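{- Let $K$ be a finite $k$-dimensional simplicial complex, where $k\ge1$, with at least two $k$-faces, and let $L^{\mathrm{up}}_{k-1}(K)$ be its unnormalized $(k-1)$-dimensional up-Laplacian. Then $$\lambda_2\bigl(L^{\mathrm{up}}_{k-1}(K)\bigr)\ \ge\ d_2(K)+k-1 .$$
   Context: A simplicial complex $K$ on a finite vertex set is a collection of subsets closed under taking subsets; a face with $m+1$ vertices has dimension $m$, and $K_j$ is the set of $j$-dimensional faces; $K$ is $k$-dimensional if $k$ is the largest dimension of a face (purity is not assumed). The $(k-1)$-faces are called ridges; the upper degree of a ridge $\rho$ is $d(\rho)=|\{F\in K_k:\rho\subset F\}|$, and $d_1(K)\ge d_2(K)\ge\cdots$ are the upper degrees of all the ridges, with multiplicity, in nonincreasing order. Choose an orientation (an ordering of the vertices, up to even permutations) of each face. The boundary matrix $B_k=([\sigma:F])_{\sigma\in K_{k-1},F\in K_k}$ has $[\sigma:F]=0$ if $\sigma\not\subset F$, and if $F=[v_0,\dots,v_k]$ and $\sigma=F\setminus\{v_i\}$ then $[\sigma:F]=(-1)^i\operatorname{sgn}(\pi)$, where $\pi$ is the permutation carrying $(v_0,\dots,\widehat{v_i},\dots,v_k)$ to the chosen ordering of $\sigma$. The up-Laplacian is $L^{\mathrm{up}}_{k-1}(K)=B_kB_k^{\mathsf T}$. For a real symmetric matrix $A$, $\lambda_1(A)\ge\lambda_2(A)\ge\cdots$ are its eigenvalues counted with multiplicity. -}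

module Defs where

open import Algebra.Bundles.Raw using (RawMonoid)
import Algebra.Definitions.RawMonoid as RawMonoidDefinitions
open import Data.Bool.Base using (if_then_else_)
import Data.Bool.Properties as Bool
open import Data.Fin.Base as Fin using (Fin; zero; suc; toℕ; punchIn; cast)
import Data.Fin.Properties as Fin
open import Data.Fin.Subset using (Subset; inside; outside; _∈_; _⊆_; _-_; ∣_∣)
open import Data.Fin.Subset.Properties using (_⊆?_; x∈p∧x≢y⇒x∈p-y)
open import Data.Integer.Base as ℤ using (ℤ; +_; 0ℤ; -1ℤ)
open import Data.List.Base using (List; []; _∷_; _++_; length; lookup; map; filter)
open import Data.List.Properties using (length-map)
open import Data.List.Relation.Binary.Permutation.Propositional.Properties using (↭-length)
import Data.List.Sort as Sort
open import Data.Nat.Base as ℕ using (ℕ; zero; suc)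
import Data.Nat.Properties as ℕ
open import Data.Product.Base using (∃; _×_; _,_; proj₁; proj₂)
open import Data.Rational.Base as ℚ using (ℚ; 0ℚ; 1ℚ; ½)
import Data.Rational.Properties as ℚ
import Data.Rational.Solver as ℚ-Solver
import Data.Vec.Base as Vec
import Data.Vec.Properties as Vec
open import Function.Bundles using (_↔_; Inverse; Injection)
open import Function.Properties.Inverse using (↔⇒↣)
open import Level using (0ℓ)
import Relation.Binary.Construct.Flip.EqAndOrd as Flip
open import Relation.Binary.Definitions using (DecidableEquality)
open import Relation.Binary.PropositionalEquality
open import Relation.Nullary.Decidable using (yes; no; does; _×-dec_)
open import Relation.Unary using (Pred; Decidable)

------------------------------------------------------------------------
-- Real numbers: Cauchy sequences of rationals, up to _≈_

IsCauchy : (ℕ → ℚ) → Set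
IsCauchy x = ∀ ε → 0ℚ ℚ.< ε → ∃ λ N → ∀ m n → N ℕ.≤ m → N ℕ.≤ n → ℚ.∣ x m ℚ.- x n ∣ ℚ.< ε

record ℝ : Set where
  constructor mkℝ
  field
    seq      : ℕ → ℚ
    isCauchy : IsCauchy seq

open ℝ public

infix 4 _≈_ _≤_ _≥_

-- Records rather than functions, so that x and y can be inferred from a proof.
record _≈_ (x y : ℝ) : Set where
  constructor mk≈
  field
    close : ∀ ε → 0ℚ ℚ.< ε →
            ∃ λ N → ∀ n → N ℕ.≤ n → ℚ.∣ seq x n ℚ.- seq y n ∣ ℚ.< ε

record _≤_ (x y : ℝ) : Set where
  constructor mk≤
  field
    below : ∀ ε → 0ℚ ℚ.< ε →
            ∃ λ N → ∀ n → N ℕ.≤ n → seq x n ℚ.< seq y n ℚ.+ ε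

_≥_ : ℝ → ℝ → Set
x ≥ y = y ≤ x

open ℚ-Solver.+-*-Solver using (solve; _:+_; _:*_; :-_; _:-_; _:=_; con)

abstract
  half : ∀ ε → 0ℚ ℚ.< ε → 0ℚ ℚ.< ½ ℚ.* ε
  half ε 0<ε = ℚ.*-monoʳ-<-pos ½ 0<ε

  halves : ∀ ε → ½ ℚ.* ε ℚ.+ ½ ℚ.* ε ≡ ε
  halves = solve 1 (λ e → con ½ :* e :+ con ½ :* e := e) refl

  rearrange₁ : ∀ a b c d → (a ℚ.+ b) ℚ.- (c ℚ.+ d) ≡ (a ℚ.- c) ℚ.+ (b ℚ.- d)
  rearrange₁ = solve 4 (λ a b c d → (a :+ b) :- (c :+ d) := (a :- c) :+ (b :- d)) refl

  rearrange₂ : ∀ a b → ℚ.- (a ℚ.- b) ≡ (ℚ.- a) ℚ.- (ℚ.- b)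
  rearrange₂ = solve 2 (λ a b → :- (a :- b) := (:- a) :- (:- b)) refl

  rearrange₃ : ∀ a b → a ≡ (a ℚ.- b) ℚ.+ b
  rearrange₃ = solve 2 (λ a b → a := (a :- b) :+ b) refl

  rearrange₄ : ∀ a b c d → a ℚ.* b ℚ.- c ℚ.* d ≡ a ℚ.* (b ℚ.- d) ℚ.+ d ℚ.* (a ℚ.- c)
  rearrange₄ = solve 4 (λ a b c d → a :* b :- c :* d := a :* (b :- d) :+ d :* (a :- c)) refl

  const-cauchy : ∀ q → IsCauchy (λ _ → q)
  const-cauchy q ε 0<ε = 0 , λ _ _ _ _ →
    subst (λ z → ℚ.∣ z ∣ ℚ.< ε) (sym (ℚ.+-inverseʳ q)) 0<ε

  +-cauchy : ∀ x y → IsCauchy x → IsCauchy y → IsCauchy (λ n → x n ℚ.+ y n)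
  +-cauchy x y cx cy ε 0<ε with cx (½ ℚ.* ε) (half ε 0<ε) | cy (½ ℚ.* ε) (half ε 0<ε)
  ... | N₁ , h₁ | N₂ , h₂ = N₁ ℕ.⊔ N₂ , λ m n N≤m N≤n →
    let open ℚ.≤-Reasoning in begin-strict
    ℚ.∣ (x m ℚ.+ y m) ℚ.- (x n ℚ.+ y n) ∣
      ≡⟨ cong ℚ.∣_∣ (rearrange₁ (x m) (y m) (x n) (y n)) ⟩
    ℚ.∣ (x m ℚ.- x n) ℚ.+ (y m ℚ.- y n) ∣
      ≤⟨ ℚ.∣p+q∣≤∣p∣+∣q∣ (x m ℚ.- x n) (y m ℚ.- y n) ⟩
    ℚ.∣ x m ℚ.- x n ∣ ℚ.+ ℚ.∣ y m ℚ.- y n ∣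
      <⟨ ℚ.+-mono-< (h₁ m n (ℕ.m⊔n≤o⇒m≤o N₁ N₂ N≤m) (ℕ.m⊔n≤o⇒m≤o N₁ N₂ N≤n))
                    (h₂ m n (ℕ.m⊔n≤o⇒n≤o N₁ N₂ N≤m) (ℕ.m⊔n≤o⇒n≤o N₁ N₂ N≤n)) ⟩
    ½ ℚ.* ε ℚ.+ ½ ℚ.* ε
      ≡⟨ halves ε ⟩
    ε ∎

  neg-cauchy : ∀ x → IsCauchy x → IsCauchy (λ n → ℚ.- x n)
  neg-cauchy x cx ε 0<ε with cx ε 0<ε
  ... | N , h = N , λ m n N≤m N≤n →
    subst (ℚ._< ε)
      (trans (sym (ℚ.∣-p∣≡∣p∣ (x m ℚ.- x n)))
             (cong ℚ.∣_∣ (rearrange₂ (x m) (x n))))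
      (h m n N≤m N≤n)

  bounded : ∀ x → IsCauchy x →
            ∃ λ C → ∃ λ N → 0ℚ ℚ.< C × (∀ n → N ℕ.≤ n → ℚ.∣ x n ∣ ℚ.≤ C)
  bounded x cx with cx 1ℚ (ℚ.positive⁻¹ 1ℚ)
  ... | N , h = 1ℚ ℚ.+ ℚ.∣ x N ∣ , N
    , ℚ.+-mono-<-≤ (ℚ.positive⁻¹ 1ℚ) (ℚ.0≤∣p∣ (x N))
    , λ n N≤n → let open ℚ.≤-Reasoning in begin
    ℚ.∣ x n ∣
      ≡⟨ cong ℚ.∣_∣ (rearrange₃ (x n) (x N)) ⟩
    ℚ.∣ (x n ℚ.- x N) ℚ.+ x N ∣
      ≤⟨ ℚ.∣p+q∣≤∣p∣+∣q∣ (x n ℚ.- x N) (x N) ⟩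
    ℚ.∣ x n ℚ.- x N ∣ ℚ.+ ℚ.∣ x N ∣
      ≤⟨ ℚ.+-monoˡ-≤ ℚ.∣ x N ∣ (ℚ.<⇒≤ (h n N N≤n ℕ.≤-refl)) ⟩
    1ℚ ℚ.+ ℚ.∣ x N ∣ ∎

  quotient : ∀ C → 0ℚ ℚ.< C → ∀ ε → 0ℚ ℚ.< ε → ∃ λ δ → 0ℚ ℚ.< δ × C ℚ.* δ ≡ ε
  quotient C 0<C ε 0<ε = ℚ.1/ C ℚ.* ε , 0<δ , C*δ≡ε
    where
    instance
      C-pos : ℚ.Positive C
      C-pos = ℚ.positive 0<C
      C-nonZero : ℚ.NonZero C
      C-nonZero = ℚ.pos⇒nonZero C
      1/C-pos : ℚ.Positive (ℚ.1/ C)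
      1/C-pos = ℚ.1/pos⇒pos C
    0<δ : 0ℚ ℚ.< ℚ.1/ C ℚ.* ε
    0<δ = subst (ℚ._< ℚ.1/ C ℚ.* ε) (ℚ.*-zeroʳ (ℚ.1/ C)) (ℚ.*-monoʳ-<-pos (ℚ.1/ C) 0<ε)
    C*δ≡ε : C ℚ.* (ℚ.1/ C ℚ.* ε) ≡ ε
    C*δ≡ε = trans (sym (ℚ.*-assoc C (ℚ.1/ C) ε))
              (trans (cong (ℚ._* ε) (ℚ.*-inverseʳ C)) (ℚ.*-identityˡ ε))

  scaled : ∀ x → IsCauchy x → ∀ C → 0ℚ ℚ.< C → ∀ ε → 0ℚ ℚ.< ε →
           ∃ λ N → ∀ m n → N ℕ.≤ m → N ℕ.≤ n → C ℚ.* ℚ.∣ x m ℚ.- x n ∣ ℚ.< ε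
  scaled x cx C 0<C ε 0<ε =
    let δ , 0<δ , C*δ≡ε = quotient C 0<C ε 0<ε
        N , h = cx δ 0<δ
    in N , λ m n N≤m N≤n →
      subst (C ℚ.* ℚ.∣ x m ℚ.- x n ∣ ℚ.<_) C*δ≡ε
        (ℚ.*-monoʳ-<-pos C {{ℚ.positive 0<C}} (h m n N≤m N≤n))

  product-bound : ∀ {C D ε} a b c d →
                  ℚ.∣ a ∣ ℚ.≤ C → ℚ.∣ d ∣ ℚ.≤ D →
                  C ℚ.* ℚ.∣ b ℚ.- d ∣ ℚ.< ½ ℚ.* ε → D ℚ.* ℚ.∣ a ℚ.- c ∣ ℚ.< ½ ℚ.* ε →
                  ℚ.∣ a ℚ.* b ℚ.- c ℚ.* d ∣ ℚ.< ε
  product-bound {C} {D} {ε} a b c d a≤C d≤D h₁ h₂ = begin-strict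
    ℚ.∣ a ℚ.* b ℚ.- c ℚ.* d ∣
      ≡⟨ cong ℚ.∣_∣ (rearrange₄ a b c d) ⟩
    ℚ.∣ a ℚ.* (b ℚ.- d) ℚ.+ d ℚ.* (a ℚ.- c) ∣
      ≤⟨ ℚ.∣p+q∣≤∣p∣+∣q∣ (a ℚ.* (b ℚ.- d)) (d ℚ.* (a ℚ.- c)) ⟩
    ℚ.∣ a ℚ.* (b ℚ.- d) ∣ ℚ.+ ℚ.∣ d ℚ.* (a ℚ.- c) ∣
      ≡⟨ cong₂ ℚ._+_ (ℚ.∣p*q∣≡∣p∣*∣q∣ a (b ℚ.- d)) (ℚ.∣p*q∣≡∣p∣*∣q∣ d (a ℚ.- c)) ⟩
    ℚ.∣ a ∣ ℚ.* ℚ.∣ b ℚ.- d ∣ ℚ.+ ℚ.∣ d ∣ ℚ.* ℚ.∣ a ℚ.- c ∣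
      ≤⟨ ℚ.+-mono-≤
           (ℚ.*-monoʳ-≤-nonNeg ℚ.∣ b ℚ.- d ∣ {{ℚ.∣-∣-nonNeg (b ℚ.- d)}} a≤C)
           (ℚ.*-monoʳ-≤-nonNeg ℚ.∣ a ℚ.- c ∣ {{ℚ.∣-∣-nonNeg (a ℚ.- c)}} d≤D) ⟩
    C ℚ.* ℚ.∣ b ℚ.- d ∣ ℚ.+ D ℚ.* ℚ.∣ a ℚ.- c ∣
      <⟨ ℚ.+-mono-< h₁ h₂ ⟩
    ½ ℚ.* ε ℚ.+ ½ ℚ.* ε
      ≡⟨ halves ε ⟩
    ε ∎
    where open ℚ.≤-Reasoning

  *-cauchy : ∀ x y → IsCauchy x → IsCauchy y → IsCauchy (λ n → x n ℚ.* y n)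
  *-cauchy x y cx cy ε 0<ε =
    let C , N₁ , 0<C , bx = bounded x cx
        D , N₂ , 0<D , by = bounded y cy
        N₃ , h₃ = scaled y cy C 0<C (½ ℚ.* ε) (half ε 0<ε)
        N₄ , h₄ = scaled x cx D 0<D (½ ℚ.* ε) (half ε 0<ε)
        l : ∀ {p} → (N₁ ℕ.⊔ N₂) ℕ.⊔ (N₃ ℕ.⊔ N₄) ℕ.≤ p → N₁ ℕ.⊔ N₂ ℕ.≤ p
        l = ℕ.m⊔n≤o⇒m≤o (N₁ ℕ.⊔ N₂) (N₃ ℕ.⊔ N₄)
        r : ∀ {p} → (N₁ ℕ.⊔ N₂) ℕ.⊔ (N₃ ℕ.⊔ N₄) ℕ.≤ p → N₃ ℕ.⊔ N₄ ℕ.≤ p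
        r = ℕ.m⊔n≤o⇒n≤o (N₁ ℕ.⊔ N₂) (N₃ ℕ.⊔ N₄)
    in (N₁ ℕ.⊔ N₂) ℕ.⊔ (N₃ ℕ.⊔ N₄) , λ m n N≤m N≤n →
    product-bound {C} {D} {ε} (x m) (y m) (x n) (y n)
      (bx m (ℕ.m⊔n≤o⇒m≤o N₁ N₂ (l N≤m)))
      (by n (ℕ.m⊔n≤o⇒n≤o N₁ N₂ (l N≤n)))
      (h₃ m n (ℕ.m⊔n≤o⇒m≤o N₃ N₄ (r N≤m)) (ℕ.m⊔n≤o⇒m≤o N₃ N₄ (r N≤n)))
      (h₄ m n (ℕ.m⊔n≤o⇒n≤o N₃ N₄ (r N≤m)) (ℕ.m⊔n≤o⇒n≤o N₃ N₄ (r N≤n)))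

fromℤ : ℤ → ℝ
fromℤ z = mkℝ (λ _ → z ℚ./ 1) (const-cauchy (z ℚ./ 1))

fromℕ : ℕ → ℝ
fromℕ n = fromℤ (+ n)

infixl 6 _+ᵣ_ _-ᵣ_
infixl 7 _*ᵣ_

_+ᵣ_ : ℝ → ℝ → ℝ
x +ᵣ y = mkℝ (λ n → seq x n ℚ.+ seq y n) (+-cauchy (seq x) (seq y) (isCauchy x) (isCauchy y))

-ᵣ_ : ℝ → ℝ
-ᵣ x = mkℝ (λ n → ℚ.- seq x n) (neg-cauchy (seq x) (isCauchy x))

_-ᵣ_ : ℝ → ℝ → ℝ
x -ᵣ y = x +ᵣ (-ᵣ y)

_*ᵣ_ : ℝ → ℝ → ℝ
x *ᵣ y = mkℝ (λ n → seq x n ℚ.* seq y n) (*-cauchy (seq x) (seq y) (isCauchy x) (isCauchy y))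

+ᵣ-rawMonoid : RawMonoid 0ℓ 0ℓ
+ᵣ-rawMonoid = record { Carrier = ℝ ; _≈_ = _≈_ ; _∙_ = _+ᵣ_ ; ε = fromℤ 0ℤ }

open RawMonoidDefinitions +ᵣ-rawMonoid using () renaming (sum to sumᵣ) public
open RawMonoidDefinitions ℕ.+-0-rawMonoid using () renaming (sum to sumℕ) public
open RawMonoidDefinitions ℤ.+-0-rawMonoid using () renaming (sum to sumℤ) public

------------------------------------------------------------------------
-- Eigenvalues counted with multiplicity

Vector : ℕ → Set
Vector n = Fin n → ℝ

Matrix : Set → ℕ → ℕ → Set
Matrix A m n = Fin m → Fin n → A

infix 4 _≋_
_≋_ : ∀ {n} → Vector n → Vector n → Set
u ≋ v = ∀ i → u i ≈ v i

0ᵥ : ∀ {n} → Vector n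
0ᵥ _ = fromℤ 0ℤ

infixr 7 _·_ _⋆_

_·_ : ∀ {m n} → Matrix ℝ m n → Vector n → Vector m
(A · v) i = sumᵣ (λ j → A i j *ᵣ v j)

_⋆_ : ∀ {n} → ℝ → Vector n → Vector n
(c ⋆ v) i = c *ᵣ v i

combination : ∀ {m n} → (Fin m → ℝ) → (Fin m → Vector n) → Vector n
combination c v j = sumᵣ (λ i → c i *ᵣ v i j)

record IsBasis {n} (v : Fin n → Vector n) : Set where
  field
    independent : ∀ c → combination c v ≋ 0ᵥ → ∀ i → c i ≈ fromℤ 0ℤ
    spanning    : ∀ x → ∃ λ c → x ≋ combination c v

-- Used for symmetric A only.  In a basis of eigenvectors, each real μ occurs
-- among the associated eigenvalues exactly dim ker (A - μ) times.  The position
-- i : Fin n is zero-based, so λ_{j+1}(A) is ev i with toℕ i = j.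
record Eigenvalues {n} (A : Matrix ℝ n n) (ev : Fin n → ℝ) : Set where
  field
    nonincreasing : ∀ {i j} → i Fin.≤ j → ev i ≥ ev j
    eigenvector   : Fin n → Vector n
    isBasis       : IsBasis eigenvector
    isEigenvector : ∀ i → A · eigenvector i ≋ ev i ⋆ eigenvector i

------------------------------------------------------------------------
-- Simplicial complexes

-- Decidability of membership is what makes the complex a finite collection
-- constructively.  Not every element of Fin N need be a vertex of the complex.
record SimplicialComplex (N : ℕ) : Set₁ where
  field
    Face   : Pred (Subset N) 0ℓ
    face?  : Decidable Face
    closed : ∀ {s t} → s ⊆ t → Face t → Face s

subsets : ∀ N → List (Subset N)
subsets zero    = Vec.[] ∷ []
subsets (suc N) = map (outside Vec.∷_) (subsets N) ++ map (inside Vec.∷_) (subsets N)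

infix 4 _≟ₛ_
_≟ₛ_ : ∀ {N} → DecidableEquality (Subset N)
_≟ₛ_ = Vec.≡-dec Bool._≟_

module _ {N} (K : SimplicialComplex N) where
  open SimplicialComplex K

  HasDimension : ℕ → Set
  HasDimension k = (∃ λ s → Face s × ∣ s ∣ ≡ suc k) × (∀ s → Face s → ∣ s ∣ ℕ.≤ suc k)

  -- Faces are graded by their number of vertices: the (m-1)-dimensional faces,
  -- each listed once.
  faces : ℕ → List (Subset N)
  faces m = filter (λ s → face? s ×-dec (∣ s ∣ ℕ.≟ m)) (subsets N)

  #faces : ℕ → ℕ
  #faces m = length (faces m)

  face : ∀ m → Fin (#faces m) → Subset N
  face m = lookup (faces m)

  upperDegree : ℕ → Subset N → ℕ
  upperDegree k ρ = length (filter (ρ ⊆?_) (faces (suc k)))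

  open Sort (Flip.decTotalOrder ℕ.≤-decTotalOrder) using (sort; sort-↭)

  ridgeDegrees : ℕ → List ℕ
  ridgeDegrees k = map (upperDegree k) (faces k)

  length-degrees : ∀ k → #faces k ≡ length (sort (ridgeDegrees k))
  length-degrees k =
    sym (trans (↭-length (sort-↭ (ridgeDegrees k))) (length-map (upperDegree k) (faces k)))

  -- The upper degrees of the (k-1)-faces of a k-dimensional complex in
  -- nonincreasing order; position i is zero-based, as for Eigenvalues.
  degree : ∀ k → Fin (#faces k) → ℕ
  degree k i = lookup (sort (ridgeDegrees k)) (cast (length-degrees k) i)

------------------------------------------------------------------------
-- Orientations and the boundary matrix

∈-irrelevant : ∀ {N} {v : Fin N} {s : Subset N} (p q : v ∈ s) → p ≡ q
∈-irrelevant Vec.here      Vec.here      = refl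
∈-irrelevant (Vec.there p) (Vec.there q) = cong Vec.there (∈-irrelevant p q)

-- A listing of the vertices of s without repetition.
Ordering : ∀ {N} → ℕ → Subset N → Set
Ordering m s = Fin m ↔ ∃ (_∈ s)

-- An orientation, given for each face by an ordering representing it.
Orientation : ∀ {N} → SimplicialComplex N → Set
Orientation K = ∀ m (i : Fin (#faces K m)) → Ordering m (face K m i)

inversions : ∀ {m} → (Fin m → Fin m) → ℕ
inversions π = sumℕ λ i → sumℕ λ j →
  if does ((i Fin.<? j) ×-dec (π j Fin.<? π i)) then 1 else 0

-- The sign when π is a permutation.
sgn : ∀ {m} → (Fin m → Fin m) → ℤ
sgn π = -1ℤ ℤ.^ inversions π

module _ {N} {m : ℕ} {F : Subset N} (oF : Ordering m F) where

  vertex : Fin m → Fin N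
  vertex i = proj₁ (Inverse.to oF i)

  vertex-injective : ∀ {i j} → vertex i ≡ vertex j → i ≡ j
  vertex-injective {i} {j} eq =
    Injection.injective (↔⇒↣ oF) (Σ-≡ (Inverse.to oF i) (Inverse.to oF j) eq)
    where
    Σ-≡ : (p q : ∃ (_∈ F)) → proj₁ p ≡ proj₁ q → p ≡ q
    Σ-≡ (v , p) (.v , q) refl = cong (v ,_) (∈-irrelevant p q)

module _ {N} {m : ℕ} {σ F : Subset N} (oσ : Ordering m σ) (oF : Ordering (suc m) F) where

  -- The permutation carrying (v₀, …, v̂ᵢ, …, v_m) to the ordering of σ: the j-th
  -- remaining vertex of F is the π(j)-th vertex of σ.
  carry : ∀ i → σ ≡ F - vertex oF i → Fin m → Fin m
  carry i σ≡F-vᵢ j = Inverse.from oσ (vertex oF (punchIn i j) , ∈σ)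
    where
    ∈σ : vertex oF (punchIn i j) ∈ σ
    ∈σ = subst (vertex oF (punchIn i j) ∈_) (sym σ≡F-vᵢ)
           (x∈p∧x≢y⇒x∈p-y (proj₂ (Inverse.to oF (punchIn i j)))
             (λ eq → Fin.punchInᵢ≢i i j (vertex-injective oF eq)))

  -- As |F| = |σ| + 1, there is an i with σ = F ∖ {vᵢ} exactly when σ ⊆ F.
  incidence : ℤ
  incidence with Fin.any? (λ i → σ ≟ₛ F - vertex oF i)
  ... | yes (i , eq) = (-1ℤ ℤ.^ toℕ i) ℤ.* sgn (carry i eq)
  ... | no _         = 0ℤ

module _ {N} (K : SimplicialComplex N) (o : Orientation K) where

  -- B_k: rows are the faces with k vertices, columns those with k+1 vertices.
  boundary : ∀ k → Matrix ℤ (#faces K k) (#faces K (suc k))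
  boundary k ρ F = incidence (o k ρ) (o (suc k) F)

  -- L^up_{k-1} = B_k B_kᵀ.
  upLaplacian : ∀ k → Matrix ℤ (#faces K k) (#faces K k)
  upLaplacian k ρ ρ′ = sumℤ λ F → boundary k ρ F ℤ.* boundary k ρ′ F

realMatrix : ∀ {m n} → Matrix ℤ m n → Matrix ℝ m n
realMatrix A i j = fromℤ (A i j)

{-# OPTIONS --safe #-}

-- Write B for the boundary matrix and M = BᵀB, so that L = BBᵀ.  If a plane of
-- vectors y satisfies |By|² ≥ c|y|², then ⟨x, Lx⟩ ≥ c|x|² for x = By, because
-- |Bᵀx - cy|² ≥ 0; if moreover c ≥ 1 and the plane of the x is nondegenerate, then
-- λ₂(L) ≥ c.  For d₂ ≤ 1 take the plane of two k-faces and c = k, where the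
-- off-diagonal entry of M is in {-1, 0, 1}.  For d₂ ≥ 2 take the rows of B at the
-- two ridges ρ₁, ρ₂ of largest degrees d₁ ≥ d₂ and c = d₂ + k - 1.
-- If a ridge ρ lies in the k-face F, then the entry at F of M applied to the row of ρ
-- is (d(ρ) + k)[ρ : F].  Otherwise at most two k-faces containing ρ share a ridge
-- with F, and their contributions to this entry have opposite signs.  So M - c maps
-- the row of ρ₂ to a vector with entries in {-1, 0, 1}, and the Gram matrix of M - c
-- on the two rows is positive semidefinite: its diagonal is d₁(d₁ - d₂ + 1), d₂ and
-- its off-diagonal entry is at most d₁ in absolute value.
module Submission where

open import Defs
open import Data.Nat.Base using (ℕ; suc) renaming (_≤_ to _≤ℕ_; _<_ to _<ℕ_)
open import Data.Fin.Base using (Fin; fromℕ<)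
open import Data.Product.Base using (Σ-syntax)

open import Algebra.Bundles using (CommutativeMonoid; CommutativeRing)
import Algebra.Properties.CommutativeMonoid.Sum as MonoidSum
import Algebra.Properties.Semiring.Sum as SemiringSum
open import Data.Bool.Base using (Bool; true; false; not; _∧_; if_then_else_)
open import Data.Fin.Base as Fin using (zero; suc; toℕ; punchIn; punchOut; cast)
open import Data.Fin.Permutation using (Permutation′; permutation; _⟨$⟩ʳ_; _⟨$⟩ˡ_; inverseˡ)
import Data.Fin.Properties as Fin
open import Data.Fin.Subset using (Subset; inside; outside; _∈_; _∉_; _⊆_; _-_; ∣_∣)
open import Data.Fin.Subset.Properties
  using (_⊆?_; _∈?_; x∈p∧x≢y⇒x∈p-y; p─q⊆p; p─x─y≡p─y─x; p─⊥≡p; p⊂q⇒∣p∣<∣q∣; p⊆q⇒∣p∣≤∣q∣; ⊆-antisym)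
open import Data.Integer.Base as ℤ using (ℤ; +_; -1ℤ; 1ℤ; 0ℤ)
import Data.Integer.Properties as ℤ
open import Data.Integer.Tactic.RingSolver as ℤ-Solver using ()
open import Data.List.Base using (List; []; _∷_; length; lookup; map; filter)
open import Data.List.Membership.Propositional using () renaming (_∈_ to _∈ˡ_)
open import Data.List.Membership.Propositional.Properties
  using (∈-map⁺; ∈-map⁻; ∈-++⁺ˡ; ∈-++⁺ʳ; ∈-filter⁺; ∈-filter⁻; ∈-lookup)
open import Data.List.Properties using (length-map)
import Data.List.Relation.Binary.Permutation.Homogeneous as Permutation
open import Data.List.Relation.Binary.Permutation.Propositional using (↭⇒↭ₛ)
import Data.List.Relation.Binary.Permutation.Setoid.Properties as PermutationSetoid
open import Data.List.Relation.Unary.All as All using ()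
open import Data.List.Relation.Unary.AllPairs using ([]; _∷_)
open import Data.List.Relation.Unary.Any using (here; there; index)
open import Data.List.Relation.Unary.Any.Properties using (lookup-index)
import Data.List.Relation.Unary.Sorted.TotalOrder.Properties as Sorted
open import Data.List.Relation.Unary.Unique.Propositional using (Unique)
import Data.List.Relation.Unary.Unique.Propositional.Properties as Unique
import Data.List.Sort as Sort
open import Data.Nat.Base as ℕ using (zero)
import Data.Nat.Properties as ℕ
open import Data.Nat.Tactic.RingSolver as ℕ-Solver using ()
open import Data.Product.Base using (∃; _×_; _,_; proj₁; proj₂)
open import Data.Rational.Base as ℚ using (ℚ; 0ℚ; 1ℚ; ½)
import Data.Rational.Properties as ℚ
import Data.Rational.Unnormalised.Base as ℚᵘ
import Data.Rational.Unnormalised.Properties as ℚᵘ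
open import Data.Sum.Base using (inj₁; inj₂)
open import Data.Vec.Base as Vec using (_∷_; here; there)
open import Data.Vec.Functional using (removeAt)
import Data.Vec.Properties as Vec
open import Function.Base using (_∘_)
open import Function.Bundles using (Inverse; Injection; mk⇔)
open import Function.Properties.Inverse using (↔⇒↣)
open import Level using (0ℓ)
open import Relation.Binary.Bundles using (DecTotalOrder)
import Relation.Binary.Construct.Flip.EqAndOrd as Flip
open import Relation.Binary.Definitions using (tri<; tri≈; tri>)
open import Relation.Binary.PropositionalEquality
import Relation.Binary.Reasoning.Setoid as SetoidReasoning
open import Relation.Nullary using (Dec; yes; no; does; ¬_; contradiction)
open import Relation.Nullary.Decidable
  using (dec-true; dec-false; does-⇔; dec⇒maybe; _×-dec_; ¬?; decidable-stable; from-no)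
open import Relation.Unary using (Pred; Decidable)
import Tactic.RingSolver as RingSolver
open import Tactic.RingSolver.Core.AlmostCommutativeRing using (AlmostCommutativeRing; fromCommutativeRing)

-- Parity of inversions

-- The case d₂ ≤ 1 is separate because the rows may then be degenerate: a ridge of degree 0 has a
-- zero row, and two ridges of degree 1 in one k-face have rows equal up to sign. The constant comes
-- from the k-faces around a ridge ρ with row b: there M restricts to bbᵀ + k, which multiplies b by
-- d(ρ) + k. Lowering this factor by one leaves b itself, so the entries there are as small as those
-- at the other k-faces. Pairing with the row of ρ₁ then costs at most its d₁ nonzero entries, and
-- the determinant is at least d₁(d₁ - d₂)(d₂ - 1). Two obstacles shape the rest. Each face carries
-- an arbitrary ordering, so incidence numbers are first brought to a form in which an ordering
-- enters only through one sign per face; these signs cancel in products. And real numbers cannot be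
-- compared or tested for zero, so all combinatorial inequalities stay in ℤ, and the passage to ℝ
-- avoids case distinctions on real quantities.

module Σℕ = SemiringSum ℕ.+-*-semiring

ι : Bool → ℕ
ι b = if b then 1 else 0

lt : ∀ {n} → Fin n → Fin n → Bool
lt i j = does (i Fin.<? j)

lt-irrefl : ∀ {n} (i : Fin n) → lt i i ≡ false
lt-irrefl i = dec-false (i Fin.<? i) (Fin.<-irrefl refl)

lt-flip : ∀ {n} {i j : Fin n} → i ≢ j → lt j i ≡ not (lt i j)
lt-flip {i = i} {j} i≢j with Fin.<-cmp i j
... | tri< i<j _ j≮i = trans (dec-false (j Fin.<? i) j≮i) (cong not (sym (dec-true (i Fin.<? j) i<j)))
... | tri≈ _ i≡j _   = contradiction i≡j i≢j
... | tri> i≮j _ j<i = trans (dec-true (j Fin.<? i) j<i) (cong not (sym (dec-false (i Fin.<? j) i≮j)))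

-- Unfolds to `inversions` on self-maps; the free codomain lets it apply to a listing of vertices as
-- well.
inv : ∀ {m n} → (Fin m → Fin n) → ℕ
inv f = sumℕ λ i → sumℕ λ j → ι (lt i j ∧ lt (f j) (f i))

Even : ℕ → Set
Even n = ∃ λ k → n ≡ k ℕ.+ k

even-sum : ∀ {n} (f : Fin n → ℕ) → (∀ i → Even (f i)) → Even (sumℕ f)
even-sum f ev = sumℕ (proj₁ ∘ ev) ,
  trans (Σℕ.sum-cong-≗ (proj₂ ∘ ev)) (Σℕ.∑-distrib-+ (proj₁ ∘ ev) (proj₁ ∘ ev))

halve : ∀ {m n} → m ℕ.+ m ≡ n ℕ.+ n → m ≡ n
halve {m} {n} eq with ℕ.<-cmp m n
... | tri< m<n _ _ = contradiction eq (ℕ.<⇒≢ (ℕ.+-mono-< m<n m<n))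
... | tri≈ _ m≡n _ = m≡n
... | tri> _ _ n<m = contradiction (sym eq) (ℕ.<⇒≢ (ℕ.+-mono-< n<m n<m))

∑∑-cong : ∀ {m n} {f g : Fin m → Fin n → ℕ} → (∀ i j → f i j ≡ g i j) →
          sumℕ (λ i → sumℕ (f i)) ≡ sumℕ (λ i → sumℕ (g i))
∑∑-cong eq = Σℕ.sum-cong-≗ λ i → Σℕ.sum-cong-≗ (eq i)

∑∑-distrib-+ : ∀ {m n} (f g : Fin m → Fin n → ℕ) →
  sumℕ (λ i → sumℕ λ j → f i j ℕ.+ g i j) ≡ sumℕ (λ i → sumℕ (f i)) ℕ.+ sumℕ (λ i → sumℕ (g i))
∑∑-distrib-+ f g = trans (Σℕ.sum-cong-≗ λ i → Σℕ.∑-distrib-+ (f i) (g i))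
                         (Σℕ.∑-distrib-+ (λ i → sumℕ (f i)) (λ i → sumℕ (g i)))

∑∑-symmetric : ∀ {m} (h : Fin m → Fin m → ℕ) → (∀ i j → h i j ≡ h j i) → (∀ i → h i i ≡ 0) →
  let below = sumℕ λ i → sumℕ λ j → ι (lt i j) ℕ.* h i j in
  sumℕ (λ i → sumℕ (h i)) ≡ below ℕ.+ below
∑∑-symmetric h h-sym h-diag = begin
  sumℕ (λ i → sumℕ (h i))
    ≡⟨ ∑∑-cong split ⟩
  sumℕ (λ i → sumℕ λ j → ι (lt i j) ℕ.* h i j ℕ.+ ι (lt j i) ℕ.* h j i)
    ≡⟨ ∑∑-distrib-+ (λ i j → ι (lt i j) ℕ.* h i j) (λ i j → ι (lt j i) ℕ.* h j i) ⟩
  below ℕ.+ sumℕ (λ i → sumℕ λ j → ι (lt j i) ℕ.* h j i)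
    ≡⟨ cong (below ℕ.+_) (Σℕ.∑-comm λ i j → ι (lt j i) ℕ.* h j i) ⟩
  below ℕ.+ below ∎
  where
  open ≡-Reasoning
  below = sumℕ λ i → sumℕ λ j → ι (lt i j) ℕ.* h i j
  split : ∀ i j → h i j ≡ ι (lt i j) ℕ.* h i j ℕ.+ ι (lt j i) ℕ.* h j i
  split i j with i Fin.≟ j
  ... | yes refl rewrite lt-irrefl i = h-diag i
  ... | no i≢j rewrite lt-flip i≢j | h-sym j i with lt i j
  ...   | true  = trans (sym (ℕ.+-identityʳ (h i j))) (cong (ℕ._+ 0) (sym (ℕ.+-identityʳ (h i j))))
  ...   | false = sym (ℕ.+-identityʳ (h i j))

-- Multiplicativity of the sign, for an injective listing `b`: a pair is inverted by the composite
-- exactly when one, but not both, of `π` and `b` (on the image pair) inverts it.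
inv-∘ : ∀ {m n} (b : Fin m → Fin n) → (∀ {i j} → b i ≡ b j → i ≡ j) → (π : Permutation′ m) →
        Even (inv (λ j → b (π ⟨$⟩ʳ j)) ℕ.+ inv (π ⟨$⟩ʳ_) ℕ.+ inv b)
inv-∘ {m} b b-inj π = subst Even (sym total) (even-sum _ λ i → even-sum _ (term-even i))
  where
  open ≡-Reasoning
  p : Fin m → Fin m
  p = π ⟨$⟩ʳ_
  p-inj : ∀ {i j} → p i ≡ p j → i ≡ j
  p-inj eq = trans (sym (inverseˡ π)) (trans (cong (π ⟨$⟩ˡ_) eq) (inverseˡ π))
  I : Fin m → Fin m → ℕ
  I i j = ι (lt i j ∧ lt (b j) (b i))
  -- Indicator that `b` inverts the unordered pair, whichever of the two indices comes first.
  h : Fin m → Fin m → ℕ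
  h i j = I i j ℕ.+ I j i
  I-diag : ∀ i → I i i ≡ 0
  I-diag i rewrite lt-irrefl i = refl
  h-sym : ∀ i j → h i j ≡ h j i
  h-sym i j = ℕ.+-comm (I i j) (I j i)
  h-diag : ∀ i → h i i ≡ 0
  h-diag i = cong₂ ℕ._+_ (I-diag i) (I-diag i)
  pulled : ℕ
  pulled = sumℕ λ i → sumℕ λ j → ι (lt i j) ℕ.* h (p i) (p j)
  -- Reindexing by `π` does not preserve i < j. Doubling both sides turns them into sums over all
  -- ordered pairs, which a permutation leaves unchanged.
  pulled≡inv : pulled ≡ inv b
  pulled≡inv = halve (begin
    pulled ℕ.+ pulled
      ≡⟨ ∑∑-symmetric (λ i j → h (p i) (p j)) (λ i j → h-sym (p i) (p j)) (λ i → h-diag (p i)) ⟨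
    sumℕ (λ i → sumℕ λ j → h (p i) (p j))
      ≡⟨ Σℕ.sum-cong-≗ (λ i → Σℕ.sum-permute (h (p i)) π) ⟨
    sumℕ (λ i → sumℕ (h (p i)))
      ≡⟨ Σℕ.sum-permute (λ i → sumℕ (h i)) π ⟨
    sumℕ (λ i → sumℕ (h i))
      ≡⟨ ∑∑-distrib-+ I (λ i j → I j i) ⟩
    inv b ℕ.+ sumℕ (λ i → sumℕ λ j → I j i)
      ≡⟨ cong (inv b ℕ.+_) (Σℕ.∑-comm λ i j → I j i) ⟩
    inv b ℕ.+ inv b ∎)
  term : Fin m → Fin m → ℕ
  term i j = ι (lt i j ∧ lt (b (p j)) (b (p i))) ℕ.+ ι (lt i j ∧ lt (p j) (p i)) ℕ.+ ι (lt i j) ℕ.* h (p i) (p j)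
  total : inv (λ j → b (p j)) ℕ.+ inv p ℕ.+ inv b ≡ sumℕ (λ i → sumℕ (term i))
  total = begin
    inv (λ j → b (p j)) ℕ.+ inv p ℕ.+ inv b ≡⟨ cong₂ ℕ._+_ (∑∑-distrib-+ C P) pulled≡inv ⟨
    sumℕ (λ i → sumℕ λ j → C i j ℕ.+ P i j) ℕ.+ pulled
      ≡⟨ ∑∑-distrib-+ (λ i j → C i j ℕ.+ P i j) (λ i j → ι (lt i j) ℕ.* h (p i) (p j)) ⟨
    sumℕ (λ i → sumℕ (term i)) ∎
    where
    C P : Fin m → Fin m → ℕ
    C i j = ι (lt i j ∧ lt (b (p j)) (b (p i)))
    P i j = ι (lt i j ∧ lt (p j) (p i))
  -- The bits say whether i < j, whether `π` keeps the pair in increasing order, and whether the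
  -- composite does.
  bits : ∀ x y z → Even (ι (x ∧ not z) ℕ.+ ι (x ∧ not y) ℕ.+ ι x ℕ.* (ι (y ∧ not z) ℕ.+ ι (not y ∧ z)))
  bits false _ _         = 0 , refl
  bits true false false  = 1 , refl
  bits true false true   = 1 , refl
  bits true true  false  = 1 , refl
  bits true true  true   = 0 , refl
  term-even : ∀ i j → Even (term i j)
  term-even i j with i Fin.≟ j
  ... | yes refl rewrite lt-irrefl i = 0 , refl
  ... | no i≢j rewrite lt-flip {i = p i} {p j} (i≢j ∘ p-inj)
                     | lt-flip {i = b (p i)} {b (p j)} (i≢j ∘ p-inj ∘ b-inj) =
    bits (lt i j) (lt (p i) (p j)) (lt (b (p i)) (b (p j)))

below : ∀ {m n} → (Fin m → Fin n) → Fin n → ℕ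
below a v = sumℕ λ j → ι (lt (a j) v)

lt-punchIn : ∀ {n} (i : Fin (suc n)) j k → lt (punchIn i j) (punchIn i k) ≡ lt j k
lt-punchIn i j k = does-⇔ (mk⇔
  (λ lt′ → Fin.≤∧≢⇒< (Fin.punchIn-cancel-≤ i j k (ℕ.<⇒≤ lt′)) (Fin.<⇒≢ lt′ ∘ cong (punchIn i)))
  (λ j<k → Fin.≤∧≢⇒< (Fin.punchIn-mono-≤ i j k (ℕ.<⇒≤ j<k)) (Fin.<⇒≢ j<k ∘ Fin.punchIn-injective i j k)))
  (punchIn i j Fin.<? punchIn i k) (j Fin.<? k)

lt-zero : ∀ {n} (j : Fin (suc n)) → lt j zero ≡ false
lt-zero _ = refl

below-id : ∀ {n} (i : Fin n) → below (λ j → j) i ≡ toℕ i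
below-id {suc n} zero    = trans (Σℕ.sum-cong-≗ {suc n} λ j → cong ι (lt-zero j))
                             (Σℕ.sum-replicate-zero (suc n))
below-id {suc n} (suc i) = cong suc
  (trans (Σℕ.sum-cong-≗ {n} (λ j → cong ι (lt-punchIn zero j i))) (below-id i))

-- Deleting entry `i` loses the inversions that involve `i`. An entry `q` forms one exactly when
-- precisely one of q < i and a q < a i holds, so their number has the parity of `toℕ i` plus
-- `below a (a i)`.
inv-punchIn : ∀ {m n} (a : Fin (suc m) → Fin n) → (∀ {i j} → a i ≡ a j → i ≡ j) → ∀ i →
              Even (inv a ℕ.+ inv (a ∘ punchIn i) ℕ.+ (toℕ i ℕ.+ below a (a i)))
inv-punchIn {m} a a-inj i = subst Even (sym total) (even-+ (I′ , refl) (even-sum term term-even))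
  where
  open ≡-Reasoning
  even-+ : ∀ {x y} → Even x → Even y → Even (x ℕ.+ y)
  even-+ (k , refl) (l , refl) = k ℕ.+ l , lemma k l
    where
    lemma : ∀ k l → k ℕ.+ k ℕ.+ (l ℕ.+ l) ≡ k ℕ.+ l ℕ.+ (k ℕ.+ l)
    lemma = ℕ-Solver.solve-∀
  I : Fin (suc m) → Fin (suc m) → ℕ
  I p q = ι (lt p q ∧ lt (a q) (a p))
  I′ = inv (a ∘ punchIn i)
  term : Fin (suc m) → ℕ
  term q = I i q ℕ.+ I q i ℕ.+ (ι (lt q i) ℕ.+ ι (lt (a q) (a i)))
  I-diag : I i i ≡ 0
  I-diag rewrite lt-irrefl i = refl
  cross : inv a ≡ sumℕ (λ q → I i q ℕ.+ I q i) ℕ.+ I′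
  cross = begin
    inv a
      ≡⟨ Σℕ.sum-remove {i = i} (λ p → sumℕ (I p)) ⟩
    sumℕ (I i) ℕ.+ sumℕ (λ p → sumℕ (I (punchIn i p)))
      ≡⟨ cong (sumℕ (I i) ℕ.+_) (Σℕ.sum-cong-≗ λ p → Σℕ.sum-remove {i = i} (I (punchIn i p))) ⟩
    sumℕ (I i) ℕ.+ sumℕ (λ p → I (punchIn i p) i ℕ.+ sumℕ (λ q → I (punchIn i p) (punchIn i q)))
      ≡⟨ cong (sumℕ (I i) ℕ.+_) (Σℕ.∑-distrib-+ (λ p → I (punchIn i p) i) _) ⟩
    sumℕ (I i) ℕ.+ (sumℕ (λ p → I (punchIn i p) i) ℕ.+ sumℕ (λ p → sumℕ (λ q → I (punchIn i p) (punchIn i q))))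
      ≡⟨ cong (λ s → sumℕ (I i) ℕ.+ (s ℕ.+ sumℕ (λ p → sumℕ (λ q → I (punchIn i p) (punchIn i q)))))
           (sym (trans (Σℕ.sum-remove {i = i} (λ p → I p i))
             (cong (ℕ._+ sumℕ (λ p → I (punchIn i p) i)) I-diag))) ⟩
    sumℕ (I i) ℕ.+ (sumℕ (λ p → I p i) ℕ.+ sumℕ (λ p → sumℕ (λ q → I (punchIn i p) (punchIn i q))))
      ≡⟨ cong (λ s → sumℕ (I i) ℕ.+ (sumℕ (λ p → I p i) ℕ.+ s))
           (∑∑-cong λ p q → cong (λ b → ι (b ∧ lt (a (punchIn i q)) (a (punchIn i p)))) (lt-punchIn i p q)) ⟩
    sumℕ (I i) ℕ.+ (sumℕ (λ p → I p i) ℕ.+ I′)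
      ≡⟨ ℕ.+-assoc (sumℕ (I i)) _ I′ ⟨
    sumℕ (I i) ℕ.+ sumℕ (λ p → I p i) ℕ.+ I′
      ≡⟨ cong (ℕ._+ I′) (Σℕ.∑-distrib-+ (I i) (λ p → I p i)) ⟨
    sumℕ (λ q → I i q ℕ.+ I q i) ℕ.+ I′ ∎
  total : inv a ℕ.+ I′ ℕ.+ (toℕ i ℕ.+ below a (a i)) ≡ (I′ ℕ.+ I′) ℕ.+ sumℕ term
  total = begin
    inv a ℕ.+ I′ ℕ.+ (toℕ i ℕ.+ below a (a i))
      ≡⟨ cong₂ (λ s t → s ℕ.+ I′ ℕ.+ (t ℕ.+ below a (a i))) cross (sym (below-id i)) ⟩
    X ℕ.+ I′ ℕ.+ I′ ℕ.+ (below (λ j → j) i ℕ.+ below a (a i))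
      ≡⟨ rearrange X I′ _ ⟩
    I′ ℕ.+ I′ ℕ.+ (X ℕ.+ (below (λ j → j) i ℕ.+ below a (a i)))
      ≡⟨ cong (λ s → I′ ℕ.+ I′ ℕ.+ (X ℕ.+ s)) (Σℕ.∑-distrib-+ (λ q → ι (lt q i)) (λ q → ι (lt (a q) (a i)))) ⟨
    I′ ℕ.+ I′ ℕ.+ (X ℕ.+ sumℕ (λ q → ι (lt q i) ℕ.+ ι (lt (a q) (a i))))
      ≡⟨ cong (I′ ℕ.+ I′ ℕ.+_) (Σℕ.∑-distrib-+ (λ q → I i q ℕ.+ I q i) (λ q → ι (lt q i) ℕ.+ ι (lt (a q) (a i)))) ⟨
    I′ ℕ.+ I′ ℕ.+ sumℕ term ∎
    where
    X = sumℕ (λ q → I i q ℕ.+ I q i)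
    rearrange : ∀ x y z → x ℕ.+ y ℕ.+ y ℕ.+ z ≡ y ℕ.+ y ℕ.+ (x ℕ.+ z)
    rearrange = ℕ-Solver.solve-∀
  bits : ∀ x y → Even (ι (x ∧ y) ℕ.+ ι (not x ∧ not y) ℕ.+ (ι (not x) ℕ.+ ι y))
  bits false false = 1 , refl
  bits false true  = 1 , refl
  bits true  false = 0 , refl
  bits true  true  = 1 , refl
  term-even : ∀ q → Even (term q)
  term-even q with i Fin.≟ q
  ... | yes refl rewrite lt-irrefl i | lt-irrefl (a i) = 0 , refl
  ... | no i≢q rewrite lt-flip {i = i} {q} i≢q
                     | lt-flip {i = a q} {a i} (i≢q ∘ sym ∘ a-inj) = bits (lt i q) (lt (a q) (a i))

-- Incidence numbers in terms of vertex ranks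

module _ {c ℓ} (M : CommutativeMonoid c ℓ) where
  open CommutativeMonoid M renaming (_≈_ to _∼_; trans to ∼-trans)
  open MonoidSum M using (sum; sum-cong-≋; sum-replicate-zero; sum-remove)

  sum-single : ∀ {n} (f : Fin n → Carrier) i → (∀ j → j ≢ i → f j ∼ ε) → sum f ∼ f i
  sum-single {suc n} f i f≈ε = ∼-trans (sum-remove {i = i} f) (∼-trans
    (∙-congˡ (∼-trans (sum-cong-≋ {n} {removeAt f i} (λ j → f≈ε (punchIn i j) (Fin.punchInᵢ≢i i j)))
                      (sum-replicate-zero n)))
    (identityʳ (f i)))

x∉p-x : ∀ {n} (p : Subset n) x → x ∉ p - x
x∉p-x (outside ∷ p) zero ()
x∉p-x (inside  ∷ p) zero ()
x∉p-x (s ∷ p) (suc x) (there x∈) = x∉p-x p x x∈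

∈-remove : ∀ {n} {p : Subset n} {x y} → x ∈ p - y → x ∈ p × x ≢ y
∈-remove {p = p} {y = y} x∈ = p─q⊆p p _ x∈ , λ { refl → x∉p-x p y x∈ }

∣p-x∣ : ∀ {n} {p : Subset n} {x} → x ∈ p → ∣ p ∣ ≡ suc ∣ p - x ∣
∣p-x∣ {p = inside ∷ p}  here       = cong suc (cong ∣_∣ (sym (p─⊥≡p p)))
∣p-x∣ {p = outside ∷ p} (there x∈) = ∣p-x∣ x∈
∣p-x∣ {p = inside ∷ p}  (there x∈) = cong suc (∣p-x∣ x∈)

infix 4 _⋖_
-- The facet relation. The removed vertex is kept as data because its position in `F` determines the
-- incidence sign.
_⋖_ : ∀ {n} → Subset n → Subset n → Set
σ ⋖ F = ∃ λ v → v ∈ F × σ ≡ F - v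

removed-unique : ∀ {n} {F : Subset n} {v w} → v ∈ F → w ∈ F → F - v ≡ F - w → v ≡ w
removed-unique {F = F} {v} {w} v∈F w∈F eq with v Fin.≟ w
... | yes v≡w = v≡w
... | no  v≢w = contradiction (subst (v ∈_) (sym eq) (x∈p∧x≢y⇒x∈p-y v∈F v≢w)) (x∉p-x F v)

⋖⇒⊆ : ∀ {n} {σ F : Subset n} → σ ⋖ F → σ ⊆ F
⋖⇒⊆ (v , _ , refl) = proj₁ ∘ ∈-remove

-- The position of `v` when `F` is listed increasingly; its parity is the textbook sign of the facet
-- `F - v`, free of any chosen ordering.
rank : ∀ {n} → Subset n → Fin n → ℕ
rank F v = sumℕ λ u → ι (does (u ∈? F) ∧ lt u v)

rank-remove : ∀ {n} {F : Subset n} {y} → y ∈ F → ∀ v → rank F v ≡ rank (F - y) v ℕ.+ ι (lt y v)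
rank-remove {n} {F} {y} y∈F v = begin
  rank F v
    ≡⟨ Σℕ.sum-cong-≗ split ⟩
  sumℕ (λ u → ι (does (u ∈? (F - y)) ∧ lt u v) ℕ.+ at-y u)
    ≡⟨ Σℕ.∑-distrib-+ (λ u → ι (does (u ∈? (F - y)) ∧ lt u v)) at-y ⟩
  rank (F - y) v ℕ.+ sumℕ at-y
    ≡⟨ cong (rank (F - y) v ℕ.+_) (trans (sum-single ℕ.+-0-commutativeMonoid at-y y off)
         (cong (λ b → ι (b ∧ lt y v)) (dec-true (y Fin.≟ y) refl))) ⟩
  rank (F - y) v ℕ.+ ι (lt y v) ∎
  where
  open ≡-Reasoning
  at-y : Fin n → ℕ
  at-y u = ι (does (u Fin.≟ y) ∧ lt u v)
  off : ∀ u → u ≢ y → at-y u ≡ 0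
  off u u≢y = cong (λ b → ι (b ∧ lt u v)) (dec-false (u Fin.≟ y) u≢y)
  split : ∀ u → ι (does (u ∈? F) ∧ lt u v) ≡ ι (does (u ∈? (F - y)) ∧ lt u v) ℕ.+ at-y u
  split u with u Fin.≟ y
  ... | yes refl rewrite dec-true (y ∈? F) y∈F | dec-false (y ∈? (F - y)) (x∉p-x F y) = refl
  ... | no  u≢y with u ∈? F
  ...   | yes u∈F rewrite dec-true (u ∈? (F - y)) (x∈p∧x≢y⇒x∈p-y u∈F u≢y) = sym (ℕ.+-identityʳ _)
  ...   | no  u∉F rewrite dec-false (u ∈? (F - y)) (u∉F ∘ proj₁ ∘ ∈-remove) = refl

-- Any listing of `F` meets each vertex once, so the count in `inv-punchIn` no longer depends on the
-- ordering.
below-vertex : ∀ {n m} {F : Subset n} (o : Ordering m F) v → below (vertex o) v ≡ rank F v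
below-vertex {n} {m} {F} o v = begin
  sumℕ (λ j → ι (lt (vertex o j) v))
    ≡⟨ Σℕ.sum-cong-≗ (λ j → sym (trans
         (sum-single ℕ.+-0-commutativeMonoid (term j) (vertex o j) (off j))
         (cong (λ b → ι (b ∧ lt (vertex o j) v)) (dec-true (vertex o j Fin.≟ vertex o j) refl)))) ⟩
  sumℕ (λ j → sumℕ (term j))
    ≡⟨ Σℕ.∑-comm term ⟩
  sumℕ (λ u → sumℕ (λ j → term j u))
    ≡⟨ Σℕ.sum-cong-≗ column ⟩
  rank F v ∎
  where
  open ≡-Reasoning
  term : Fin m → Fin n → ℕ
  term j u = ι (does (u Fin.≟ vertex o j) ∧ lt u v)
  off : ∀ j u → u ≢ vertex o j → term j u ≡ 0
  off j u ne = cong (λ b → ι (b ∧ lt u v)) (dec-false (u Fin.≟ vertex o j) ne)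
  column : ∀ u → sumℕ (λ j → term j u) ≡ ι (does (u ∈? F) ∧ lt u v)
  column u with u ∈? F
  ... | no u∉F = trans (Σℕ.sum-cong-≗ (λ j → off j u λ eq →
                   u∉F (subst (_∈ F) (sym eq) (proj₂ (Inverse.to o j))))) (Σℕ.sum-replicate-zero m)
  ... | yes u∈F = trans (sum-single ℕ.+-0-commutativeMonoid (λ j → term j u) j₀ (λ j j≢j₀ →
                    off j u λ eq → j≢j₀ (vertex-injective o (trans (sym eq) (sym at-j₀)))))
                  (cong (λ b → ι (b ∧ lt u v)) (dec-true (u Fin.≟ vertex o j₀) (sym at-j₀)))
    where
    j₀ : Fin m
    j₀ = Inverse.from o (u , u∈F)
    at-j₀ : vertex o j₀ ≡ u
    at-j₀ = cong proj₁ (Inverse.strictlyInverseˡ o (u , u∈F))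

sign : ℕ → ℤ
sign n = -1ℤ ℤ.^ n

sign-+ : ∀ m n → sign (m ℕ.+ n) ≡ sign m ℤ.* sign n
sign-+ m n = ℤ.^-distribˡ-+-* -1ℤ m n

sign² : ∀ n → sign n ℤ.* sign n ≡ 1ℤ
sign² zero    = refl
sign² (suc n) = trans (lemma (sign n)) (sign² n)
  where
  lemma : ∀ x → -1ℤ ℤ.* x ℤ.* (-1ℤ ℤ.* x) ≡ x ℤ.* x
  lemma = ℤ-Solver.solve-∀

sign-even : ∀ {n} → Even n → sign n ≡ 1ℤ
sign-even (k , refl) = trans (sign-+ k k) (sign² k)

inv-cong : ∀ {m n} {f g : Fin m → Fin n} → (∀ i → f i ≡ g i) → inv f ≡ inv g
inv-cong eq = ∑∑-cong λ i j → cong ι (cong (lt i j ∧_) (cong₂ lt (eq j) (eq i)))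

-- The sign of the chosen ordering relative to the increasing one.
orientationSign : ∀ {n m} {F : Subset n} → Ordering m F → ℤ
orientationSign o = sign (inv (vertex o))

module _ {n m} {σ F : Subset n} (oσ : Ordering m σ) (oF : Ordering (suc m) F)
         (i : Fin (suc m)) (σ≡F-vᵢ : σ ≡ F - vertex oF i) where

  private
    a = vertex oF
    b = vertex oσ
    π = carry oσ oF i σ≡F-vᵢ

  vertex-carry : ∀ j → b (π j) ≡ a (punchIn i j)
  vertex-carry j = cong proj₁ (Inverse.strictlyInverseˡ oσ _)

  private
    b∈ : ∀ l → b l ∈ F × b l ≢ a i
    b∈ l = ∈-remove (subst (b l ∈_) σ≡F-vᵢ (proj₂ (Inverse.to oσ l)))

    position : Fin m → Fin (suc m)
    position l = Inverse.from oF (b l , proj₁ (b∈ l))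

    a-position : ∀ l → a (position l) ≡ b l
    a-position l = cong proj₁ (Inverse.strictlyInverseˡ oF (b l , proj₁ (b∈ l)))

    i≢position : ∀ l → i ≢ position l
    i≢position l i≡ = proj₂ (b∈ l) (trans (sym (a-position l)) (cong a (sym i≡)))

    π⁻¹ : Fin m → Fin m
    π⁻¹ l = punchOut (i≢position l)

    b-π∘π⁻¹ : ∀ l → b (π (π⁻¹ l)) ≡ b l
    b-π∘π⁻¹ l = trans (vertex-carry (π⁻¹ l)) (trans (cong a (Fin.punchIn-punchOut (i≢position l))) (a-position l))

  carryPermutation : Permutation′ m
  carryPermutation = permutation π π⁻¹ left right
    where
    left : ∀ l → π (π⁻¹ l) ≡ l
    left l = vertex-injective oσ (b-π∘π⁻¹ l)
    right : ∀ j → π⁻¹ (π j) ≡ j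
    right j = Fin.punchIn-injective i _ _ (vertex-injective oF
      (trans (sym (vertex-carry (π⁻¹ (π j)))) (trans (b-π∘π⁻¹ (π j)) (vertex-carry j))))

  -- `vertex oσ` after `π` is `vertex oF` with entry `i` deleted. `inv-∘` evaluates the inversions
  -- of this listing from the side of `σ`, `inv-punchIn` from the side of `F`.
  sgn-carry : sign (toℕ i) ℤ.* sgn π ≡ orientationSign oσ ℤ.* orientationSign oF ℤ.* sign (rank F (a i))
  sgn-carry = begin
    s-i ℤ.* s-π
      ≡⟨ ℤ.*-identityʳ _ ⟨
    s-i ℤ.* s-π ℤ.* 1ℤ
      -- Inserting both parity relations as factors 1 makes every unwanted sign occur twice.
      ≡⟨ cong (s-i ℤ.* s-π ℤ.*_) (cong₂ ℤ._*_ parity₁ parity₂) ⟨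
    s-i ℤ.* s-π ℤ.* ((s-a′ ℤ.* s-π ℤ.* s-b) ℤ.* (s-a ℤ.* s-a′ ℤ.* (s-i ℤ.* s-r)))
      ≡⟨ rearrange s-i s-π s-a′ s-b s-a s-r ⟩
    (s-i ℤ.* s-i) ℤ.* (s-π ℤ.* s-π) ℤ.* (s-a′ ℤ.* s-a′) ℤ.* (s-b ℤ.* s-a ℤ.* s-r)
      ≡⟨ cong (ℤ._* (s-b ℤ.* s-a ℤ.* s-r)) (cong₂ ℤ._*_ (cong₂ ℤ._*_ (sign² (toℕ i)) (sign² (inv π)))
           (sign² (inv (a ∘ punchIn i)))) ⟩
    1ℤ ℤ.* (s-b ℤ.* s-a ℤ.* s-r)
      ≡⟨ ℤ.*-identityˡ _ ⟩
    s-b ℤ.* s-a ℤ.* s-r ∎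
    where
    open ≡-Reasoning
    s-i  = sign (toℕ i)
    s-π  = sign (inv π)
    s-a  = sign (inv a)
    s-a′ = sign (inv (a ∘ punchIn i))
    s-b  = sign (inv b)
    s-r  = sign (rank F (a i))
    parity₁ : s-a′ ℤ.* s-π ℤ.* s-b ≡ 1ℤ
    parity₁ = trans (sym (trans (sign-+ (inv (a ∘ punchIn i) ℕ.+ inv π) (inv b))
                      (cong (ℤ._* s-b) (sign-+ (inv (a ∘ punchIn i)) (inv π)))))
      (sign-even (subst (λ x → Even (x ℕ.+ inv π ℕ.+ inv b)) (inv-cong vertex-carry)
        (inv-∘ b (vertex-injective oσ) carryPermutation)))
    parity₂ : s-a ℤ.* s-a′ ℤ.* (s-i ℤ.* s-r) ≡ 1ℤ
    parity₂ = trans (sym (trans (sign-+ (inv a ℕ.+ inv (a ∘ punchIn i)) (toℕ i ℕ.+ rank F (a i)))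
                      (cong₂ ℤ._*_ (sign-+ (inv a) (inv (a ∘ punchIn i))) (sign-+ (toℕ i) (rank F (a i))))))
      (sign-even (subst (λ x → Even (inv a ℕ.+ inv (a ∘ punchIn i) ℕ.+ (toℕ i ℕ.+ x))) (below-vertex oF (a i))
        (inv-punchIn a (vertex-injective oF) i)))
    rearrange : ∀ i p a′ b a r → i ℤ.* p ℤ.* ((a′ ℤ.* p ℤ.* b) ℤ.* (a ℤ.* a′ ℤ.* (i ℤ.* r))) ≡
                (i ℤ.* i) ℤ.* (p ℤ.* p) ℤ.* (a′ ℤ.* a′) ℤ.* (b ℤ.* a ℤ.* r)
    rearrange = ℤ-Solver.solve-∀

module _ {n m} {σ F : Subset n} (oσ : Ordering m σ) (oF : Ordering (suc m) F) where

  private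
    position : ∀ {v} → v ∈ F → Fin (suc m)
    position v∈F = Inverse.from oF (_ , v∈F)

    vertex-position : ∀ {v} (v∈F : v ∈ F) → vertex oF (position v∈F) ≡ v
    vertex-position v∈F = cong proj₁ (Inverse.strictlyInverseˡ oF (_ , v∈F))

  -- A facet determines the vertex removed, so the index found by the search in `incidence` must be
  -- that of `v`. The orderings now contribute only one sign for each face.
  incidence-remove : ∀ {v} → v ∈ F → σ ≡ F - v →
    incidence oσ oF ≡ orientationSign oσ ℤ.* orientationSign oF ℤ.* sign (rank F v)
  incidence-remove {v} v∈F σ≡ with Fin.any? (λ i → σ ≟ₛ F - vertex oF i)
  ... | yes (i , eq) = trans (sgn-carry oσ oF i eq)
    (cong (λ w → orientationSign oσ ℤ.* orientationSign oF ℤ.* sign (rank F w))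
      (removed-unique (proj₂ (Inverse.to oF i)) v∈F (trans (sym eq) σ≡)))
  ... | no none = contradiction (position v∈F , trans σ≡ (cong (F -_) (sym (vertex-position v∈F)))) none

  incidence-none : ¬ (σ ⋖ F) → incidence oσ oF ≡ 0ℤ
  incidence-none ¬σ⋖F with Fin.any? (λ i → σ ≟ₛ F - vertex oF i)
  ... | yes (i , eq) = contradiction (vertex oF i , proj₂ (Inverse.to oF i) , eq) ¬σ⋖F
  ... | no _         = refl

module Σℤ = SemiringSum ℤ.+-*-semiring

-- Indexing the faces

lookup-injective : ∀ {A : Set} {xs : List A} → Unique xs → ∀ {i j} → lookup xs i ≡ lookup xs j → i ≡ j
lookup-injective (_ ∷ _)    {zero}  {zero}  _  = refl
lookup-injective (x∉ ∷ _)   {zero}  {suc j} eq = contradiction eq (All.lookup x∉ (∈-lookup j))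
lookup-injective (x∉ ∷ _)   {suc i} {zero}  eq = contradiction (sym eq) (All.lookup x∉ (∈-lookup i))
lookup-injective (_ ∷ uniq) {suc i} {suc j} eq = cong suc (lookup-injective uniq eq)

subsets-complete : ∀ {N} (s : Subset N) → s ∈ˡ subsets N
subsets-complete Vec.[]              = here refl
subsets-complete (outside Vec.∷ s)   = ∈-++⁺ˡ (∈-map⁺ (outside Vec.∷_) (subsets-complete s))
subsets-complete {suc N} (inside Vec.∷ s) =
  ∈-++⁺ʳ (map (outside Vec.∷_) (subsets N)) (∈-map⁺ (inside Vec.∷_) (subsets-complete s))

subsets-unique : ∀ N → Unique (subsets N)
subsets-unique zero    = All.[] ∷ []
subsets-unique (suc N) = Unique.++⁺ (Unique.map⁺ Vec.∷-injectiveʳ (subsets-unique N))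
  (Unique.map⁺ Vec.∷-injectiveʳ (subsets-unique N)) disjoint
  where
  disjoint : ∀ {s} → s ∈ˡ map (outside Vec.∷_) (subsets N) × s ∈ˡ map (inside Vec.∷_) (subsets N) → _
  disjoint (s∈₁ , s∈₂) with ∈-map⁻ (outside Vec.∷_) s∈₁ | ∈-map⁻ (inside Vec.∷_) s∈₂
  ... | _ , _ , refl | _ , _ , ()

module _ {N} (K : SimplicialComplex N) where
  open SimplicialComplex K

  face-injective : ∀ m {i j} → face K m i ≡ face K m j → i ≡ j
  face-injective m = lookup-injective (Unique.filter⁺ (λ s → face? s ×-dec (∣ s ∣ ℕ.≟ m)) (subsets-unique N))

  face-isFace : ∀ m i → Face (face K m i) × ∣ face K m i ∣ ≡ m
  face-isFace m i = proj₂ (∈-filter⁻ (λ s → face? s ×-dec (∣ s ∣ ℕ.≟ m)) {xs = subsets N} (∈-lookup i))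

  face-surjective : ∀ {m s} → Face s → ∣ s ∣ ≡ m → ∃ λ i → face K m i ≡ s
  face-surjective {m} {s} s∈K ∣s∣≡m = index s∈ , sym (lookup-index s∈)
    where
    s∈ : s ∈ˡ faces K m
    s∈ = ∈-filter⁺ (λ s → face? s ×-dec (∣ s ∣ ℕ.≟ m)) (subsets-complete s) (s∈K , ∣s∣≡m)

-- Facets, and signs in codimension two

_⋖?_ : ∀ {n} (σ F : Subset n) → Dec (σ ⋖ F)
σ ⋖? F = Fin.any? λ v → (v ∈? F) ×-dec (σ ≟ₛ F - v)

⊆⇒⋖ : ∀ {n} {σ F : Subset n} → σ ⊆ F → ∣ F ∣ ≡ suc ∣ σ ∣ → σ ⋖ F
⊆⇒⋖ {n} {σ} {F} σ⊆F ∣F∣≡ with Fin.any? (λ v → (v ∈? F) ×-dec ¬? (v ∈? σ))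
... | no none = contradiction (p⊆q⇒∣p∣≤∣q∣ F⊆σ) (ℕ.<⇒≱ (ℕ.≤-reflexive (sym ∣F∣≡)))
  where
  F⊆σ : F ⊆ σ
  F⊆σ {v} v∈F = decidable-stable (v ∈? σ) λ v∉σ → none (v , v∈F , v∉σ)
... | yes (v , v∈F , v∉σ) = v , v∈F , ⊆-antisym σ⊆F-v F-v⊆σ
  where
  σ⊆F-v : σ ⊆ F - v
  σ⊆F-v x∈σ = x∈p∧x≢y⇒x∈p-y (σ⊆F x∈σ) λ { refl → v∉σ x∈σ }
  ∣F-v∣≡∣σ∣ : ∣ F - v ∣ ≡ ∣ σ ∣
  ∣F-v∣≡∣σ∣ = ℕ.suc-injective (trans (sym (∣p-x∣ v∈F)) ∣F∣≡)
  F-v⊆σ : F - v ⊆ σ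
  F-v⊆σ {x} x∈ = decidable-stable (x ∈? σ) λ x∉σ →
    ℕ.<⇒≢ (p⊂q⇒∣p∣<∣q∣ (σ⊆F-v , x , x∈ , x∉σ)) (sym ∣F-v∣≡∣σ∣)

-- Two distinct facets cover a face, since the vertex missing from one lies in the other; both faces
-- are therefore the union of `σ` and `τ`.
common-facet-unique : ∀ {n} {σ τ F G : Subset n} → σ ≢ τ → σ ⋖ F → σ ⋖ G → τ ⋖ F → τ ⋖ G → F ≡ G
common-facet-unique σ≢τ σF σG τF τG = ⊆-antisym (half-⊆ σ≢τ σF τF σG τG) (half-⊆ σ≢τ σG τG σF τF)
  where
  half-⊆ : ∀ {n} {σ τ F G : Subset n} → σ ≢ τ → σ ⋖ F → τ ⋖ F → σ ⋖ G → τ ⋖ G → F ⊆ G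
  half-⊆ {F = F} σ≢τ (v , _ , refl) (w , _ , refl) σG τG {x} x∈F with x Fin.≟ v
  ... | no x≢v = ⋖⇒⊆ σG (x∈p∧x≢y⇒x∈p-y x∈F x≢v)
  ... | yes refl = ⋖⇒⊆ τG (x∈p∧x≢y⇒x∈p-y x∈F λ x≡w → σ≢τ (cong (F -_) x≡w))

facetSign : ∀ {n} → Subset n → Fin n → ℤ
facetSign F v = sign (rank F v)

sign-flip : ∀ {n} {u v : Fin n} → u ≢ v → sign (ι (lt v u)) ≡ ℤ.- sign (ι (lt u v))
sign-flip {u = u} {v} u≢v rewrite lt-flip u≢v with lt u v
... | true  = refl
... | false = refl

-- Separates the sign of `v` into a part seen in the codimension-two face alone and the order of `u`
-- and `v`. Removing `v` itself does not change its rank. Faces with a common codimension-two face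
-- thus have comparable signs.
facetSign-remove₂ : ∀ {n} {F : Subset n} {u v} → u ∈ F → v ∈ F → u ≢ v → ∀ {σ} → F - u - v ≡ σ →
                    facetSign F v ≡ sign (rank σ v) ℤ.* sign (ι (lt u v))
facetSign-remove₂ {F = F} {u} {v} u∈F v∈F u≢v refl = trans
  (cong sign (trans (rank-remove u∈F v) (cong (ℕ._+ ι (lt u v))
    (trans (rank-remove (x∈p∧x≢y⇒x∈p-y v∈F (u≢v ∘ sym)) v)
      (trans (cong (λ b → rank (F - u - v) v ℕ.+ ι b) (lt-irrefl v)) (ℕ.+-identityʳ _))))))
  (sign-+ (rank (F - u - v) v) (ι (lt u v)))

-- All six signs are read over the common core `F - y - y′`. The two products then agree except that
-- `F` sees `y` and `y′` in opposite orders, the same antisymmetry that makes the boundary of a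
-- boundary vanish.
facetSigns-opposite′ : ∀ {n} {F G G′ : Subset n} {x y y′} →
  y ∈ F → y′ ∈ F → x ∈ G → y ∈ G → x ∈ G′ → y′ ∈ G′ → x ≢ y → x ≢ y′ → y ≢ y′ →
  G - x ≡ F - y′ → G′ - x ≡ F - y →
  facetSign F y′ ℤ.* facetSign G x ℤ.* facetSign G y ℤ.+
  facetSign F y ℤ.* facetSign G′ x ℤ.* facetSign G′ y′ ≡ 0ℤ
facetSigns-opposite′ {F = F} {G} {G′} {x} {y} {y′} y∈F y′∈F x∈G y∈G x∈G′ y′∈G′ x≢y x≢y′ y≢y′ G-x≡ G′-x≡
  rewrite facetSign-remove₂ y∈F y′∈F y≢y′ {F - y - y′} refl
    | facetSign-remove₂ y′∈F y∈F (y≢y′ ∘ sym) {F - y - y′} (p─x─y≡p─y─x F y′ y)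
    | facetSign-remove₂ y∈G x∈G (x≢y ∘ sym) {F - y - y′}
        (trans (p─x─y≡p─y─x G y x) (trans (cong (_- y) G-x≡) (p─x─y≡p─y─x F y′ y)))
    | facetSign-remove₂ x∈G y∈G x≢y {F - y - y′} (trans (cong (_- y) G-x≡) (p─x─y≡p─y─x F y′ y))
    | facetSign-remove₂ y′∈G′ x∈G′ (x≢y′ ∘ sym) {F - y - y′}
        (trans (p─x─y≡p─y─x G′ y′ x) (cong (_- y′) G′-x≡))
    | facetSign-remove₂ x∈G′ y′∈G′ x≢y′ {F - y - y′} (cong (_- y′) G′-x≡)
    | sign-flip y≢y′ | sign-flip x≢y | sign-flip x≢y′ =
  lemma (sign (rank (F - y - y′) y)) (sign (rank (F - y - y′) y′)) (sign (rank (F - y - y′) x))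
    (sign (ι (lt y y′))) (sign (ι (lt x y))) (sign (ι (lt x y′))) (sign² (ι (lt x y))) (sign² (ι (lt x y′)))
  where
  -- Here a, a′, c are the signs of `y`, `y′`, `x` over the core, and p, q, r encode the orders of
  -- the pairs (y, y′), (x, y), (x, y′); each negation is a pair read in the other order.
  lemma : ∀ a a′ c p q r → q ℤ.* q ≡ 1ℤ → r ℤ.* r ≡ 1ℤ →
    (a′ ℤ.* p) ℤ.* (c ℤ.* (ℤ.- q)) ℤ.* (a ℤ.* q) ℤ.+
    (a ℤ.* (ℤ.- p)) ℤ.* (c ℤ.* (ℤ.- r)) ℤ.* (a′ ℤ.* r) ≡ 0ℤ
  lemma a a′ c p q r q²≡1 r²≡1 = trans (expand a a′ c p q r)
    (trans (cong₂ (λ s t → a ℤ.* a′ ℤ.* c ℤ.* p ℤ.* (t ℤ.- s)) q²≡1 r²≡1) (ℤ.*-zeroʳ (a ℤ.* a′ ℤ.* c ℤ.* p)))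
    where
    expand : ∀ a a′ c p q r →
      (a′ ℤ.* p) ℤ.* (c ℤ.* (ℤ.- q)) ℤ.* (a ℤ.* q) ℤ.+
      (a ℤ.* (ℤ.- p)) ℤ.* (c ℤ.* (ℤ.- r)) ℤ.* (a′ ℤ.* r) ≡
      a ℤ.* a′ ℤ.* c ℤ.* p ℤ.* (r ℤ.* r ℤ.- q ℤ.* q)
    expand = ℤ-Solver.solve-∀

-- If G ≠ G′ contain ρ and share facets τ and τ′ with F ⊉ ρ, then for σ = F ∩ ρ
-- the six sets are F = σyy′, ρ = σx, G = σxy, G′ = σxy′, τ = σy, τ′ = σy′.
module _ {n} {F G G′ ρ τ τ′ : Subset n} {y y′ x x′ z z′ : Fin n}
         (ρ⊈F : ¬ (ρ ⊆ F)) (G≢G′ : G ≢ G′)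
         (y∈G : y ∈ G) (ρ≡G-y : ρ ≡ G - y) (y′∈G′ : y′ ∈ G′) (ρ≡G′-y′ : ρ ≡ G′ - y′)
         (z∈F : z ∈ F) (τ≡F-z : τ ≡ F - z) (x∈G : x ∈ G) (τ≡G-x : τ ≡ G - x)
         (z′∈F : z′ ∈ F) (τ′≡F-z′ : τ′ ≡ F - z′) (x′∈G′ : x′ ∈ G′) (τ′≡G′-x′ : τ′ ≡ G′ - x′) where

  private
    τ⊆F : τ ⊆ F
    τ⊆F = ⋖⇒⊆ (z , z∈F , τ≡F-z)
    τ′⊆F : τ′ ⊆ F
    τ′⊆F = ⋖⇒⊆ (z′ , z′∈F , τ′≡F-z′)
    x≢y : x ≢ y
    x≢y refl = ρ⊈F (subst (_⊆ F) (trans τ≡G-x (sym ρ≡G-y)) τ⊆F)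
    x′≢y′ : x′ ≢ y′
    x′≢y′ refl = ρ⊈F (subst (_⊆ F) (trans τ′≡G′-x′ (sym ρ≡G′-y′)) τ′⊆F)
    y∉ρ : y ∉ ρ
    y∉ρ y∈ρ = x∉p-x G y (subst (y ∈_) ρ≡G-y y∈ρ)
    y′∉ρ : y′ ∉ ρ
    y′∉ρ y′∈ρ = x∉p-x G′ y′ (subst (y′ ∈_) ρ≡G′-y′ y′∈ρ)
    ∈ρ⇒∈G : ∀ {v} → v ∈ ρ → v ∈ G
    ∈ρ⇒∈G = ⋖⇒⊆ (y , y∈G , ρ≡G-y)
    ∈ρ⇒∈G′ : ∀ {v} → v ∈ ρ → v ∈ G′
    ∈ρ⇒∈G′ = ⋖⇒⊆ (y′ , y′∈G′ , ρ≡G′-y′)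
    ∈G⇒ : ∀ {v} → v ∈ G → v ≢ y → v ∈ ρ
    ∈G⇒ v∈G v≢y = subst (_ ∈_) (sym ρ≡G-y) (x∈p∧x≢y⇒x∈p-y v∈G v≢y)
    ∈G′⇒ : ∀ {v} → v ∈ G′ → v ≢ y′ → v ∈ ρ
    ∈G′⇒ v∈G′ v≢y′ = subst (_ ∈_) (sym ρ≡G′-y′) (x∈p∧x≢y⇒x∈p-y v∈G′ v≢y′)
    y≢y′ : y ≢ y′
    y≢y′ refl = G≢G′ (⊆-antisym G⊆G′ G′⊆G)
      where
      G⊆G′ : G ⊆ G′
      G⊆G′ {v} v∈G with v Fin.≟ y
      ... | yes refl = y′∈G′
      ... | no v≢y   = ∈ρ⇒∈G′ (∈G⇒ v∈G v≢y)
      G′⊆G : G′ ⊆ G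
      G′⊆G {v} v∈G′ with v Fin.≟ y
      ... | yes refl = y∈G
      ... | no v≢y   = ∈ρ⇒∈G (∈G′⇒ v∈G′ v≢y)
    y∈F : y ∈ F
    y∈F = τ⊆F (subst (y ∈_) (sym τ≡G-x) (x∈p∧x≢y⇒x∈p-y y∈G (x≢y ∘ sym)))
    y′∈F : y′ ∈ F
    y′∈F = τ′⊆F (subst (y′ ∈_) (sym τ′≡G′-x′) (x∈p∧x≢y⇒x∈p-y y′∈G′ (x′≢y′ ∘ sym)))
    y∉G′ : y ∉ G′
    y∉G′ y∈G′ = y∉ρ (∈G′⇒ y∈G′ y≢y′)
    y′∉G : y′ ∉ G
    y′∉G y′∈G = y′∉ρ (∈G⇒ y′∈G (y≢y′ ∘ sym))
    -- The vertex `y′` lies in `F` but not in `G`, hence not in their common facet `τ`; only the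
    -- vertex removed from `F` can be missing.
    z≡y′ : z ≡ y′
    z≡y′ with z Fin.≟ y′
    ... | yes eq = eq
    ... | no z≢y′ = contradiction
      (⋖⇒⊆ (x , x∈G , τ≡G-x) (subst (y′ ∈_) (sym τ≡F-z) (x∈p∧x≢y⇒x∈p-y y′∈F (z≢y′ ∘ sym)))) y′∉G
    z′≡y : z′ ≡ y
    z′≡y with z′ Fin.≟ y
    ... | yes eq = eq
    ... | no z′≢y = contradiction
      (⋖⇒⊆ (x′ , x′∈G′ , τ′≡G′-x′) (subst (y ∈_) (sym τ′≡F-z′) (x∈p∧x≢y⇒x∈p-y y∈F (z′≢y ∘ sym)))) y∉G′
    x∈ρ : x ∈ ρ
    x∈ρ = ∈G⇒ x∈G x≢y
    x∉F : x ∉ F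
    x∉F x∈F = x∉p-x G x (subst (x ∈_) τ≡G-x (subst (x ∈_) (sym τ≡F-z)
      (x∈p∧x≢y⇒x∈p-y x∈F λ x≡z → y′∉ρ (subst (_∈ ρ) (trans x≡z z≡y′) x∈ρ))))
    x≡x′ : x ≡ x′
    x≡x′ with x Fin.≟ x′
    ... | yes eq = eq
    ... | no x≢x′ = contradiction
      (τ′⊆F (subst (x ∈_) (sym τ′≡G′-x′) (x∈p∧x≢y⇒x∈p-y (∈ρ⇒∈G′ x∈ρ) x≢x′))) x∉F
    x≢y′ : x ≢ y′
    x≢y′ refl = y′∉ρ x∈ρ

  facetSigns-opposite : facetSign F z ℤ.* facetSign G x ℤ.* facetSign G y ℤ.+
                        facetSign F z′ ℤ.* facetSign G′ x′ ℤ.* facetSign G′ y′ ≡ 0ℤ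
  facetSigns-opposite = substituted z≡y′ z′≡y x≡x′
    where
    substituted : ∀ {z z′ x′} → z ≡ y′ → z′ ≡ y → x ≡ x′ →
      facetSign F z ℤ.* facetSign G x ℤ.* facetSign G y ℤ.+
      facetSign F z′ ℤ.* facetSign G′ x′ ℤ.* facetSign G′ y′ ≡ 0ℤ
    substituted refl refl refl = facetSigns-opposite′ y∈F y′∈F x∈G y∈G (∈ρ⇒∈G′ x∈ρ) y′∈G′
      x≢y x≢y′ y≢y′ (trans (sym τ≡G-x) (trans τ≡F-z (cong (F -_) z≡y′)))
      (trans (cong (G′ -_) x≡x′) (trans (sym τ′≡G′-x′) (trans τ′≡F-z′ (cong (F -_) z′≡y))))

-- The Gram matrix of the boundary

data Trit : ℤ → Set where
  plus  : Trit 1ℤ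
  none  : Trit 0ℤ
  minus : Trit -1ℤ

trit-* : ∀ {x y} → Trit x → Trit y → Trit (x ℤ.* y)
trit-* plus  plus  = plus
trit-* plus  none  = none
trit-* plus  minus = minus
trit-* none  _     = none
trit-* minus plus  = minus
trit-* minus none  = none
trit-* minus minus = plus

trit-sign : ∀ n → Trit (sign n)
trit-sign zero    = plus
trit-sign (suc n) = trit-* minus (trit-sign n)

sum-zero : ∀ {n} (f : Fin n → ℤ) → (∀ i → f i ≡ 0ℤ) → sumℤ f ≡ 0ℤ
sum-zero {n} f f≡0 = trans (Σℤ.sum-cong-≗ f≡0) (Σℤ.sum-replicate-zero n)

sum-at : ∀ {n} (f : Fin n → ℤ) i → (∀ j → j ≢ i → f j ≡ 0ℤ) → sumℤ f ≡ f i
sum-at = sum-single ℤ.+-0-commutativeMonoid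

-- At most two terms are nonzero: if a, b, c were three of them, then 2c = (a + c) + (b + c) - (a +
-- b) = 0. Two nonzero terms cancel, so the sum is 0 or a single term.
trit-sum : ∀ {n} (t : Fin n → ℤ) → (∀ i → Trit (t i)) →
           (∀ i j → i ≢ j → t i ≢ 0ℤ → t j ≢ 0ℤ → t i ℤ.+ t j ≡ 0ℤ) → Trit (sumℤ t)
trit-sum {zero}  t trit opp = none
trit-sum {suc n} t trit opp with t zero ℤ.≟ 0ℤ
... | yes t₀≡0 rewrite t₀≡0 | ℤ.+-identityˡ (sumℤ (t ∘ suc)) =
  trit-sum (t ∘ suc) (trit ∘ suc) (λ i j i≢j → opp (suc i) (suc j) (i≢j ∘ Fin.suc-injective))
... | no t₀≢0 with Fin.any? (λ i → ¬? (t (suc i) ℤ.≟ 0ℤ))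
...   | no all-zero = subst Trit (sym (trans (cong (ℤ._+_ (t zero))
          (sum-zero (t ∘ suc) λ i → decidable-stable (t (suc i) ℤ.≟ 0ℤ) λ ne → all-zero (i , ne)))
          (ℤ.+-identityʳ (t zero)))) (trit zero)
...   | yes (i , tᵢ≢0) = subst Trit (sym (trans (cong (ℤ._+_ (t zero)) (sum-at (t ∘ suc) i others))
          (opp zero (suc i) (λ ()) t₀≢0 tᵢ≢0))) none
  where
  others : ∀ j → j ≢ i → t (suc j) ≡ 0ℤ
  others j j≢i = decidable-stable (t (suc j) ℤ.≟ 0ℤ) λ tⱼ≢0 → tⱼ≢0 (2x≡0 (t (suc j))
    (trans (cancel (t zero) (t (suc i)) (t (suc j)))
      (cong₂ ℤ._+_ (cong₂ ℤ._+_ (opp zero (suc j) (λ ()) t₀≢0 tⱼ≢0)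
        (opp (suc i) (suc j) (j≢i ∘ sym ∘ Fin.suc-injective) tᵢ≢0 tⱼ≢0))
        (cong ℤ.-_ (opp zero (suc i) (λ ()) t₀≢0 tᵢ≢0)))))
    where
    cancel : ∀ a b c → c ℤ.+ c ≡ (a ℤ.+ c) ℤ.+ (b ℤ.+ c) ℤ.- (a ℤ.+ b)
    cancel = ℤ-Solver.solve-∀
    2x≡0 : ∀ x → x ℤ.+ x ≡ 0ℤ → x ≡ 0ℤ
    2x≡0 (+ zero) _ = refl

sum-ones : ∀ n → sumℤ {n} (λ _ → 1ℤ) ≡ + n
sum-ones zero    = refl
sum-ones (suc n) = cong (ℤ._+_ 1ℤ) (sum-ones n)

𝟙 : Bool → ℤ
𝟙 b = if b then 1ℤ else 0ℤ

length-filter : ∀ {A : Set} {P : Pred A 0ℓ} (P? : Decidable P) xs →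
                sumℤ (λ j → 𝟙 (does (P? (lookup xs j)))) ≡ + length (filter P? xs)
length-filter P? []       = refl
length-filter P? (x ∷ xs) with does (P? x)
... | true  = cong (ℤ._+_ 1ℤ) (length-filter P? xs)
... | false = trans (ℤ.+-identityˡ _) (length-filter P? xs)

sum-mono : ∀ {n} {f g : Fin n → ℤ} → (∀ i → f i ℤ.≤ g i) → sumℤ f ℤ.≤ sumℤ g
sum-mono {zero}  f≤g = ℤ.≤-refl
sum-mono {suc n} f≤g = ℤ.+-mono-≤ (f≤g zero) (sum-mono (f≤g ∘ suc))

-- Bilinear algebra over a commutative ring, applied to both ℤ and ℝ

module Linear {c ℓ} (R : CommutativeRing c ℓ) where
  open CommutativeRing R renaming (_≈_ to _∼_; refl to ∼-refl; sym to ∼-sym; trans to ∼-trans)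
  open SemiringSum semiring
  open SetoidReasoning (CommutativeRing.setoid R)

  dot : ∀ {n} → (Fin n → Carrier) → (Fin n → Carrier) → Carrier
  dot u v = sum λ i → u i * v i

  apply : ∀ {m n} → (Fin m → Fin n → Carrier) → (Fin n → Carrier) → Fin m → Carrier
  apply A v i = sum λ j → A i j * v j

  _ᵀ : ∀ {m n} → (Fin m → Fin n → Carrier) → Fin n → Fin m → Carrier
  (A ᵀ) j i = A i j

  _⊗_ : ∀ {l m n} → (Fin l → Fin m → Carrier) → (Fin m → Fin n → Carrier) → Fin l → Fin n → Carrier
  (A ⊗ B) i k = sum λ j → A i j * B j k

  dot-cong : ∀ {n} {u u′ v v′ : Fin n → Carrier} → (∀ i → u i ∼ u′ i) → (∀ i → v i ∼ v′ i) →
             dot u v ∼ dot u′ v′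
  dot-cong u∼u′ v∼v′ = sum-cong-≋ λ i → *-cong (u∼u′ i) (v∼v′ i)

  dot-comm : ∀ {n} (u v : Fin n → Carrier) → dot u v ∼ dot v u
  dot-comm u v = sum-cong-≋ λ i → *-comm (u i) (v i)

  dot-+ : ∀ {n} (u v w : Fin n → Carrier) → dot u (λ i → v i + w i) ∼ dot u v + dot u w
  dot-+ u v w = ∼-trans (sum-cong-≋ λ i → distribˡ (u i) (v i) (w i)) (∑-distrib-+ (λ i → u i * v i) (λ i → u i * w i))

  dot-* : ∀ {n} (u v : Fin n → Carrier) c → dot u (λ i → c * v i) ∼ c * dot u v
  dot-* u v c = ∼-trans (sum-cong-≋ λ i → ∼-trans (∼-sym (*-assoc (u i) c (v i)))
      (∼-trans (*-congʳ (*-comm (u i) c)) (*-assoc c (u i) (v i))))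
    (∼-sym (*-distribˡ-sum c (λ i → u i * v i)))

  dot-adjoint : ∀ {m n} (A : Fin m → Fin n → Carrier) u v → dot u (apply A v) ∼ dot (apply (A ᵀ) u) v
  dot-adjoint A u v = begin
    sum (λ i → u i * sum λ j → A i j * v j)
      ≈⟨ sum-cong-≋ (λ i → *-distribˡ-sum (u i) (λ j → A i j * v j)) ⟩
    sum (λ i → sum λ j → u i * (A i j * v j))
      ≈⟨ ∑-comm (λ i j → u i * (A i j * v j)) ⟩
    sum (λ j → sum λ i → u i * (A i j * v j))
      ≈⟨ sum-cong-≋ (λ j → ∼-trans
           (sum-cong-≋ λ i → ∼-trans (∼-sym (*-assoc (u i) (A i j) (v j))) (*-congʳ (*-comm (u i) (A i j))))
           (∼-sym (*-distribʳ-sum (v j) (λ i → A i j * u i)))) ⟩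
    sum (λ j → (sum λ i → A i j * u i) * v j) ∎

  apply-⊗ : ∀ {l m n} (A : Fin l → Fin m → Carrier) (B : Fin m → Fin n → Carrier) v i →
            apply (A ⊗ B) v i ∼ apply A (apply B v) i
  apply-⊗ A B v i = ∼-trans
    (sum-cong-≋ λ k → *-congʳ (sum-cong-≋ λ j → *-comm (A i j) (B j k)))
    (∼-sym (dot-adjoint B (A i) v))

module Linearℤ = Linear ℤ.+-*-commutativeRing

module UpGram {N} (K : SimplicialComplex N) (o : Orientation K) (k : ℕ) where

  open SimplicialComplex K
  open Linearℤ

  ρ : Fin (#faces K k) → Subset N
  ρ = face K k

  F : Fin (#faces K (suc k)) → Subset N
  F = face K (suc k)

  abstract
    B : Matrix ℤ (#faces K k) (#faces K (suc k))
    B = boundary K o k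

    M : Matrix ℤ (#faces K (suc k)) (#faces K (suc k))
    M = (B ᵀ) ⊗ B

    d : Fin (#faces K k) → ℤ
    d r = + upperDegree K k (ρ r)

    oρ : Fin (#faces K k) → ℤ
    oρ i = orientationSign (o k i)

    oF : Fin (#faces K (suc k)) → ℤ
    oF j = orientationSign (o (suc k) j)

    B≡boundary : B ≡ boundary K o k
    B≡boundary = refl

    M≡BᵀB : M ≡ (B ᵀ) ⊗ B
    M≡BᵀB = refl

    d≡upperDegree : ∀ r → d r ≡ + upperDegree K k (ρ r)
    d≡upperDegree r = refl

    oρ² : ∀ i → oρ i ℤ.* oρ i ≡ 1ℤ
    oρ² i = sign² (inv (vertex (o k i)))

    oF² : ∀ j → oF j ℤ.* oF j ≡ 1ℤ
    oF² j = sign² (inv (vertex (o (suc k) j)))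

    oρ-trit : ∀ i → Trit (oρ i)
    oρ-trit i = trit-sign (inv (vertex (o k i)))

    oF-trit : ∀ j → Trit (oF j)
    oF-trit j = trit-sign (inv (vertex (o (suc k) j)))

    B-facet : ∀ {i j v} → v ∈ F j → ρ i ≡ F j - v → B i j ≡ oρ i ℤ.* oF j ℤ.* facetSign (F j) v
    B-facet {i} {j} = incidence-remove (o k i) (o (suc k) j)

    B-none : ∀ {i j} → ¬ (ρ i ⋖ F j) → B i j ≡ 0ℤ
    B-none {i} {j} = incidence-none (o k i) (o (suc k) j)

  M-entry : ∀ j j′ → M j j′ ≡ sumℤ (λ i → B i j ℤ.* B i j′)
  M-entry j j′ = cong (λ A → A j j′) M≡BᵀB

  B-facet² : ∀ {i j} → ρ i ⋖ F j → B i j ℤ.* B i j ≡ 1ℤ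
  B-facet² {i} {j} (v , v∈F , ρ≡) rewrite B-facet {i} {j} v∈F ρ≡ = trans
    (rearrange (oρ i) (oF j) (facetSign (F j) v))
    (cong₂ ℤ._*_ (cong₂ ℤ._*_ (oρ² i) (oF² j)) (sign² (rank (F j) v)))
    where
    rearrange : ∀ a b c → a ℤ.* b ℤ.* c ℤ.* (a ℤ.* b ℤ.* c) ≡ a ℤ.* a ℤ.* (b ℤ.* b) ℤ.* (c ℤ.* c)
    rearrange = ℤ-Solver.solve-∀

  B-trit : ∀ i j → Trit (B i j)
  B-trit i j with ρ i ⋖? F j
  ... | yes (v , v∈F , ρ≡) = subst Trit (sym (B-facet {i} {j} v∈F ρ≡))
          (trit-* (trit-* (oρ-trit i) (oF-trit j))
                  (trit-sign (rank (F j) v)))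
  ... | no  ¬facet = subst Trit (sym (B-none {i} {j} ¬facet)) none

  ¬facet⇒product≡0 : ∀ {i j j′} → ¬ (ρ i ⋖ F j × ρ i ⋖ F j′) → B i j ℤ.* B i j′ ≡ 0ℤ
  ¬facet⇒product≡0 {i} {j} {j′} ¬both with ρ i ⋖? F j | ρ i ⋖? F j′
  ... | no ¬f | _     = cong (ℤ._* B i j′) (B-none {i} {j} ¬f)
  ... | _     | no ¬f = trans (cong (B i j ℤ.*_) (B-none {i} {j′} ¬f)) (ℤ.*-zeroʳ (B i j))
  ... | yes f | yes f′ = contradiction (f , f′) ¬both

  -- Distinct k-faces share at most one ridge, so one summand of BᵀB survives.
  M-facet : ∀ {i j j′} → j ≢ j′ → ρ i ⋖ F j → ρ i ⋖ F j′ → M j j′ ≡ B i j ℤ.* B i j′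
  M-facet {i} {j} {j′} j≢j′ f f′ = trans (M-entry j j′) (sum-at (λ i′ → B i′ j ℤ.* B i′ j′) i λ i′ i′≢i →
    ¬facet⇒product≡0 {i′} {j} {j′} λ (g , g′) → j≢j′ (face-injective K (suc k)
      (common-facet-unique (i′≢i ∘ face-injective K k) g g′ f f′)))

  M-none : ∀ {j j′} → (∀ i → ¬ (ρ i ⋖ F j × ρ i ⋖ F j′)) → M j j′ ≡ 0ℤ
  M-none {j} {j′} ¬f = trans (M-entry j j′)
    (sum-zero (λ i → B i j ℤ.* B i j′) λ i → ¬facet⇒product≡0 {i} {j} {j′} (¬f i))

  common-facet? : ∀ j j′ → Dec (∃ λ i → ρ i ⋖ F j × ρ i ⋖ F j′)
  common-facet? j j′ = Fin.any? λ i → (ρ i ⋖? F j) ×-dec (ρ i ⋖? F j′)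

  M-trit : ∀ {j j′} → j ≢ j′ → Trit (M j j′)
  M-trit {j} {j′} j≢j′ with common-facet? j j′
  ... | yes (i , f , f′) = subst Trit (sym (M-facet j≢j′ f f′)) (trit-* (B-trit i j) (B-trit i j′))
  ... | no ¬f = subst Trit (sym (M-none {j} {j′} λ i f → ¬f (i , f))) none

  removed-face : ∀ {j v} → v ∈ F j → ∃ λ i → ρ i ≡ F j - v
  removed-face {j} v∈F = face-surjective K (closed (p─q⊆p (F j) _) (proj₁ (face-isFace K (suc k) j)))
    (ℕ.suc-injective (trans (sym (∣p-x∣ v∈F)) (proj₂ (face-isFace K (suc k) j))))

  -- Each of the k + 1 vertices of `F j` gives one ridge by removal, and each such ridge contributes
  -- the square of a sign.
  M-diag : ∀ j → M j j ≡ + suc k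
  M-diag j = begin
    M j j                                            ≡⟨ M-entry j j ⟩
    sumℤ (λ i → B i j ℤ.* B i j)                     ≡⟨ Σℤ.sum-cong-≗ square ⟩
    sumℤ (λ i → sumℤ λ q → 𝟙 (does (i Fin.≟ row q))) ≡⟨ Σℤ.∑-comm (λ i q → 𝟙 (does (i Fin.≟ row q))) ⟩
    sumℤ (λ q → sumℤ λ i → 𝟙 (does (i Fin.≟ row q))) ≡⟨ Σℤ.sum-cong-≗ column ⟩
    sumℤ {suc k} (λ q → 1ℤ)                          ≡⟨ sum-ones (suc k) ⟩
    + suc k ∎
    where
    open ≡-Reasoning
    v : Fin (suc k) → Fin N
    v = vertex (o (suc k) j)
    v∈ : ∀ q → v q ∈ F j
    v∈ q = proj₂ (Inverse.to (o (suc k) j) q)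
    row′ : ∀ q → ∃ λ i → ρ i ≡ F j - v q
    row′ q = removed-face (v∈ q)
    row : Fin (suc k) → Fin (#faces K k)
    row q = proj₁ (row′ q)
    column : ∀ q → sumℤ (λ i → 𝟙 (does (i Fin.≟ row q))) ≡ 1ℤ
    column q = trans (sum-at (λ i → 𝟙 (does (i Fin.≟ row q))) (row q)
        λ i i≢ → cong 𝟙 (dec-false (i Fin.≟ row q) i≢))
      (cong 𝟙 (dec-true (row q Fin.≟ row q) refl))
    square : ∀ i → B i j ℤ.* B i j ≡ sumℤ λ q → 𝟙 (does (i Fin.≟ row q))
    square i with ρ i ⋖? F j
    ... | no ¬f = trans (¬facet⇒product≡0 {i} {j} {j} (¬f ∘ proj₁)) (sym (sum-zero (λ q → 𝟙 (does (i Fin.≟ row q))) λ q →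
            cong 𝟙 (dec-false (i Fin.≟ row q) λ { refl → ¬f (v q , v∈ q , proj₂ (row′ q)) })))
    ... | yes f@(w , w∈F , ρ≡) = trans (B-facet² f) (sym (trans
            (sum-at (λ q → 𝟙 (does (i Fin.≟ row q))) q₀ λ q q≢ → cong 𝟙 (dec-false (i Fin.≟ row q) λ { refl →
              q≢ (vertex-injective (o (suc k) j) (trans
                (removed-unique (v∈ q) w∈F (trans (sym (proj₂ (row′ q))) ρ≡)) (sym v-q₀))) }))
            (cong 𝟙 (dec-true (i Fin.≟ row q₀) (face-injective K k
              (trans ρ≡ (trans (cong (F j -_) (sym v-q₀)) (sym (proj₂ (row′ q₀))))))))))
      where
      q₀ : Fin (suc k)
      q₀ = Inverse.from (o (suc k) j) (w , w∈F)
      v-q₀ : v q₀ ≡ w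
      v-q₀ = cong proj₁ (Inverse.strictlyInverseˡ (o (suc k) j) (w , w∈F))

  ⊆⇒facet : ∀ {r j} → ρ r ⊆ F j → ρ r ⋖ F j
  ⊆⇒facet {r} {j} ρ⊆F = ⊆⇒⋖ ρ⊆F
    (trans (proj₂ (face-isFace K (suc k) j)) (cong suc (sym (proj₂ (face-isFace K k r)))))

  B-row² : ∀ r → dot (B r) (B r) ≡ d r
  B-row² r = trans (Σℤ.sum-cong-≗ square) 
    (trans (length-filter (ρ r ⊆?_) (faces K (suc k))) (sym (d≡upperDegree r)))
    where
    square : ∀ j → B r j ℤ.* B r j ≡ 𝟙 (does (ρ r ⊆? F j))
    square j with ρ r ⋖? F j
    ... | yes f = trans (B-facet² f) (cong 𝟙 (sym (dec-true (ρ r ⊆? F j) (⋖⇒⊆ f))))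
    ... | no ¬f = trans (¬facet⇒product≡0 {r} {j} {j} (¬f ∘ proj₁))
                    (cong 𝟙 (sym (dec-false (ρ r ⊆? F j) (¬f ∘ ⊆⇒facet))))

  MB : Fin (#faces K k) → Fin (#faces K (suc k)) → ℤ
  MB r = apply M (B r)

  -- Write b for the row `B r`. Two distinct k-faces containing `ρ r` share precisely this ridge, so
  -- on these faces `M` is bbᵀ + k and b is multiplied by |b|² + k. The remaining k-faces do not
  -- contribute, as b vanishes there.
  MB-facet : ∀ {r j} → ρ r ⋖ F j → MB r j ≡ (d r ℤ.+ + k) ℤ.* B r j
  MB-facet {r} {j} f = begin
    sumℤ (λ j′ → M j j′ ℤ.* B r j′)
      ≡⟨ Σℤ.sum-cong-≗ term ⟩
    sumℤ (λ j′ → B r j ℤ.* (B r j′ ℤ.* B r j′ ℤ.+ extra j′))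
      ≡⟨ Σℤ.*-distribˡ-sum (B r j) (λ j′ → B r j′ ℤ.* B r j′ ℤ.+ extra j′) ⟨
    B r j ℤ.* sumℤ (λ j′ → B r j′ ℤ.* B r j′ ℤ.+ extra j′)
      ≡⟨ cong (B r j ℤ.*_) (trans (Σℤ.∑-distrib-+ (λ j′ → B r j′ ℤ.* B r j′) extra)
           (cong₂ ℤ._+_ (B-row² r) extra-sum)) ⟩
    B r j ℤ.* (d r ℤ.+ + k)
      ≡⟨ ℤ.*-comm (B r j) (d r ℤ.+ + k) ⟩
    (d r ℤ.+ + k) ℤ.* B r j ∎
    where
    open ≡-Reasoning
    -- The diagonal entry k + 1 splits into 1 from bbᵀ and the k recorded here.
    extra : Fin (#faces K (suc k)) → ℤ
    extra j′ = + k ℤ.* 𝟙 (does (j′ Fin.≟ j))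
    extra-sum : sumℤ extra ≡ + k
    extra-sum = trans (sum-at extra j (λ j′ j′≢j → trans
        (cong (λ b → + k ℤ.* 𝟙 b) (dec-false (j′ Fin.≟ j) j′≢j)) (ℤ.*-zeroʳ (+ k))))
      (trans (cong (λ b → + k ℤ.* 𝟙 b) (dec-true (j Fin.≟ j) refl)) (ℤ.*-identityʳ (+ k)))
    diagonal : ∀ b κ → b ℤ.* b ≡ 1ℤ → (1ℤ ℤ.+ κ) ℤ.* b ≡ b ℤ.* (b ℤ.* b ℤ.+ κ ℤ.* 1ℤ)
    diagonal b κ b²≡1 rewrite b²≡1 = lemma b κ
      where
      lemma : ∀ b κ → (1ℤ ℤ.+ κ) ℤ.* b ≡ b ℤ.* (1ℤ ℤ.+ κ ℤ.* 1ℤ)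
      lemma = ℤ-Solver.solve-∀
    offDiagonal : ∀ b c κ → b ℤ.* c ℤ.* c ≡ b ℤ.* (c ℤ.* c ℤ.+ κ ℤ.* 0ℤ)
    offDiagonal = ℤ-Solver.solve-∀
    term : ∀ j′ → M j j′ ℤ.* B r j′ ≡ B r j ℤ.* (B r j′ ℤ.* B r j′ ℤ.+ extra j′)
    term j′ with j′ Fin.≟ j
    ... | yes refl = trans (cong (ℤ._* B r j) (M-diag j)) (diagonal (B r j) (+ k) (B-facet² f))
    ... | no j′≢j with ρ r ⋖? F j′
    ...   | yes f′ = trans (cong (ℤ._* B r j′) (M-facet (j′≢j ∘ sym) f f′)) (offDiagonal (B r j) (B r j′) (+ k))
    ...   | no ¬f′ rewrite B-none {r} {j′} ¬f′ = trans (ℤ.*-zeroʳ (M j j′))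
              (trans (sym (ℤ.*-zeroʳ (B r j))) (cong (B r j ℤ.*_)
                (sym (trans (ℤ.+-identityˡ (+ k ℤ.* 0ℤ)) (ℤ.*-zeroʳ (+ k))))))

  MB-nonfacet : ∀ {r j} → ¬ (ρ r ⋖ F j) → Trit (MB r j)
  MB-nonfacet {r} {j} ¬f = trit-sum (λ j′ → M j j′ ℤ.* B r j′) trit opposite
    where
    facet? : ∀ j′ → M j j′ ℤ.* B r j′ ≢ 0ℤ → ρ r ⋖ F j′
    facet? j′ ≢0 = decidable-stable (ρ r ⋖? F j′) λ ¬f′ →
      ≢0 (trans (cong (M j j′ ℤ.*_) (B-none {r} {j′} ¬f′)) (ℤ.*-zeroʳ (M j j′)))
    shared : ∀ j′ → M j j′ ℤ.* B r j′ ≢ 0ℤ → ∃ λ i → ρ i ⋖ F j × ρ i ⋖ F j′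
    shared j′ ≢0 = decidable-stable (common-facet? j j′) λ ¬c →
      ≢0 (cong (ℤ._* B r j′) (M-none {j} {j′} λ i c → ¬c (i , c)))
    j≢ : ∀ {j′} → ρ r ⋖ F j′ → j ≢ j′
    j≢ f′ refl = ¬f f′
    trit : ∀ j′ → Trit (M j j′ ℤ.* B r j′)
    trit j′ with ρ r ⋖? F j′
    ... | yes f′ = trit-* (M-trit (j≢ f′)) (B-trit r j′)
    ... | no ¬f′ = subst Trit (sym (trans (cong (M j j′ ℤ.*_) (B-none {r} {j′} ¬f′)) (ℤ.*-zeroʳ (M j j′)))) none
    opposite : ∀ j₁ j₂ → j₁ ≢ j₂ → M j j₁ ℤ.* B r j₁ ≢ 0ℤ → M j j₂ ℤ.* B r j₂ ≢ 0ℤ →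
               M j j₁ ℤ.* B r j₁ ℤ.+ M j j₂ ℤ.* B r j₂ ≡ 0ℤ
    opposite j₁ j₂ j₁≢j₂ ≢0₁ ≢0₂
      with facet? j₁ ≢0₁ | facet? j₂ ≢0₂ | shared j₁ ≢0₁ | shared j₂ ≢0₂
    ... | f₁@(y , y∈ , y≡) | f₂@(y′ , y′∈ , y′≡)
        | i₁ , g₁@(z , z∈ , z≡) , h₁@(x , x∈ , x≡) | i₂ , g₂@(z′ , z′∈ , z′≡) , h₂@(x′ , x′∈ , x′≡) =
      begin
        M j j₁ ℤ.* B r j₁ ℤ.+ M j j₂ ℤ.* B r j₂
          ≡⟨ cong₂ ℤ._+_
               (reduce (oρ i₁) (oF j₁) (oρ r) (facetSign (F j) z) (facetSign (F j₁) x) (facetSign (F j₁) y)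
                 (M-facet (j≢ f₁) g₁ h₁) (B-facet {i₁} {j} z∈ z≡) (B-facet {i₁} {j₁} x∈ x≡)
                 (B-facet {r} {j₁} y∈ y≡) (oρ² i₁) (oF² j₁))
               (reduce (oρ i₂) (oF j₂) (oρ r) (facetSign (F j) z′) (facetSign (F j₂) x′) (facetSign (F j₂) y′)
                 (M-facet (j≢ f₂) g₂ h₂) (B-facet {i₂} {j} z′∈ z′≡) (B-facet {i₂} {j₂} x′∈ x′≡)
                 (B-facet {r} {j₂} y′∈ y′≡) (oρ² i₂) (oF² j₂)) ⟩
        c ℤ.* e₁ ℤ.+ c ℤ.* e₂
          ≡⟨ ℤ.*-distribˡ-+ c e₁ e₂ ⟨
        c ℤ.* (e₁ ℤ.+ e₂)
          ≡⟨ cong (c ℤ.*_) (facetSigns-opposite (¬f ∘ ⊆⇒facet) (j₁≢j₂ ∘ face-injective K (suc k))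
               y∈ y≡ y′∈ y′≡ z∈ z≡ x∈ x≡ z′∈ z′≡ x′∈ x′≡) ⟩
        c ℤ.* 0ℤ
          ≡⟨ ℤ.*-zeroʳ c ⟩
        0ℤ ∎
      where
      open ≡-Reasoning
      -- In each contribution the orientation signs of the shared ridge and of the k-face through
      -- `ρ r` occur squared. Those of `F j` and `ρ r` remain, and they are common to both
      -- contributions.
      c = oF j ℤ.* oρ r
      e₁ = facetSign (F j) z ℤ.* facetSign (F j₁) x ℤ.* facetSign (F j₁) y
      e₂ = facetSign (F j) z′ ℤ.* facetSign (F j₂) x′ ℤ.* facetSign (F j₂) y′
      reduce : ∀ s t a u v w {m b₁ b₂ b₃} → m ≡ b₁ ℤ.* b₂ →
        b₁ ≡ s ℤ.* oF j ℤ.* u → b₂ ≡ s ℤ.* t ℤ.* v → b₃ ≡ a ℤ.* t ℤ.* w →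
        s ℤ.* s ≡ 1ℤ → t ℤ.* t ≡ 1ℤ → m ℤ.* b₃ ≡ oF j ℤ.* a ℤ.* (u ℤ.* v ℤ.* w)
      reduce s t a u v w refl refl refl refl s²≡1 t²≡1 =
        trans (rearrange s t (oF j) a u v w)
          (trans (cong₂ (λ p q → p ℤ.* q ℤ.* (oF j ℤ.* a ℤ.* (u ℤ.* v ℤ.* w))) s²≡1 t²≡1) (ℤ.*-identityˡ _))
        where
        rearrange : ∀ s t f a u v w → s ℤ.* f ℤ.* u ℤ.* (s ℤ.* t ℤ.* v) ℤ.* (a ℤ.* t ℤ.* w) ≡
                    s ℤ.* s ℤ.* (t ℤ.* t) ℤ.* (f ℤ.* a ℤ.* (u ℤ.* v ℤ.* w))
        rearrange = ℤ-Solver.solve-∀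

-- Test vectors

0≤* : ∀ {x y} → 0ℤ ℤ.≤ x → 0ℤ ℤ.≤ y → 0ℤ ℤ.≤ x ℤ.* y
0≤* {x} {y} 0≤x 0≤y = subst (ℤ._≤ x ℤ.* y) (ℤ.*-zeroʳ x) (ℤ.*-monoˡ-≤-nonNeg x {{ℤ.nonNegative 0≤x}} 0≤y)

square-bound : ∀ {x d} → ℤ.- d ℤ.≤ x → x ℤ.≤ d → x ℤ.* x ℤ.≤ d ℤ.* d
square-bound {x} {d} -d≤x x≤d = ℤ.0≤i-j⇒j≤i (subst (0ℤ ℤ.≤_) (lemma x d)
  (0≤* (ℤ.i≤j⇒0≤j-i x≤d) (ℤ.i≤j⇒0≤j-i -d≤x)))
  where
  lemma : ∀ x d → (d ℤ.- x) ℤ.* (x ℤ.- ℤ.- d) ≡ d ℤ.* d ℤ.- x ℤ.* x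
  lemma = ℤ-Solver.solve-∀

trit²≤1 : ∀ {x} → Trit x → x ℤ.* x ℤ.≤ 1ℤ
trit²≤1 plus  = ℤ.+≤+ (ℕ.s≤s ℕ.z≤n)
trit²≤1 none  = ℤ.+≤+ ℕ.z≤n
trit²≤1 minus = ℤ.+≤+ (ℕ.s≤s ℕ.z≤n)

trit-*≤² : ∀ {x y} → Trit x → Trit y → x ℤ.* y ℤ.≤ y ℤ.* y
trit-*≤² plus  plus  = ℤ.≤-refl
trit-*≤² plus  none  = ℤ.≤-refl
trit-*≤² plus  minus = ℤ.-≤+
trit-*≤² none  plus  = ℤ.+≤+ ℕ.z≤n
trit-*≤² none  none  = ℤ.≤-refl
trit-*≤² none  minus = ℤ.+≤+ ℕ.z≤n
trit-*≤² minus plus  = ℤ.-≤+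
trit-*≤² minus none  = ℤ.≤-refl
trit-*≤² minus minus = ℤ.≤-refl

open Linearℤ

trit-dot-upper : ∀ {n} {u v : Fin n → ℤ} → (∀ j → Trit (u j)) → (∀ j → Trit (v j)) → dot u v ℤ.≤ dot v v
trit-dot-upper u-trit v-trit = sum-mono λ j → trit-*≤² (u-trit j) (v-trit j)

neg-sum : ∀ {n} (f : Fin n → ℤ) → sumℤ (λ j → ℤ.- f j) ≡ ℤ.- sumℤ f
neg-sum {zero}  f = refl
neg-sum {suc n} f = trans (cong (ℤ._+_ (ℤ.- f zero)) (neg-sum (f ∘ suc)))
                          (sym (ℤ.neg-distrib-+ (f zero) (sumℤ (f ∘ suc))))

trit-neg : ∀ {x} → Trit x → Trit (ℤ.- x)
trit-neg plus  = minus
trit-neg none  = none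
trit-neg minus = plus

-- Only the support of `v` enters the bound. The Cauchy-Schwarz inequality would also involve the
-- support of `u`, over which there is no control in the application.
trit-dot² : ∀ {n} {u v : Fin n → ℤ} → (∀ j → Trit (u j)) → (∀ j → Trit (v j)) →
            dot u v ℤ.* dot u v ℤ.≤ dot v v ℤ.* dot v v
trit-dot² {u = u} {v} u-trit v-trit = square-bound
  (subst₂ ℤ._≤_ refl (ℤ.neg-involutive (dot u v)) (ℤ.neg-mono-≤
    (subst (ℤ._≤ dot v v) (trans (Σℤ.sum-cong-≗ λ j → sym (ℤ.neg-distribˡ-* (u j) (v j))) (neg-sum λ j → u j ℤ.* v j))
      (trit-dot-upper (trit-neg ∘ u-trit) v-trit))))
  (trit-dot-upper u-trit v-trit)

-- Positivity of (p q; q r); 0 ≤ p follows.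
record PosForm (p q r : ℤ) : Set where
  constructor posForm
  field
    0<r   : 0ℤ ℤ.< r
    q²≤pr : q ℤ.* q ℤ.≤ p ℤ.* r

posForm-resp : ∀ {p p′ q q′ r r′} → p ≡ p′ → q ≡ q′ → r ≡ r′ → PosForm p′ q′ r′ → PosForm p q r
posForm-resp refl refl refl form = form

-- An integral basis of the plane of vectors y, so that every condition is an integer inequality.
-- The matrix in `excess` is the Gram matrix of BᵀB - c on this basis.
record TestVectors {n m} (B : Matrix ℤ n m) (c : ℤ) : Set where
  field
    y z : Fin m → ℤ
    excess : PosForm (dot (apply B y) (apply B y) ℤ.- c ℤ.* dot y y)
                     (dot (apply B y) (apply B z) ℤ.- c ℤ.* dot y z)
                     (dot (apply B z) (apply B z) ℤ.- c ℤ.* dot z z)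
    -- For the Gram matrix G this is 2G - 1, not G - 1: the latter is 0 for
    -- orthonormal y and z, whereas PosForm asks for r > 0.
    independent : PosForm (dot y y ℤ.+ dot y y ℤ.- 1ℤ) (dot y z ℤ.+ dot y z) (dot z z ℤ.+ dot z z ℤ.- 1ℤ)

twice-1 : ℤ → ℤ
twice-1 x = x ℤ.+ x ℤ.- 1ℤ

module _ {N} (K : SimplicialComplex N) (o : Orientation K) (k : ℕ) where

  open UpGram K o k

  gram : ∀ y z → dot (apply B y) (apply B z) ≡ dot (apply M y) z
  gram y z = trans (dot-adjoint B (apply B y) z)
                   (dot-cong {v = z} {z} (λ j → trans (sym (apply-⊗ (B ᵀ) B y j)) (cong (λ A → apply A y j) (sym M≡BᵀB))) (λ _ → refl))

  module _ (f g : Fin (#faces K (suc k))) (f≢g : f ≢ g) where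

    private
      e : Fin (#faces K (suc k)) → Fin (#faces K (suc k)) → ℤ
      e f j = 𝟙 (does (j Fin.≟ f))
      dot-e : ∀ u f → dot u (e f) ≡ u f
      dot-e u f = trans (sum-at (λ j → u j ℤ.* e f j) f λ j j≢f →
          trans (cong (λ b → u j ℤ.* 𝟙 b) (dec-false (j Fin.≟ f) j≢f)) (ℤ.*-zeroʳ (u j)))
        (trans (cong (λ b → u f ℤ.* 𝟙 b) (dec-true (f Fin.≟ f) refl)) (ℤ.*-identityʳ (u f)))
      gram-e : ∀ f g → dot (apply B (e f)) (apply B (e g)) ≡ M g f
      gram-e f g = trans (gram (e f) (e g)) (trans (dot-e (apply M (e f)) g) (dot-e (M g) f))
      ee : ∀ f → dot (e f) (e f) ≡ 1ℤ
      ee f = trans (dot-e (e f) f) (cong 𝟙 (dec-true (f Fin.≟ f) refl))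
      ef : dot (e f) (e g) ≡ 0ℤ
      ef = trans (dot-e (e f) g) (cong 𝟙 (dec-false (g Fin.≟ f) (f≢g ∘ sym)))
      diag : ∀ f → dot (apply B (e f)) (apply B (e f)) ℤ.- + k ℤ.* dot (e f) (e f) ≡ 1ℤ
      diag f rewrite gram-e f f | M-diag f | ee f = lemma (+ k)
        where
        lemma : ∀ κ → 1ℤ ℤ.+ κ ℤ.- κ ℤ.* 1ℤ ≡ 1ℤ
        lemma = ℤ-Solver.solve-∀
      cross : dot (apply B (e f)) (apply B (e g)) ℤ.- + k ℤ.* dot (e f) (e g) ≡ M g f
      cross rewrite gram-e f g | ef | ℤ.*-zeroʳ (+ k) = ℤ.+-identityʳ (M g f)

    faceVectors : TestVectors B (+ k)
    faceVectors = record
      { y = e f ; z = e g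
      ; excess = posForm-resp (diag f) cross (diag g)
          (posForm (ℤ.+<+ (ℕ.s≤s ℕ.z≤n)) (trit²≤1 (M-trit (f≢g ∘ sym))))
      ; independent = posForm-resp (cong twice-1 (ee f)) (cong₂ ℤ._+_ ef ef) (cong twice-1 (ee g))
          (posForm (ℤ.+<+ (ℕ.s≤s ℕ.z≤n)) (ℤ.+≤+ ℕ.z≤n))
      }

  module _ (r s : Fin (#faces K k)) (r≢s : r ≢ s) (ds≤dr : d s ℤ.≤ d r) (2≤ds : + 2 ℤ.≤ d s) where

    private
      c : ℤ
      c = d s ℤ.+ + k ℤ.- 1ℤ

      gram-diag : ∀ t → dot (apply B (B t)) (apply B (B t)) ≡ (d t ℤ.+ + k) ℤ.* d t
      gram-diag t = trans (gram (B t) (B t)) (trans (Σℤ.sum-cong-≗ term)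
        (trans (sym (Σℤ.*-distribˡ-sum (d t ℤ.+ + k) (λ j → B t j ℤ.* B t j)))
          (cong ((d t ℤ.+ + k) ℤ.*_) (B-row² t))))
        where
        term : ∀ j → MB t j ℤ.* B t j ≡ (d t ℤ.+ + k) ℤ.* (B t j ℤ.* B t j)
        term j with ρ t ⋖? F j
        ... | yes f = trans (cong (ℤ._* B t j) (MB-facet f)) (ℤ.*-assoc (d t ℤ.+ + k) (B t j) (B t j))
        ... | no ¬f = trans (trans (cong (MB t j ℤ.*_) (B-none {t} {j} ¬f)) (ℤ.*-zeroʳ (MB t j)))
                (sym (trans (cong ((d t ℤ.+ + k) ℤ.*_) (¬facet⇒product≡0 {t} {j} {j} (¬f ∘ proj₁)))
                  (ℤ.*-zeroʳ (d t ℤ.+ + k))))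

      residual : Fin (#faces K (suc k)) → ℤ
      residual j = MB s j ℤ.- c ℤ.* B s j

      -- The value of `c` is one less than the factor in `MB-facet`, so around `ρ s` the residual is
      -- the row `B s` itself; elsewhere the row vanishes and `MB-nonfacet` applies.
      residual-trit : ∀ j → Trit (residual j)
      residual-trit j with ρ s ⋖? F j
      ... | yes f = subst Trit (sym (trans (cong (ℤ._- c ℤ.* B s j) (MB-facet f)) (lemma (d s) (+ k) (B s j)))) (B-trit s j)
        where
        lemma : ∀ d κ b → (d ℤ.+ κ) ℤ.* b ℤ.- (d ℤ.+ κ ℤ.- 1ℤ) ℤ.* b ≡ b
        lemma = ℤ-Solver.solve-∀
      ... | no ¬f = subst Trit (sym (trans (cong (λ b → MB s j ℤ.- c ℤ.* b) (B-none {s} {j} ¬f))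
                      (trans (cong (λ x → MB s j ℤ.- x) (ℤ.*-zeroʳ c)) (ℤ.+-identityʳ (MB s j))))) (MB-nonfacet ¬f)

      cross : dot (apply B (B s)) (apply B (B r)) ℤ.- c ℤ.* dot (B s) (B r) ≡ dot residual (B r)
      cross = trans (cong₂ ℤ._-_ (gram (B s) (B r)) (sym (trans (Σℤ.sum-cong-≗ λ j → ℤ.*-assoc c (B s j) (B r j))
                (sym (Σℤ.*-distribˡ-sum c (λ j → B s j ℤ.* B r j))))))
              (trans (cong (ℤ._+_ (dot (MB s) (B r))) (sym (neg-sum (λ j → c ℤ.* B s j ℤ.* B r j))))
              (trans (sym (Σℤ.∑-distrib-+ (λ j → MB s j ℤ.* B r j) (λ j → ℤ.- (c ℤ.* B s j ℤ.* B r j))))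
                (Σℤ.sum-cong-≗ λ j → lemma (MB s j) (c ℤ.* B s j) (B r j))))
        where
        lemma : ∀ x y z → x ℤ.* z ℤ.+ ℤ.- (y ℤ.* z) ≡ (x ℤ.- y) ℤ.* z
        lemma = ℤ-Solver.solve-∀

      -- The constant is tuned to `s`, so it is the residual of `s` that has small entries; it is
      -- paired with the row of `r`, which has `d r` nonzero ones.
      cross² : dot residual (B r) ℤ.* dot residual (B r) ℤ.≤ d r ℤ.* d r
      cross² = subst (λ x → dot residual (B r) ℤ.* dot residual (B r) ℤ.≤ x ℤ.* x) (B-row² r)
        (trit-dot² residual-trit (B-trit r))

      -- Two distinct ridges lie together in at most one k-face. No two terms are nonzero, and the
      -- cancellation condition of `trit-sum` holds vacuously.
      overlap-trit : Trit (dot (B s) (B r))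
      overlap-trit = trit-sum (λ j → B s j ℤ.* B r j) (λ j → trit-* (B-trit s j) (B-trit r j))
        λ i j i≢j ≢0ᵢ ≢0ⱼ → contradiction (face-injective K (suc k)
          (common-facet-unique (r≢s ∘ sym ∘ face-injective K k)
            (left ≢0ᵢ) (left ≢0ⱼ) (right ≢0ᵢ) (right ≢0ⱼ))) i≢j
        where
        left : ∀ {j} → B s j ℤ.* B r j ≢ 0ℤ → ρ s ⋖ F j
        left {j} ≢0 with ρ s ⋖? F j
        ... | yes f = f
        ... | no ¬f = contradiction (cong (ℤ._* B r j) (B-none {s} {j} ¬f)) ≢0
        right : ∀ {j} → B s j ℤ.* B r j ≢ 0ℤ → ρ r ⋖ F j
        right {j} ≢0 with ρ r ⋖? F j
        ... | yes f = f
        ... | no ¬f = contradiction (trans (cong (B s j ℤ.*_) (B-none {r} {j} ¬f)) (ℤ.*-zeroʳ (B s j))) ≢0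

      0≤dr : 0ℤ ℤ.≤ d r
      0≤dr = ℤ.≤-trans (ℤ.+≤+ ℕ.z≤n) (ℤ.≤-trans 2≤ds ds≤dr)
      gap : 0ℤ ℤ.≤ d r ℤ.- d s
      gap = ℤ.i≤j⇒0≤j-i ds≤dr
      0≤ds-2 : 0ℤ ℤ.≤ d s ℤ.- + 2
      0≤ds-2 = ℤ.i≤j⇒0≤j-i 2≤ds
      0≤ds-1 : 0ℤ ℤ.≤ d s ℤ.- 1ℤ
      0≤ds-1 = ℤ.i≤j⇒0≤j-i (ℤ.≤-trans (ℤ.+≤+ (ℕ.s≤s ℕ.z≤n)) 2≤ds)
      0≤dr-2 : 0ℤ ℤ.≤ d r ℤ.- + 2
      0≤dr-2 = ℤ.i≤j⇒0≤j-i (ℤ.≤-trans 2≤ds ds≤dr)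

      0<-from : ∀ {x y} → 0ℤ ℤ.≤ x → x ℤ.+ 1ℤ ≡ y → 0ℤ ℤ.< y
      0<-from {+ n} _ refl = ℤ.+<+ (ℕ.m≤n+m 1 n)

      -- With a = `d r` and b = `d s` the diagonal simplifies to b and a(a - b + 1). Replacing the
      -- squared off-diagonal entry by its bound a² leaves the determinant a(a - b)(b - 1).
      excess-form : PosForm ((d s ℤ.+ + k) ℤ.* d s ℤ.- c ℤ.* d s) (dot residual (B r))
                            ((d r ℤ.+ + k) ℤ.* d r ℤ.- c ℤ.* d r)
      excess-form = posForm
        (0<-from (ℤ.+-mono-≤ (0≤* gap 0≤dr) (ℤ.+-mono-≤ 0≤dr-2 (ℤ.+≤+ {0} {1} ℕ.z≤n)))
          (positive (d r) (d s) (+ k)))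
        (ℤ.≤-trans cross² (ℤ.0≤i-j⇒j≤i (subst (0ℤ ℤ.≤_) (determinant (d r) (d s) (+ k))
          (0≤* (0≤* 0≤dr gap) 0≤ds-1))))
        where
        positive : ∀ a b κ → (a ℤ.- b) ℤ.* a ℤ.+ (a ℤ.- + 2 ℤ.+ 1ℤ) ℤ.+ 1ℤ ≡
                   (a ℤ.+ κ) ℤ.* a ℤ.- (b ℤ.+ κ ℤ.- 1ℤ) ℤ.* a
        positive = ℤ-Solver.solve-∀
        determinant : ∀ a b κ → a ℤ.* (a ℤ.- b) ℤ.* (b ℤ.- 1ℤ) ≡
                      ((b ℤ.+ κ) ℤ.* b ℤ.- (b ℤ.+ κ ℤ.- 1ℤ) ℤ.* b) ℤ.*
                      ((a ℤ.+ κ) ℤ.* a ℤ.- (b ℤ.+ κ ℤ.- 1ℤ) ℤ.* a) ℤ.- a ℤ.* a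
        determinant = ℤ-Solver.solve-∀

      -- The margin is smallest when both degrees are 2: the diagonal product is 3 · 3 = 9, against
      -- at most 4 from the overlap. Expanding in the differences of the degrees from 2 leaves only
      -- nonnegative terms and the surplus 5.
      independent-form : PosForm (d s ℤ.+ d s ℤ.- 1ℤ) (dot (B s) (B r) ℤ.+ dot (B s) (B r)) (d r ℤ.+ d r ℤ.- 1ℤ)
      independent-form = posForm
        (0<-from (ℤ.+-mono-≤ (ℤ.+-mono-≤ 0≤dr-2 0≤dr-2) (ℤ.+≤+ {0} {2} ℕ.z≤n)) (positive (d r)))
        (ℤ.0≤i-j⇒j≤i (subst (0ℤ ℤ.≤_) (determinant (d r) (d s) (dot (B s) (B r)))
          (ℤ.+-mono-≤ (ℤ.+-mono-≤ (0≤* (ℤ.+≤+ {0} {4} ℕ.z≤n) (0≤* 0≤ds-2 0≤dr-2))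
              (0≤* (ℤ.+≤+ {0} {6} ℕ.z≤n) (ℤ.+-mono-≤ 0≤ds-2 0≤dr-2)))
            (ℤ.+-mono-≤ (ℤ.+≤+ {0} {5} ℕ.z≤n) (0≤* (ℤ.+≤+ {0} {4} ℕ.z≤n) (ℤ.i≤j⇒0≤j-i (trit²≤1 overlap-trit)))))))
        where
        positive : ∀ a → a ℤ.- + 2 ℤ.+ (a ℤ.- + 2) ℤ.+ + 2 ℤ.+ 1ℤ ≡ a ℤ.+ a ℤ.- 1ℤ
        positive = ℤ-Solver.solve-∀
        determinant : ∀ a b l → + 4 ℤ.* ((b ℤ.- + 2) ℤ.* (a ℤ.- + 2)) ℤ.+ + 6 ℤ.* ((b ℤ.- + 2) ℤ.+ (a ℤ.- + 2)) ℤ.+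
                      (+ 5 ℤ.+ + 4 ℤ.* (1ℤ ℤ.- l ℤ.* l)) ≡
                      (b ℤ.+ b ℤ.- 1ℤ) ℤ.* (a ℤ.+ a ℤ.- 1ℤ) ℤ.- (l ℤ.+ l) ℤ.* (l ℤ.+ l)
        determinant = ℤ-Solver.solve-∀

    ridgeVectors : TestVectors B (d s ℤ.+ + k ℤ.- 1ℤ)
    ridgeVectors = record
      { y = B s ; z = B r
      ; excess = posForm-resp
          (cong₂ (λ x y → x ℤ.- c ℤ.* y) (gram-diag s) (B-row² s)) cross
          (cong₂ (λ x y → x ℤ.- c ℤ.* y) (gram-diag r) (B-row² r)) excess-form
      ; independent = posForm-resp (cong twice-1 (B-row² s)) refl (cong twice-1 (B-row² r)) independent-form
      }

-- The ordered ring ℝ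

ℚ-ring : AlmostCommutativeRing 0ℓ 0ℓ
ℚ-ring = fromCommutativeRing ℚ.+-*-commutativeRing λ x → dec⇒maybe (0ℚ ℚ.≟ x)

∣p-q∣<r⇒p<q+r : ∀ p q {r} → ℚ.∣ p ℚ.- q ∣ ℚ.< r → p ℚ.< q ℚ.+ r
∣p-q∣<r⇒p<q+r p q {r} h = subst₂ ℚ._<_ (lemma p q) (ℚ.+-comm r q)
  (ℚ.+-monoˡ-< q (ℚ.≤-<-trans (p≤∣p∣ (p ℚ.- q)) h))
  where
  lemma : ∀ a b → (a ℚ.- b) ℚ.+ b ≡ a
  lemma = RingSolver.solve-∀ ℚ-ring
  p≤∣p∣ : ∀ p → p ℚ.≤ ℚ.∣ p ∣
  p≤∣p∣ p with ℚ.≤-total 0ℚ p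
  ... | inj₁ 0≤p = ℚ.≤-reflexive (sym (ℚ.0≤p⇒∣p∣≡p 0≤p))
  ... | inj₂ p≤0 = ℚ.≤-trans p≤0 (ℚ.0≤∣p∣ p)

pointwise : ∀ {x y} → (∀ n → seq x n ≡ seq y n) → x ≈ y
pointwise {x} eq = mk≈ λ ε 0<ε → 0 , λ n _ →
  subst (λ z → ℚ.∣ seq x n ℚ.- z ∣ ℚ.< ε) (eq n) (subst (λ z → ℚ.∣ z ∣ ℚ.< ε) (sym (ℚ.+-inverseʳ (seq x n))) 0<ε)

pointwise-≤ : ∀ {x y} → (∀ n → seq x n ℚ.≤ seq y n) → x ≤ y
pointwise-≤ {x} {y} le = mk≤ λ ε 0<ε → 0 , λ n _ →
  subst (ℚ._< seq y n ℚ.+ ε) (ℚ.+-identityʳ (seq x n)) (ℚ.+-mono-≤-< (le n) 0<ε)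

private
  Eventually : (ℕ → Set) → Set
  Eventually P = ∃ λ N → ∀ n → N ℕ.≤ n → P n

  both : ∀ {P Q R : ℕ → Set} → Eventually P → Eventually Q → (∀ n → P n → Q n → R n) → Eventually R
  both (M , p) (N , q) f = M ℕ.⊔ N , λ n le →
    f n (p n (ℕ.m⊔n≤o⇒m≤o M N le)) (q n (ℕ.m⊔n≤o⇒n≤o M N le))

≈-refl : ∀ {x} → x ≈ x
≈-refl = pointwise λ _ → refl

≈-sym : ∀ {x y} → x ≈ y → y ≈ x
≈-sym {x} {y} (mk≈ c) = mk≈ λ ε 0<ε → let N , h = c ε 0<ε in N , λ n le →
  subst (ℚ._< ε) (trans (sym (ℚ.∣-p∣≡∣p∣ (seq x n ℚ.- seq y n))) (cong ℚ.∣_∣ (lemma (seq x n) (seq y n)))) (h n le)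
  where
  lemma : ∀ a b → ℚ.- (a ℚ.- b) ≡ b ℚ.- a
  lemma = RingSolver.solve-∀ ℚ-ring

≈-trans : ∀ {x y z} → x ≈ y → y ≈ z → x ≈ z
≈-trans {x} {y} {z} (mk≈ c₁) (mk≈ c₂) = mk≈ λ ε 0<ε →
  both (c₁ (½ ℚ.* ε) (half ε 0<ε)) (c₂ (½ ℚ.* ε) (half ε 0<ε)) λ n h₁ h₂ → begin-strict
    ℚ.∣ seq x n ℚ.- seq z n ∣
      ≡⟨ cong ℚ.∣_∣ (lemma (seq x n) (seq y n) (seq z n)) ⟩
    ℚ.∣ (seq x n ℚ.- seq y n) ℚ.+ (seq y n ℚ.- seq z n) ∣
      ≤⟨ ℚ.∣p+q∣≤∣p∣+∣q∣ (seq x n ℚ.- seq y n) (seq y n ℚ.- seq z n) ⟩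
    ℚ.∣ seq x n ℚ.- seq y n ∣ ℚ.+ ℚ.∣ seq y n ℚ.- seq z n ∣
      <⟨ ℚ.+-mono-< h₁ h₂ ⟩
    ½ ℚ.* ε ℚ.+ ½ ℚ.* ε
      ≡⟨ halves ε ⟩
    ε ∎
  where
  open ℚ.≤-Reasoning
  lemma : ∀ a b c → a ℚ.- c ≡ (a ℚ.- b) ℚ.+ (b ℚ.- c)
  lemma = RingSolver.solve-∀ ℚ-ring

+ᵣ-cong : ∀ {x x′ y y′} → x ≈ x′ → y ≈ y′ → x +ᵣ y ≈ x′ +ᵣ y′
+ᵣ-cong {x} {x′} {y} {y′} (mk≈ c₁) (mk≈ c₂) = mk≈ λ ε 0<ε →
  both (c₁ (½ ℚ.* ε) (half ε 0<ε)) (c₂ (½ ℚ.* ε) (half ε 0<ε)) λ n h₁ h₂ → begin-strict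
    ℚ.∣ (seq x n ℚ.+ seq y n) ℚ.- (seq x′ n ℚ.+ seq y′ n) ∣
      ≡⟨ cong ℚ.∣_∣ (rearrange₁ (seq x n) (seq y n) (seq x′ n) (seq y′ n)) ⟩
    ℚ.∣ (seq x n ℚ.- seq x′ n) ℚ.+ (seq y n ℚ.- seq y′ n) ∣
      ≤⟨ ℚ.∣p+q∣≤∣p∣+∣q∣ (seq x n ℚ.- seq x′ n) (seq y n ℚ.- seq y′ n) ⟩
    ℚ.∣ seq x n ℚ.- seq x′ n ∣ ℚ.+ ℚ.∣ seq y n ℚ.- seq y′ n ∣
      <⟨ ℚ.+-mono-< h₁ h₂ ⟩
    ½ ℚ.* ε ℚ.+ ½ ℚ.* ε
      ≡⟨ halves ε ⟩
    ε ∎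
  where open ℚ.≤-Reasoning

-ᵣ-cong : ∀ {x y} → x ≈ y → -ᵣ x ≈ -ᵣ y
-ᵣ-cong {x} {y} (mk≈ c) = mk≈ λ ε 0<ε → let N , h = c ε 0<ε in N , λ n le →
  subst (ℚ._< ε) (trans (sym (ℚ.∣-p∣≡∣p∣ (seq x n ℚ.- seq y n))) (cong ℚ.∣_∣ (rearrange₂ (seq x n) (seq y n)))) (h n le)

*ᵣ-cong : ∀ {x x′ y y′} → x ≈ x′ → y ≈ y′ → x *ᵣ y ≈ x′ *ᵣ y′
*ᵣ-cong {x} {x′} {y} {y′} (mk≈ c₁) (mk≈ c₂) = mk≈ λ ε 0<ε →
  let C , N₁ , 0<C , bx = bounded (seq x) (isCauchy x)
      D , N₂ , 0<D , by = bounded (seq y′) (isCauchy y′)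
      δ , 0<δ , Cδ≡ = quotient C 0<C (½ ℚ.* ε) (half ε 0<ε)
      γ , 0<γ , Dγ≡ = quotient D 0<D (½ ℚ.* ε) (half ε 0<ε)
  in both (both (N₁ , bx) (N₂ , by) (λ _ → _,_)) (both (c₂ δ 0<δ) (c₁ γ 0<γ) (λ _ → _,_))
    λ n (hx , hy) (h₂ , h₁) → product-bound {C} {D} {ε} (seq x n) (seq y n) (seq x′ n) (seq y′ n) hx hy
      (subst (C ℚ.* ℚ.∣ seq y n ℚ.- seq y′ n ∣ ℚ.<_) Cδ≡ (ℚ.*-monoʳ-<-pos C {{ℚ.positive 0<C}} h₂))
      (subst (D ℚ.* ℚ.∣ seq x n ℚ.- seq x′ n ∣ ℚ.<_) Dγ≡ (ℚ.*-monoʳ-<-pos D {{ℚ.positive 0<D}} h₁))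

ℝ-commutativeRing : CommutativeRing 0ℓ 0ℓ
ℝ-commutativeRing = record
  { Carrier = ℝ ; _≈_ = _≈_ ; _+_ = _+ᵣ_ ; _*_ = _*ᵣ_ ; -_ = -ᵣ_ ; 0# = fromℤ 0ℤ ; 1# = fromℤ 1ℤ
  ; isCommutativeRing = record
    { isRing = record
      { +-isAbelianGroup = record
        { isGroup = record
          { isMonoid = record
            { isSemigroup = record
              { isMagma = record
                { isEquivalence = record { refl = ≈-refl ; sym = ≈-sym ; trans = ≈-trans }
                ; ∙-cong = +ᵣ-cong }
              ; assoc = λ x y z → pointwise λ n → ℚ.+-assoc (seq x n) (seq y n) (seq z n) }
            ; identity = (λ x → pointwise λ n → ℚ.+-identityˡ (seq x n))
                       , (λ x → pointwise λ n → ℚ.+-identityʳ (seq x n)) }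
          ; inverse = (λ x → pointwise λ n → ℚ.+-inverseˡ (seq x n))
                    , (λ x → pointwise λ n → ℚ.+-inverseʳ (seq x n))
          ; ⁻¹-cong = -ᵣ-cong }
        ; comm = λ x y → pointwise λ n → ℚ.+-comm (seq x n) (seq y n) }
      ; *-cong = *ᵣ-cong
      ; *-assoc = λ x y z → pointwise λ n → ℚ.*-assoc (seq x n) (seq y n) (seq z n)
      ; *-identity = (λ x → pointwise λ n → ℚ.*-identityˡ (seq x n))
                   , (λ x → pointwise λ n → ℚ.*-identityʳ (seq x n))
      ; distrib = (λ x y z → pointwise λ n → ℚ.*-distribˡ-+ (seq x n) (seq y n) (seq z n))
                , (λ x y z → pointwise λ n → ℚ.*-distribʳ-+ (seq x n) (seq y n) (seq z n)) }
    ; *-comm = λ x y → pointwise λ n → ℚ.*-comm (seq x n) (seq y n) } }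

≤-reflexive : ∀ {x y} → x ≈ y → x ≤ y
≤-reflexive {x} {y} (mk≈ c) = mk≤ λ ε 0<ε → let N , h = c ε 0<ε in N , λ n le →
  ∣p-q∣<r⇒p<q+r (seq x n) (seq y n) (h n le)

≤-trans : ∀ {x y z} → x ≤ y → y ≤ z → x ≤ z
≤-trans {x} {y} {z} (mk≤ b₁) (mk≤ b₂) = mk≤ λ ε 0<ε →
  both (b₁ (½ ℚ.* ε) (half ε 0<ε)) (b₂ (½ ℚ.* ε) (half ε 0<ε)) λ n h₁ h₂ →
    subst (seq x n ℚ.<_) (trans (ℚ.+-assoc (seq z n) (½ ℚ.* ε) (½ ℚ.* ε)) (cong (seq z n ℚ.+_) (halves ε)))
      (ℚ.<-trans h₁ (ℚ.+-monoˡ-< (½ ℚ.* ε) h₂))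

+ᵣ-mono-≤ : ∀ {x x′ y y′} → x ≤ x′ → y ≤ y′ → x +ᵣ y ≤ x′ +ᵣ y′
+ᵣ-mono-≤ {x} {x′} {y} {y′} (mk≤ b₁) (mk≤ b₂) = mk≤ λ ε 0<ε →
  both (b₁ (½ ℚ.* ε) (half ε 0<ε)) (b₂ (½ ℚ.* ε) (half ε 0<ε)) λ n h₁ h₂ →
    subst (seq x n ℚ.+ seq y n ℚ.<_)
      (trans (lemma (seq x′ n) (seq y′ n) (½ ℚ.* ε)) (cong (seq x′ n ℚ.+ seq y′ n ℚ.+_) (halves ε)))
      (ℚ.+-mono-< h₁ h₂)
  where
  lemma : ∀ a b e → (a ℚ.+ e) ℚ.+ (b ℚ.+ e) ≡ a ℚ.+ b ℚ.+ (e ℚ.+ e)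
  lemma = RingSolver.solve-∀ ℚ-ring

-- Termwise, hence stronger than `0ᵣ ≤ s`. Squares, sums of squares and the forms below have this
-- property, and it allows multiplication of an inequality without an error term for the factor.
NonNegative : ℝ → Set
NonNegative s = ∀ n → 0ℚ ℚ.≤ seq s n

*ᵣ-monoˡ-≤ : ∀ {s} → NonNegative s → ∀ {x y} → x ≤ y → x *ᵣ s ≤ y *ᵣ s
*ᵣ-monoˡ-≤ {s} 0≤s {x} {y} (mk≤ b) = mk≤ λ ε 0<ε →
  let D , N , 0<D , bs = bounded (seq s) (isCauchy s)
      -- The factor enlarges the error to at most ε/2; the other half supplies the strict
      -- inequality.
      δ , 0<δ , Dδ≡ε = quotient D 0<D (½ ℚ.* ε) (half ε 0<ε)
  in both (b δ 0<δ) (N , bs) λ n h hs → let open ℚ.≤-Reasoning in begin-strict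
    seq x n ℚ.* seq s n
      ≤⟨ ℚ.*-monoʳ-≤-nonNeg (seq s n) {{ℚ.nonNegative (0≤s n)}} (ℚ.<⇒≤ h) ⟩
    (seq y n ℚ.+ δ) ℚ.* seq s n
      ≡⟨ lemma (seq y n) δ (seq s n) ⟩
    seq y n ℚ.* seq s n ℚ.+ seq s n ℚ.* δ
      ≤⟨ ℚ.+-monoʳ-≤ (seq y n ℚ.* seq s n) (ℚ.*-monoʳ-≤-nonNeg δ {{ℚ.nonNegative (ℚ.<⇒≤ 0<δ)}}
           (subst (ℚ._≤ D) (ℚ.0≤p⇒∣p∣≡p (0≤s n)) hs)) ⟩
    seq y n ℚ.* seq s n ℚ.+ D ℚ.* δ
      ≡⟨ cong (seq y n ℚ.* seq s n ℚ.+_) Dδ≡ε ⟩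
    seq y n ℚ.* seq s n ℚ.+ ½ ℚ.* ε
      <⟨ ℚ.+-monoʳ-< (seq y n ℚ.* seq s n) (subst (½ ℚ.* ε ℚ.<_) (halves ε)
           (subst (ℚ._< ½ ℚ.* ε ℚ.+ ½ ℚ.* ε) (ℚ.+-identityʳ (½ ℚ.* ε)) (ℚ.+-monoʳ-< (½ ℚ.* ε) (half ε 0<ε)))) ⟩
    seq y n ℚ.* seq s n ℚ.+ ε ∎
  where
  lemma : ∀ a d b → (a ℚ.+ d) ℚ.* b ≡ a ℚ.* b ℚ.+ b ℚ.* d
  lemma = RingSolver.solve-∀ ℚ-ring

0ᵣ 1ᵣ : ℝ
0ᵣ = fromℤ 0ℤ
1ᵣ = fromℤ 1ℤ

x≤y⇒0≤y-x : ∀ {x y} → x ≤ y → 0ᵣ ≤ y -ᵣ x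
x≤y⇒0≤y-x {x} {y} x≤y = ≤-trans (≤-reflexive (pointwise λ n → sym (ℚ.+-inverseʳ (seq x n))))
  (+ᵣ-mono-≤ x≤y (≤-reflexive (≈-refl { -ᵣ x})))

0≤y-x⇒x≤y : ∀ {x y} → 0ᵣ ≤ y -ᵣ x → x ≤ y
0≤y-x⇒x≤y {x} {y} 0≤ = ≤-trans (≤-reflexive (pointwise λ n → sym (ℚ.+-identityˡ (seq x n))))
  (≤-trans (+ᵣ-mono-≤ 0≤ (≤-reflexive (≈-refl {x}))) (≤-reflexive (pointwise λ n → lemma (seq x n) (seq y n))))
  where
  lemma : ∀ x y → y ℚ.- x ℚ.+ x ≡ y
  lemma = RingSolver.solve-∀ ℚ-ring

∣p∣²≡p² : ∀ p → ℚ.∣ p ∣ ℚ.* ℚ.∣ p ∣ ≡ p ℚ.* p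
∣p∣²≡p² p with ℚ.∣p∣≡p∨∣p∣≡-p p
... | inj₁ eq = cong₂ ℚ._*_ eq eq
... | inj₂ eq = trans (cong₂ ℚ._*_ eq eq) (lemma p)
  where
  lemma : ∀ p → ℚ.- p ℚ.* ℚ.- p ≡ p ℚ.* p
  lemma = RingSolver.solve-∀ ℚ-ring

sq≤0⇒≈0 : ∀ {x} → x *ᵣ x ≤ 0ᵣ → x ≈ 0ᵣ
sq≤0⇒≈0 {x} (mk≤ b) = mk≈ λ ε 0<ε → let N , h = b (ε ℚ.* ε) (0<ε² ε 0<ε) in N , λ n le →
  ℚ.≰⇒> λ ε≤ → ℚ.<-irrefl refl (ℚ.<-≤-trans (subst (seq x n ℚ.* seq x n ℚ.<_) (ℚ.+-identityˡ (ε ℚ.* ε)) (h n le))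
    (ℚ.≤-trans (square-mono ε (seq x n) (ℚ.<⇒≤ 0<ε) (subst (λ z → ε ℚ.≤ ℚ.∣ z ∣) (ℚ.+-identityʳ (seq x n)) ε≤))
      (ℚ.≤-reflexive (∣p∣²≡p² (seq x n)))))
  where
  0<ε² : ∀ ε → 0ℚ ℚ.< ε → 0ℚ ℚ.< ε ℚ.* ε
  0<ε² ε 0<ε = subst (ℚ._< ε ℚ.* ε) (ℚ.*-zeroʳ ε) (ℚ.*-monoʳ-<-pos ε {{ℚ.positive 0<ε}} 0<ε)
  square-mono : ∀ ε p → 0ℚ ℚ.≤ ε → ε ℚ.≤ ℚ.∣ p ∣ → ε ℚ.* ε ℚ.≤ ℚ.∣ p ∣ ℚ.* ℚ.∣ p ∣
  square-mono ε p 0≤ε ε≤ = ℚ.≤-trans (ℚ.*-monoˡ-≤-nonNeg ε {{ℚ.nonNegative 0≤ε}} ε≤)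
    (ℚ.*-monoʳ-≤-nonNeg ℚ.∣ p ∣ {{ℚ.∣-∣-nonNeg p}} ε≤)

square-nonNeg : ∀ p → 0ℚ ℚ.≤ p ℚ.* p
square-nonNeg p = ℚ.≤-trans (ℚ.≤-reflexive (sym (ℚ.*-zeroʳ ℚ.∣ p ∣)))
  (ℚ.≤-trans (ℚ.*-monoˡ-≤-nonNeg ℚ.∣ p ∣ {{ℚ.∣-∣-nonNeg p}} (ℚ.0≤∣p∣ p)) (ℚ.≤-reflexive (∣p∣²≡p² p)))

const : ℚ → ℝ
const q = mkℝ (λ _ → q) (const-cauchy q)

-- A comparison of rational terms is decidable. If one late term of `x` falls short of `q` by ε, the
-- Cauchy property keeps all later terms below `q` by a fixed rational margin, which is what the
-- hypothesis excludes.
≤-by-contradiction : ∀ q x → (∀ δ → 0ℚ ℚ.< δ → ¬ (x +ᵣ const δ ≤ const q)) → const q ≤ x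
≤-by-contradiction q x ¬below = mk≤ λ ε 0<ε →
  -- One η pays for the fluctuation of the later terms and one is the margin that remains; together
  -- they use ε/2.
  let η = ½ ℚ.* (½ ℚ.* ε)
      0<η = half (½ ℚ.* ε) (half ε 0<ε)
      N , h = isCauchy x η 0<η
  in N , λ n N≤n → ℚ.≰⇒> λ xₙ+ε≤q → ¬below η 0<η (mk≤ λ ε′ 0<ε′ → N , λ m N≤m →
    let open ℚ.≤-Reasoning in begin-strict
      seq x m ℚ.+ η
        <⟨ ℚ.+-monoˡ-< η (∣p-q∣<r⇒p<q+r (seq x m) (seq x n) (h m n N≤m N≤n)) ⟩
      seq x n ℚ.+ η ℚ.+ η
        ≡⟨ trans (ℚ.+-assoc (seq x n) η η) (cong (seq x n ℚ.+_) (halves (½ ℚ.* ε))) ⟩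
      seq x n ℚ.+ ½ ℚ.* ε
        ≤⟨ ℚ.+-monoʳ-≤ (seq x n) (subst₂ ℚ._≤_ (ℚ.+-identityʳ (½ ℚ.* ε)) (halves ε)
             (ℚ.+-monoʳ-≤ (½ ℚ.* ε) (ℚ.<⇒≤ (half ε 0<ε)))) ⟩
      seq x n ℚ.+ ε
        ≤⟨ xₙ+ε≤q ⟩
      q
        <⟨ subst (ℚ._< q ℚ.+ ε′) (ℚ.+-identityʳ q) (ℚ.+-monoʳ-< q 0<ε′) ⟩
      q ℚ.+ ε′ ∎)

-- Division normalizes its result; among unnormalised fractions with denominator 1 the claim is an
-- identity of integers.
/1-homo-+ : ∀ a b → (a ℤ.+ b) ℚ./ 1 ≡ a ℚ./ 1 ℚ.+ b ℚ./ 1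
/1-homo-+ a b = ℚ.toℚᵘ-injective (ℚᵘ.≃-trans (ℚ.toℚᵘ-fromℚᵘ (ℚᵘ.mkℚᵘ (a ℤ.+ b) 0))
  (ℚᵘ.≃-trans (ℚᵘ.*≡* (cong (ℤ._* (+ 1)) (sym (cong₂ ℤ._+_ (ℤ.*-identityʳ a) (ℤ.*-identityʳ b)))))
  (ℚᵘ.≃-trans (ℚᵘ.≃-sym (ℚᵘ.+-cong (ℚ.toℚᵘ-fromℚᵘ (ℚᵘ.mkℚᵘ a 0)) (ℚ.toℚᵘ-fromℚᵘ (ℚᵘ.mkℚᵘ b 0))))
    (ℚᵘ.≃-sym (ℚ.toℚᵘ-homo-+ (a ℚ./ 1) (b ℚ./ 1))))))

/1-homo-* : ∀ a b → (a ℤ.* b) ℚ./ 1 ≡ a ℚ./ 1 ℚ.* (b ℚ./ 1)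
/1-homo-* a b = ℚ.toℚᵘ-injective (ℚᵘ.≃-trans (ℚ.toℚᵘ-fromℚᵘ (ℚᵘ.mkℚᵘ (a ℤ.* b) 0))
  (ℚᵘ.≃-trans (ℚᵘ.≃-sym (ℚᵘ.*-cong (ℚ.toℚᵘ-fromℚᵘ (ℚᵘ.mkℚᵘ a 0)) (ℚ.toℚᵘ-fromℚᵘ (ℚᵘ.mkℚᵘ b 0))))
    (ℚᵘ.≃-sym (ℚ.toℚᵘ-homo-* (a ℚ./ 1) (b ℚ./ 1)))))

/1-homo-neg : ∀ a → (ℤ.- a) ℚ./ 1 ≡ ℚ.- (a ℚ./ 1)
/1-homo-neg a = ℚ.toℚᵘ-injective (ℚᵘ.≃-trans (ℚ.toℚᵘ-fromℚᵘ (ℚᵘ.mkℚᵘ (ℤ.- a) 0))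
  (ℚᵘ.≃-trans (ℚᵘ.≃-sym (ℚᵘ.-‿cong (ℚ.toℚᵘ-fromℚᵘ (ℚᵘ.mkℚᵘ a 0))))
    (ℚᵘ.≃-sym (ℚ.toℚᵘ-homo‿- (a ℚ./ 1)))))

/1-mono-≤ : ∀ {a b} → a ℤ.≤ b → a ℚ./ 1 ℚ.≤ b ℚ./ 1
/1-mono-≤ {a} {b} a≤b = ℚ.toℚᵘ-cancel-≤ (ℚᵘ.≤-respˡ-≃ (ℚᵘ.≃-sym (ℚ.toℚᵘ-fromℚᵘ (ℚᵘ.mkℚᵘ a 0)))
  (ℚᵘ.≤-respʳ-≃ (ℚᵘ.≃-sym (ℚ.toℚᵘ-fromℚᵘ (ℚᵘ.mkℚᵘ b 0))) (ℚᵘ.*≤* (ℤ.*-monoʳ-≤-nonNeg (+ 1) a≤b))))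

/1-mono-< : ∀ {a b} → a ℤ.< b → a ℚ./ 1 ℚ.< b ℚ./ 1
/1-mono-< {a} {b} a<b = ℚ.toℚᵘ-cancel-< (ℚᵘ.<-respˡ-≃ (ℚᵘ.≃-sym (ℚ.toℚᵘ-fromℚᵘ (ℚᵘ.mkℚᵘ a 0)))
  (ℚᵘ.<-respʳ-≃ (ℚᵘ.≃-sym (ℚ.toℚᵘ-fromℚᵘ (ℚᵘ.mkℚᵘ b 0))) (ℚᵘ.*<* (ℤ.*-monoʳ-<-pos (+ 1) a<b))))

-- Rayleigh quotients

module ℝR = CommutativeRing ℝ-commutativeRing
module Σℝ = SemiringSum ℝR.semiring
open Linear ℝ-commutativeRing renaming (_ᵀ to _ᵀᵣ; _⊗_ to _⊗ᵣ_; dot to dotᵣ; apply to applyᵣ;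
  dot-cong to dotᵣ-cong; dot-comm to dotᵣ-comm; dot-+ to dotᵣ-+; dot-* to dotᵣ-*;
  dot-adjoint to dotᵣ-adjoint; apply-⊗ to applyᵣ-⊗)

infixl 6 _⊕_
_⊕_ : ∀ {n} → Vector n → Vector n → Vector n
(u ⊕ v) i = u i +ᵣ v i

dotᵣ-⊕ˡ : ∀ {n} (u v w : Vector n) → dotᵣ (u ⊕ v) w ≈ dotᵣ u w +ᵣ dotᵣ v w
dotᵣ-⊕ˡ u v w = ≈-trans (dotᵣ-comm (u ⊕ v) w)
  (≈-trans (dotᵣ-+ w u v) (+ᵣ-cong (dotᵣ-comm w u) (dotᵣ-comm w v)))

dotᵣ-⋆ˡ : ∀ {n} c (u v : Vector n) → dotᵣ (c ⋆ u) v ≈ c *ᵣ dotᵣ u v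
dotᵣ-⋆ˡ c u v = ≈-trans (dotᵣ-comm (c ⋆ u) v)
  (≈-trans (dotᵣ-* v u c) (*ᵣ-cong ≈-refl (dotᵣ-comm v u)))

applyᵣ-⊕ : ∀ {m n} (A : Matrix ℝ m n) u v → A · (u ⊕ v) ≋ (A · u) ⊕ (A · v)
applyᵣ-⊕ A u v i = dotᵣ-+ (A i) u v

applyᵣ-⋆ : ∀ {m n} (A : Matrix ℝ m n) c u → A · (c ⋆ u) ≋ c ⋆ (A · u)
applyᵣ-⋆ A c u i = dotᵣ-* (A i) u c

·-cong : ∀ {m n} (A : Matrix ℝ m n) {u v} → u ≋ v → A · u ≋ A · v
·-cong A u≋v i = dotᵣ-cong (λ _ → ≈-refl) u≋v

dotᵣ-self-nonNegative : ∀ {n} (u : Vector n) → NonNegative (dotᵣ u u)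
dotᵣ-self-nonNegative {zero}  u n = ℚ.≤-refl
dotᵣ-self-nonNegative {suc m} u n = ℚ.+-mono-≤ (square-nonNeg (seq (u zero) n)) (dotᵣ-self-nonNegative (u ∘ suc) n)

lincomb : ∀ {n} → ℝ → Vector n → ℝ → Vector n → Vector n
lincomb a u b v = (a ⋆ u) ⊕ (b ⋆ v)

dotᵣ-lincomb : ∀ {n} a b (u v u′ v′ : Vector n) → dotᵣ (lincomb a u b v) (lincomb a u′ b v′) ≈
  a *ᵣ a *ᵣ dotᵣ u u′ +ᵣ a *ᵣ b *ᵣ (dotᵣ u v′ +ᵣ dotᵣ v u′) +ᵣ b *ᵣ b *ᵣ dotᵣ v v′
dotᵣ-lincomb a b u v u′ v′ = ≈-trans (dotᵣ-⊕ˡ (a ⋆ u) (b ⋆ v) (lincomb a u′ b v′))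
  (≈-trans (+ᵣ-cong (expand a u) (expand b v))
    (pointwise λ n → lemma (seq a n) (seq b n) (seq (dotᵣ u u′) n) (seq (dotᵣ u v′) n) (seq (dotᵣ v u′) n) (seq (dotᵣ v v′) n)))
  where
  expand : ∀ c w → dotᵣ (c ⋆ w) (lincomb a u′ b v′) ≈ c *ᵣ (a *ᵣ dotᵣ w u′ +ᵣ b *ᵣ dotᵣ w v′)
  expand c w = ≈-trans (dotᵣ-⋆ˡ c w (lincomb a u′ b v′)) (*ᵣ-cong ≈-refl
    (≈-trans (dotᵣ-+ w (a ⋆ u′) (b ⋆ v′)) (+ᵣ-cong (dotᵣ-* w u′ a) (dotᵣ-* w v′ b))))
  lemma : ∀ a b x y z w → a ℚ.* (a ℚ.* x ℚ.+ b ℚ.* y) ℚ.+ b ℚ.* (a ℚ.* z ℚ.+ b ℚ.* w) ≡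
          a ℚ.* a ℚ.* x ℚ.+ a ℚ.* b ℚ.* (y ℚ.+ z) ℚ.+ b ℚ.* b ℚ.* w
  lemma = RingSolver.solve-∀ ℚ-ring

-- For T = a₀e₀ + T′ the form λ₀⟨T, T⟩ - ⟨T, AT⟩ does not depend on a₀, because
-- A - λ₀ is self-adjoint and kills e₀.  Hence neither orthogonality of the
-- eigenvectors nor a decision which eigenvalues are equal is needed.
module _ {n} (A : Matrix ℝ n n) (self-adjoint : ∀ u v → dotᵣ (A · u) v ≈ dotᵣ u (A · v)) where

  rayleigh-≤ : ∀ {m} (e : Fin m → Vector n) (ev : Fin m → ℝ) → (∀ i → A · e i ≋ ev i ⋆ e i) →
    (∀ {i j} → i Fin.≤ j → ev j ≤ ev i) → ∀ μ → (∀ i → ev i ≤ μ) → ∀ a →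
    let T = combination a e in dotᵣ T (A · T) ≤ μ *ᵣ dotᵣ T T
  rayleigh-≤ {zero} e ev eigen mono μ ev≤μ a = ≤-reflexive (≈-trans (zero-dot (A · combination a e))
    (≈-trans (pointwise λ n → sym (ℚ.*-zeroʳ (seq μ n))) (*ᵣ-cong ≈-refl (≈-sym (zero-dot (combination a e))))))
    where
    zero-dot : ∀ v → dotᵣ 0ᵥ v ≈ 0ᵣ
    zero-dot v = ≈-trans (Σℝ.sum-cong-≋ λ i → ℝR.zeroˡ (v i)) (Σℝ.sum-replicate-zero n)
  rayleigh-≤ {suc m} e ev eigen mono μ ev≤μ a = ≤-trans (0≤y-x⇒x≤y
      (≤-trans (x≤y⇒0≤y-x IH) (≤-reflexive (≈-sym difference))))
    (*ᵣ-monoˡ-≤ {dotᵣ T T} (dotᵣ-self-nonNegative T) (ev≤μ zero))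
    where
    s = a zero
    l = ev zero
    e₀ = e zero
    T T′ : Vector n
    T = combination a e
    T′ = combination (a ∘ suc) (e ∘ suc)
    -- The induction runs with the leading eigenvalue `l` in place of `μ`, since the first
    -- coefficient drops out of the difference only for `l`. The step from `l` to `μ` comes last.
    IH : dotᵣ T′ (A · T′) ≤ l *ᵣ dotᵣ T′ T′
    IH = rayleigh-≤ (e ∘ suc) (ev ∘ suc) (eigen ∘ suc) (mono ∘ ℕ.s≤s) l (λ i → mono {zero} {suc i} ℕ.z≤n) (a ∘ suc)
    E = dotᵣ e₀ e₀
    P = dotᵣ e₀ T′
    Q = dotᵣ T′ T′
    R = dotᵣ T′ (A · T′)
    T≋ : T ≋ lincomb s e₀ 1ᵣ T′
    T≋ i = +ᵣ-cong ≈-refl (≈-sym (ℝR.*-identityˡ (T′ i)))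
    AT≋ : A · T ≋ lincomb s (l ⋆ e₀) 1ᵣ (A · T′)
    AT≋ i = ≈-trans (·-cong A T≋ i) (≈-trans (applyᵣ-⊕ A (s ⋆ e₀) (1ᵣ ⋆ T′) i)
      (+ᵣ-cong (≈-trans (applyᵣ-⋆ A s e₀ i) (*ᵣ-cong ≈-refl (eigen zero i))) (applyᵣ-⋆ A 1ᵣ T′ i)))
    TT : dotᵣ T T ≈ s *ᵣ s *ᵣ E +ᵣ s *ᵣ 1ᵣ *ᵣ (P +ᵣ P) +ᵣ 1ᵣ *ᵣ 1ᵣ *ᵣ Q
    TT = ≈-trans (dotᵣ-cong T≋ T≋) (≈-trans (dotᵣ-lincomb s 1ᵣ e₀ T′ e₀ T′)
      (+ᵣ-cong (+ᵣ-cong ≈-refl (*ᵣ-cong ≈-refl (+ᵣ-cong ≈-refl (dotᵣ-comm T′ e₀)))) ≈-refl))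
    TAT : dotᵣ T (A · T) ≈ s *ᵣ s *ᵣ (l *ᵣ E) +ᵣ s *ᵣ 1ᵣ *ᵣ (l *ᵣ P +ᵣ l *ᵣ P) +ᵣ 1ᵣ *ᵣ 1ᵣ *ᵣ R
    TAT = ≈-trans (dotᵣ-cong T≋ AT≋) (≈-trans (dotᵣ-lincomb s 1ᵣ e₀ T′ (l ⋆ e₀) (A · T′))
      (+ᵣ-cong (+ᵣ-cong (*ᵣ-cong ≈-refl (dotᵣ-* e₀ e₀ l)) (*ᵣ-cong ≈-refl (+ᵣ-cong
        (≈-trans (≈-sym (self-adjoint e₀ T′)) (≈-trans (dotᵣ-cong (eigen zero) (λ _ → ≈-refl)) (dotᵣ-⋆ˡ l e₀ T′)))
        (≈-trans (dotᵣ-* T′ e₀ l) (*ᵣ-cong ≈-refl (dotᵣ-comm T′ e₀)))))) ≈-refl))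
    difference : l *ᵣ dotᵣ T T -ᵣ dotᵣ T (A · T) ≈ l *ᵣ Q -ᵣ R
    difference = ≈-trans (+ᵣ-cong (*ᵣ-cong ≈-refl TT) (-ᵣ-cong TAT))
      (pointwise λ n → lemma (seq s n) (seq l n) (seq E n) (seq P n) (seq Q n) (seq R n))
      where
      lemma : ∀ s l E P Q R →
        l ℚ.* (s ℚ.* s ℚ.* E ℚ.+ s ℚ.* 1ℚ ℚ.* (P ℚ.+ P) ℚ.+ 1ℚ ℚ.* 1ℚ ℚ.* Q) ℚ.-
        (s ℚ.* s ℚ.* (l ℚ.* E) ℚ.+ s ℚ.* 1ℚ ℚ.* (l ℚ.* P ℚ.+ l ℚ.* P) ℚ.+ 1ℚ ℚ.* 1ℚ ℚ.* R) ≡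
        l ℚ.* Q ℚ.- R
      lemma = RingSolver.solve-∀ ℚ-ring

-- Integer forms at real arguments, and the Rayleigh bound on a hyperplane

fromℤ-+ : ∀ a b → fromℤ (a ℤ.+ b) ≈ fromℤ a +ᵣ fromℤ b
fromℤ-+ a b = pointwise λ _ → /1-homo-+ a b

fromℤ-* : ∀ a b → fromℤ (a ℤ.* b) ≈ fromℤ a *ᵣ fromℤ b
fromℤ-* a b = pointwise λ _ → /1-homo-* a b

fromℤ-sum : ∀ {n} (f : Fin n → ℤ) → fromℤ (sumℤ f) ≈ sumᵣ (fromℤ ∘ f)
fromℤ-sum {zero}  f = ≈-refl
fromℤ-sum {suc n} f = ≈-trans (fromℤ-+ (f zero) (sumℤ (f ∘ suc))) (+ᵣ-cong ≈-refl (fromℤ-sum (f ∘ suc)))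

fromℤ-dot : ∀ {n} (u v : Fin n → ℤ) → fromℤ (Linearℤ.dot u v) ≈ dotᵣ (fromℤ ∘ u) (fromℤ ∘ v)
fromℤ-dot u v = ≈-trans (fromℤ-sum (λ i → u i ℤ.* v i)) (Σℝ.sum-cong-≋ λ i → fromℤ-* (u i) (v i))

form : ℝ → ℝ → ℤ → ℤ → ℤ → ℝ
form a b p q r = a *ᵣ a *ᵣ fromℤ p +ᵣ a *ᵣ b *ᵣ (fromℤ q +ᵣ fromℤ q) +ᵣ b *ᵣ b *ᵣ fromℤ r

-- Completing the square: r times the form is (rb + qa)² + (pr - q²)a², and r > 0 can be cancelled.
form-nonNegative : ∀ {p q r} → PosForm p q r → ∀ a b → NonNegative (form a b p q r)
form-nonNegative {p} {q} {r} (posForm 0<r q²≤pr) a b n =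
  ℚ.*-cancelˡ-≤-pos r′ {{ℚ.positive (/1-mono-< 0<r)}} (subst₂ ℚ._≤_ (sym (ℚ.*-zeroʳ r′))
    (lemma (seq a n) (seq b n) p′ q′ r′)
    (ℚ.+-mono-≤ (square-nonNeg (r′ ℚ.* seq b n ℚ.+ q′ ℚ.* seq a n))
      (ℚ.≤-trans (ℚ.≤-reflexive (sym (ℚ.*-zeroˡ (seq a n ℚ.* seq a n))))
        (ℚ.*-monoʳ-≤-nonNeg (seq a n ℚ.* seq a n) {{ℚ.nonNegative (square-nonNeg (seq a n))}} det))))
  where
  p′ = p ℚ./ 1
  q′ = q ℚ./ 1
  r′ = r ℚ./ 1
  det : 0ℚ ℚ.≤ p′ ℚ.* r′ ℚ.- q′ ℚ.* q′
  det = subst (ℚ._≤ p′ ℚ.* r′ ℚ.- q′ ℚ.* q′) (ℚ.+-inverseʳ (q′ ℚ.* q′)) (ℚ.+-monoˡ-≤ (ℚ.- (q′ ℚ.* q′))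
    (subst₂ ℚ._≤_ (/1-homo-* q q) (/1-homo-* p r) (/1-mono-≤ q²≤pr)))
  lemma : ∀ a b p q r → (r ℚ.* b ℚ.+ q ℚ.* a) ℚ.* (r ℚ.* b ℚ.+ q ℚ.* a) ℚ.+ (p ℚ.* r ℚ.- q ℚ.* q) ℚ.* (a ℚ.* a) ≡
          r ℚ.* (a ℚ.* a ℚ.* p ℚ.+ a ℚ.* b ℚ.* (q ℚ.+ q) ℚ.+ b ℚ.* b ℚ.* r)
  lemma = RingSolver.solve-∀ ℚ-ring

form-combine : ∀ a b c p q r p′ q′ r′ →
  form a b (p ℤ.- c ℤ.* p′) (q ℤ.- c ℤ.* q′) (r ℤ.- c ℤ.* r′) ≈
  form a b p q r -ᵣ fromℤ c *ᵣ form a b p′ q′ r′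
form-combine a b c p q r p′ q′ r′ = pointwise λ n → trans
  (cong₂ ℚ._+_ (cong₂ (λ x y → seq a n ℚ.* seq a n ℚ.* x ℚ.+ seq a n ℚ.* seq b n ℚ.* (y ℚ.+ y)) (entry p p′) (entry q q′))
    (cong (seq b n ℚ.* seq b n ℚ.*_) (entry r r′)))
  (lemma (seq a n) (seq b n) (c ℚ./ 1) (p ℚ./ 1) (q ℚ./ 1) (r ℚ./ 1) (p′ ℚ./ 1) (q′ ℚ./ 1) (r′ ℚ./ 1))
  where
  entry : ∀ x y → (x ℤ.- c ℤ.* y) ℚ./ 1 ≡ x ℚ./ 1 ℚ.- c ℚ./ 1 ℚ.* (y ℚ./ 1)
  entry x y = trans (/1-homo-+ x (ℤ.- (c ℤ.* y))) (cong (x ℚ./ 1 ℚ.+_)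
    (trans (/1-homo-neg (c ℤ.* y)) (cong ℚ.-_ (/1-homo-* c y))))
  lemma : ∀ a b c p q r p′ q′ r′ →
    a ℚ.* a ℚ.* (p ℚ.- c ℚ.* p′) ℚ.+ a ℚ.* b ℚ.* ((q ℚ.- c ℚ.* q′) ℚ.+ (q ℚ.- c ℚ.* q′)) ℚ.+ b ℚ.* b ℚ.* (r ℚ.- c ℚ.* r′) ≡
    a ℚ.* a ℚ.* p ℚ.+ a ℚ.* b ℚ.* (q ℚ.+ q) ℚ.+ b ℚ.* b ℚ.* r ℚ.-
    c ℚ.* (a ℚ.* a ℚ.* p′ ℚ.+ a ℚ.* b ℚ.* (q′ ℚ.+ q′) ℚ.+ b ℚ.* b ℚ.* r′)
  lemma = RingSolver.solve-∀ ℚ-ring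

dotᵣ-form : ∀ {n} a b (u v : Fin n → ℤ) →
  let w = lincomb a (fromℤ ∘ u) b (fromℤ ∘ v) in
  dotᵣ w w ≈ form a b (Linearℤ.dot u u) (Linearℤ.dot u v) (Linearℤ.dot v v)
dotᵣ-form a b u v = ≈-trans (dotᵣ-lincomb a b u′ v′ u′ v′)
  (+ᵣ-cong (+ᵣ-cong (*ᵣ-cong ≈-refl (≈-sym (fromℤ-dot u u))) (*ᵣ-cong ≈-refl
      (+ᵣ-cong (≈-sym (fromℤ-dot u v)) (≈-trans (dotᵣ-comm v′ u′) (≈-sym (fromℤ-dot u v))))))
    (*ᵣ-cong ≈-refl (≈-sym (fromℤ-dot v v))))
  where
  u′ = fromℤ ∘ u
  v′ = fromℤ ∘ v

nonNegative⇒0≤ : ∀ {x} → NonNegative x → 0ᵣ ≤ x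
nonNegative⇒0≤ = pointwise-≤

module _ {n} (A : Matrix ℝ n n) (self-adjoint : ∀ u v → dotᵣ (A · u) v ≈ dotᵣ u (A · v)) where

  -- `α` and `β` are the coordinates of `u` and `v` along the first eigenvector. When the combined
  -- coordinate vanishes, `X` lies in the span of the other eigenvectors, whose eigenvalues are at
  -- most the second.
  hyperplane-rayleigh-≤ : ∀ {ev} → Eigenvalues A ev → (p : 1 ℕ.< n) → ∀ u v → ∃ λ α → ∃ λ β → ∀ a b →
    a *ᵣ α +ᵣ b *ᵣ β ≈ 0ᵣ → let X = lincomb a u b v in dotᵣ X (A · X) ≤ ev (fromℕ< p) *ᵣ dotᵣ X X
  -- Matching on the proof of 1 < n makes `fromℕ< p` compute to `suc zero`.
  hyperplane-rayleigh-≤ eigenvalues (ℕ.s≤s (ℕ.s≤s _)) u v =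
    α zero , β zero , λ a b vanish →
      let X = lincomb a u b v
          γ = lincomb a α b β
          T = combination (γ ∘ suc) (e ∘ suc)
          X≋T : X ≋ T
          X≋T i = ≈-trans (+ᵣ-cong (*ᵣ-cong ≈-refl (u≋ i)) (*ᵣ-cong ≈-refl (v≋ i)))
            (≈-trans (≈-sym (≈-trans (dotᵣ-⊕ˡ (a ⋆ α) (b ⋆ β) (λ l → e l i))
                (+ᵣ-cong (dotᵣ-⋆ˡ a α (λ l → e l i)) (dotᵣ-⋆ˡ b β (λ l → e l i)))))
              (≈-trans (+ᵣ-cong (≈-trans (*ᵣ-cong vanish ≈-refl) (ℝR.zeroˡ (e zero i))) ≈-refl) (ℝR.+-identityˡ (T i))))
      in ≤-trans (≤-reflexive (dotᵣ-cong X≋T (·-cong A X≋T)))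
        (≤-trans (rayleigh-≤ A self-adjoint (e ∘ suc) _ (isEigenvector ∘ suc) (nonincreasing ∘ ℕ.s≤s)
            _ (λ i → nonincreasing {suc zero} {suc i} (ℕ.s≤s ℕ.z≤n)) (γ ∘ suc))
          (≤-reflexive (*ᵣ-cong ≈-refl (≈-sym (dotᵣ-cong X≋T X≋T)))))
    where
    open Eigenvalues eigenvalues renaming (eigenvector to e)
    α = proj₁ (IsBasis.spanning isBasis u)
    β = proj₁ (IsBasis.spanning isBasis v)
    u≋ = proj₂ (IsBasis.spanning isBasis u)
    v≋ = proj₂ (IsBasis.spanning isBasis v)

-- From a test plane to the second eigenvalue of BBᵀ

module _ {n m} (B : Matrix ℤ n m) (L : Matrix ℤ n n)
         (L≡BBᵀ : ∀ i i′ → L i i′ ≡ sumℤ λ j → B i j ℤ.* B i′ j) where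

  private
    A = realMatrix L
    Bᵣ = realMatrix B

  BBᵀ-apply : ∀ v → A · v ≋ Bᵣ · ((Bᵣ ᵀᵣ) · v)
  BBᵀ-apply v i = ≈-trans (dotᵣ-cong {v = v} entry (λ _ → ≈-refl)) (applyᵣ-⊗ Bᵣ (Bᵣ ᵀᵣ) v i)
    where
    entry : ∀ i′ → A i i′ ≈ (Bᵣ ⊗ᵣ (Bᵣ ᵀᵣ)) i i′
    entry i′ = ≈-trans (pointwise λ _ → cong (λ x → x ℚ./ 1) (L≡BBᵀ i i′)) (fromℤ-dot (B i) (B i′))

  dotᵣ-BBᵀ : ∀ u v → dotᵣ u (A · v) ≈ dotᵣ ((Bᵣ ᵀᵣ) · u) ((Bᵣ ᵀᵣ) · v)
  dotᵣ-BBᵀ u v = ≈-trans (dotᵣ-cong {u = u} (λ _ → ≈-refl) (BBᵀ-apply v)) (dotᵣ-adjoint Bᵣ u ((Bᵣ ᵀᵣ) · v))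

  self-adjoint : ∀ u v → dotᵣ (A · u) v ≈ dotᵣ u (A · v)
  self-adjoint u v = ≈-trans (dotᵣ-comm (A · u) v) (≈-trans (dotᵣ-BBᵀ v u)
    (≈-trans (dotᵣ-comm ((Bᵣ ᵀᵣ) · v) ((Bᵣ ᵀᵣ) · u)) (≈-sym (dotᵣ-BBᵀ u v))))

  module _ (c : ℤ) (1≤c : 1ℤ ℤ.≤ c) (vectors : TestVectors B c) where

    open TestVectors vectors

    private
      cᵣ = fromℤ c

      w₁ w₂ : Vector n
      w₁ = fromℤ ∘ Linearℤ.apply B y
      w₂ = fromℤ ∘ Linearℤ.apply B z

      0≤c : NonNegative cᵣ
      0≤c _ = /1-mono-≤ {0ℤ} {c} (ℤ.≤-trans (ℤ.+≤+ ℕ.z≤n) 1≤c)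

      module Span (a b : ℝ) where
        X : Vector n
        X = lincomb a w₁ b w₂
        Y : Vector m
        Y = lincomb a (fromℤ ∘ y) b (fromℤ ∘ z)
        g : Vector m
        g = (Bᵣ ᵀᵣ) · X
        S = dotᵣ X X
        D = dotᵣ Y Y

        open Linearℤ using (dot)
        By = Linearℤ.apply B y
        Bz = Linearℤ.apply B z

        X≋BY : X ≋ Bᵣ · Y
        X≋BY i = ≈-sym (≈-trans (applyᵣ-⊕ Bᵣ (a ⋆ (fromℤ ∘ y)) (b ⋆ (fromℤ ∘ z)) i)
          (+ᵣ-cong (≈-trans (applyᵣ-⋆ Bᵣ a (fromℤ ∘ y) i) (*ᵣ-cong ≈-refl (≈-sym (fromℤ-dot (B i) y))))
                   (≈-trans (applyᵣ-⋆ Bᵣ b (fromℤ ∘ z) i) (*ᵣ-cong ≈-refl (≈-sym (fromℤ-dot (B i) z))))))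

        S≈gY : S ≈ dotᵣ g Y
        S≈gY = ≈-trans (dotᵣ-cong {u = X} (λ _ → ≈-refl) X≋BY) (dotᵣ-adjoint Bᵣ X Y)

        0≤S-cD : 0ᵣ ≤ S -ᵣ cᵣ *ᵣ D
        0≤S-cD = ≤-trans (nonNegative⇒0≤ (form-nonNegative excess a b)) (≤-reflexive (≈-trans
          (form-combine a b c (dot By By) (dot By Bz) (dot Bz Bz) (dot y y) (dot y z) (dot z z))
          (+ᵣ-cong (≈-sym (dotᵣ-form a b By Bz))
                   (-ᵣ-cong (*ᵣ-cong ≈-refl (≈-sym (dotᵣ-form a b y z)))))))

        -- ⟨X, AX⟩ - c⟨X, X⟩ = |g - cY|² + c(|X|² - c|Y|²), as ⟨g, Y⟩ = |X|².
        cS≤XAX : cᵣ *ᵣ S ≤ dotᵣ X (A · X)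
        cS≤XAX = 0≤y-x⇒x≤y (≤-trans
          (≤-trans (≤-reflexive (pointwise λ n → lemma₀ (seq cᵣ n)))
            (+ᵣ-mono-≤ (nonNegative⇒0≤ (dotᵣ-self-nonNegative h)) (*ᵣ-monoˡ-≤ {cᵣ} 0≤c 0≤S-cD)))
          (≤-reflexive (≈-sym (≈-trans (+ᵣ-cong (dotᵣ-BBᵀ X X) ≈-refl)
            (≈-sym (≈-trans (+ᵣ-cong h² ≈-refl)
              (pointwise λ n → lemma (seq (dotᵣ g g) n) (seq S n) (seq D n) (seq cᵣ n))))))))
          where
          h : Vector m
          h = lincomb 1ᵣ g (-ᵣ cᵣ) Y
          h² : dotᵣ h h ≈ 1ᵣ *ᵣ 1ᵣ *ᵣ dotᵣ g g +ᵣ 1ᵣ *ᵣ (-ᵣ cᵣ) *ᵣ (S +ᵣ S) +ᵣ (-ᵣ cᵣ) *ᵣ (-ᵣ cᵣ) *ᵣ D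
          h² = ≈-trans (dotᵣ-lincomb 1ᵣ (-ᵣ cᵣ) g Y g Y) (+ᵣ-cong (+ᵣ-cong ≈-refl (*ᵣ-cong ≈-refl
            (+ᵣ-cong (≈-sym S≈gY) (≈-trans (dotᵣ-comm Y g) (≈-sym S≈gY))))) ≈-refl)
          lemma₀ : ∀ c → 0ℚ ≡ 0ℚ ℚ.+ 0ℚ ℚ.* c
          lemma₀ = RingSolver.solve-∀ ℚ-ring
          lemma : ∀ g S D c → 1ℚ ℚ.* 1ℚ ℚ.* g ℚ.+ 1ℚ ℚ.* (ℚ.- c) ℚ.* (S ℚ.+ S) ℚ.+ (ℚ.- c) ℚ.* (ℚ.- c) ℚ.* D ℚ.+
                  (S ℚ.- c ℚ.* D) ℚ.* c ≡ g ℚ.- c ℚ.* S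
          lemma = RingSolver.solve-∀ ℚ-ring

        -- Nondegeneracy in quantitative form, so that a bound on `X` passes to its coefficients.
        -- The condition `independent` gives a² + b² ≤ 2|Y|², and c ≥ 1 gives |Y|² ≤ c|Y|² ≤ |X|².
        a²+b²≤2S : a *ᵣ a +ᵣ b *ᵣ b ≤ S +ᵣ S
        a²+b²≤2S = ≤-trans (0≤y-x⇒x≤y (≤-trans (nonNegative⇒0≤ (form-nonNegative independent a b)) (≤-reflexive
            (≈-trans split (+ᵣ-cong (+ᵣ-cong (≈-sym (dotᵣ-form a b y z)) (≈-sym (dotᵣ-form a b y z))) ≈-refl)))))
          (+ᵣ-mono-≤ D≤S D≤S)
          where
          D≤S : D ≤ S
          D≤S = ≤-trans (≤-trans (≤-reflexive (pointwise λ n → sym (ℚ.*-identityˡ (seq D n))))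
            (*ᵣ-monoˡ-≤ {D} (dotᵣ-self-nonNegative Y) (pointwise-≤ {1ᵣ} {cᵣ} λ _ → /1-mono-≤ 1≤c)))
            (0≤y-x⇒x≤y 0≤S-cD)
          p = Linearℤ.dot y y
          q = Linearℤ.dot y z
          r = Linearℤ.dot z z
          split : form a b (p ℤ.+ p ℤ.- 1ℤ) (q ℤ.+ q) (r ℤ.+ r ℤ.- 1ℤ) ≈
                  (form a b p q r +ᵣ form a b p q r) -ᵣ (a *ᵣ a +ᵣ b *ᵣ b)
          split = pointwise λ n → trans
            (cong₂ ℚ._+_ (cong₂ (λ x y → seq a n ℚ.* seq a n ℚ.* x ℚ.+ seq a n ℚ.* seq b n ℚ.* (y ℚ.+ y)) (entry p) (/1-homo-+ q q))
              (cong (seq b n ℚ.* seq b n ℚ.*_) (entry r)))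
            (lemma (seq a n) (seq b n) (p ℚ./ 1) (q ℚ./ 1) (r ℚ./ 1))
            where
            entry : ∀ x → (x ℤ.+ x ℤ.- 1ℤ) ℚ./ 1 ≡ x ℚ./ 1 ℚ.+ x ℚ./ 1 ℚ.- 1ℚ
            entry x = trans (/1-homo-+ (x ℤ.+ x) -1ℤ) (cong (ℚ._- 1ℚ) (/1-homo-+ x x))
            lemma : ∀ a b p q r →
              a ℚ.* a ℚ.* (p ℚ.+ p ℚ.- 1ℚ) ℚ.+ a ℚ.* b ℚ.* ((q ℚ.+ q) ℚ.+ (q ℚ.+ q)) ℚ.+ b ℚ.* b ℚ.* (r ℚ.+ r ℚ.- 1ℚ) ≡
              (a ℚ.* a ℚ.* p ℚ.+ a ℚ.* b ℚ.* (q ℚ.+ q) ℚ.+ b ℚ.* b ℚ.* r ℚ.+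
               (a ℚ.* a ℚ.* p ℚ.+ a ℚ.* b ℚ.* (q ℚ.+ q) ℚ.+ b ℚ.* b ℚ.* r)) ℚ.-
              (a ℚ.* a ℚ.+ b ℚ.* b)
            lemma = RingSolver.solve-∀ ℚ-ring

    module _ (μ : ℝ) (δ : ℚ) (0<δ : 0ℚ ℚ.< δ) (μ+δ≤c : μ +ᵣ const δ ≤ cᵣ) where

      -- The chain (μ + δ)S ≤ cS ≤ ⟨X, AX⟩ ≤ μS leaves δS ≤ 0. The gap δ is a positive rational and
      -- can be divided out, and the coefficients follow `S`.
      span-vanishes : ∀ a b → let open Span a b in
                      dotᵣ X (A · X) ≤ μ *ᵣ S → a *ᵣ a +ᵣ b *ᵣ b ≤ 0ᵣ
      span-vanishes a b XAX≤μS = ≤-trans a²+b²≤2S (≤-trans (+ᵣ-mono-≤ S≤0 S≤0) (≤-reflexive (pointwise λ _ → refl)))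
        where
        open Span a b
        δ⁻¹ = proj₁ (quotient δ 0<δ 1ℚ (ℚ.positive⁻¹ 1ℚ))
        0<δ⁻¹ = proj₁ (proj₂ (quotient δ 0<δ 1ℚ (ℚ.positive⁻¹ 1ℚ)))
        δδ⁻¹≡1 = proj₂ (proj₂ (quotient δ 0<δ 1ℚ (ℚ.positive⁻¹ 1ℚ)))
        δS≤0 : const δ *ᵣ S ≤ 0ᵣ
        δS≤0 = ≤-trans (≤-reflexive (pointwise λ n → lemma (seq μ n) δ (seq S n)))
          (≤-trans (+ᵣ-mono-≤
              (≤-trans (*ᵣ-monoˡ-≤ {S} (dotᵣ-self-nonNegative X) μ+δ≤c) (≤-trans cS≤XAX XAX≤μS))
              (≤-reflexive (≈-refl { -ᵣ (μ *ᵣ S)})))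
            (≤-reflexive (pointwise λ n → ℚ.+-inverseʳ (seq μ n ℚ.* seq S n))))
          where
          lemma : ∀ μ δ S → δ ℚ.* S ≡ (μ ℚ.+ δ) ℚ.* S ℚ.- μ ℚ.* S
          lemma = RingSolver.solve-∀ ℚ-ring
        S≤0 : S ≤ 0ᵣ
        S≤0 = ≤-trans (≤-reflexive (pointwise λ n → cancel (seq S n)))
          (≤-trans (*ᵣ-monoˡ-≤ {const δ⁻¹} (λ _ → ℚ.<⇒≤ 0<δ⁻¹) δS≤0)
            (≤-reflexive (pointwise λ _ → ℚ.*-zeroˡ δ⁻¹)))
          where
          lemma : ∀ S δ γ → δ ℚ.* S ℚ.* γ ≡ (δ ℚ.* γ) ℚ.* S
          lemma = RingSolver.solve-∀ ℚ-ring
          cancel : ∀ S → S ≡ δ ℚ.* S ℚ.* δ⁻¹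
          cancel S = sym (trans (lemma S δ δ⁻¹) (trans (cong (ℚ._* S) δδ⁻¹≡1) (ℚ.*-identityˡ S)))

    -- The plane must meet the hyperplane aα + bβ = 0 in a nonzero vector, without deciding whether
    -- α and β vanish. Under the contrary assumption the solution (β, -α) yields β² + α² ≤ 0, so α ≈
    -- 0; then (1, 0) is a solution too and yields 1 ≤ 0.
    second-eigenvalue-≥ : ∀ {ev} → Eigenvalues A ev → (p : 1 ℕ.< n) → fromℤ c ≤ ev (fromℕ< p)
    second-eigenvalue-≥ {ev} eigenvalues p = ≤-by-contradiction (c ℚ./ 1) (ev (fromℕ< p)) λ δ 0<δ below →
      let α , β , bound = hyperplane-rayleigh-≤ A self-adjoint eigenvalues p w₁ w₂
          vanish : ∀ a b → a *ᵣ α +ᵣ b *ᵣ β ≈ 0ᵣ → a *ᵣ a +ᵣ b *ᵣ b ≤ 0ᵣ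
          vanish a b eq = span-vanishes (ev (fromℕ< p)) δ 0<δ below a b (bound a b eq)
          α²≤0 : α *ᵣ α ≤ 0ᵣ
          α²≤0 = ≤-trans (pointwise-≤ λ n → lemma₁ (seq β n) (seq α n))
            (vanish β (-ᵣ α) (pointwise λ n → lemma₂ (seq α n) (seq β n)))
          1≤0 : 1ᵣ *ᵣ 1ᵣ +ᵣ 0ᵣ *ᵣ 0ᵣ ≤ 0ᵣ
          1≤0 = vanish 1ᵣ 0ᵣ (≈-trans (+ᵣ-cong (ℝR.*-identityˡ α) (ℝR.zeroˡ β))
            (≈-trans (ℝR.+-identityʳ α) (sq≤0⇒≈0 α²≤0)))
          N , h = _≤_.below 1≤0 ½ (ℚ.positive⁻¹ ½)
      in from-no (1ℚ ℚ.<? ½) (h N ℕ.≤-refl)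
      where
      lemma₁ : ∀ b a → a ℚ.* a ℚ.≤ b ℚ.* b ℚ.+ ℚ.- a ℚ.* ℚ.- a
      lemma₁ b a = subst₂ ℚ._≤_ (ℚ.+-identityˡ (a ℚ.* a)) (cong (b ℚ.* b ℚ.+_) (neg² a))
        (ℚ.+-monoˡ-≤ (a ℚ.* a) (square-nonNeg b))
        where
        neg² : ∀ a → a ℚ.* a ≡ ℚ.- a ℚ.* ℚ.- a
        neg² = RingSolver.solve-∀ ℚ-ring
      lemma₂ : ∀ a b → b ℚ.* a ℚ.+ ℚ.- a ℚ.* b ≡ 0ℚ
      lemma₂ = RingSolver.solve-∀ ℚ-ring

-- The two largest ridge degrees

distinct⇒1< : ∀ {n} {i j : Fin n} → i ≢ j → 1 ℕ.< n
distinct⇒1< {suc zero}    {zero} {zero} i≢j = contradiction refl i≢j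
distinct⇒1< {suc (suc _)} _ = ℕ.s≤s (ℕ.s≤s ℕ.z≤n)

lookup-map : ∀ {A B : Set} (f : A → B) xs i → lookup (map f xs) i ≡ f (lookup xs (cast (length-map f xs) i))
lookup-map f (x ∷ xs) zero    = refl
lookup-map f (x ∷ xs) (suc i) = lookup-map f xs i

module _ {N} (K : SimplicialComplex N) (k : ℕ) where

  private
    ≥-order = Flip.decTotalOrder ℕ.≤-decTotalOrder
    degrees = ridgeDegrees K k
  open Sort ≥-order using (sort; sort-↭; sort-↗)

  private
    π = Permutation.onIndices (↭⇒↭ₛ (sort-↭ degrees))

    sorted-index : Fin (#faces K k) → Fin (length (sort degrees))
    sorted-index = cast (length-degrees K k)

  -- Follows the permutation performed by the sort, so that different positions give different
  -- ridges even when their degrees coincide.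
  ridgeOfRank : Fin (#faces K k) → Fin (#faces K k)
  ridgeOfRank i = cast (length-map (upperDegree K k) (faces K k)) (Inverse.to π (sorted-index i))

  degree-ridgeOfRank : ∀ i → degree K k i ≡ upperDegree K k (face K k (ridgeOfRank i))
  degree-ridgeOfRank i = trans
    (PermutationSetoid.onIndices-lookup (setoid ℕ) (↭⇒↭ₛ (sort-↭ degrees)) (sorted-index i))
    (lookup-map (upperDegree K k) (faces K k) (Inverse.to π (sorted-index i)))

  ridgeOfRank-injective : ∀ {i j} → ridgeOfRank i ≡ ridgeOfRank j → i ≡ j
  ridgeOfRank-injective eq = cast-injective (length-degrees K k)
    (Injection.injective (↔⇒↣ π) (cast-injective (length-map (upperDegree K k) (faces K k)) eq))
    where
    cast-injective : ∀ {m n} (eq : m ≡ n) {i j : Fin m} → cast eq i ≡ cast eq j → i ≡ j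
    cast-injective eq {i} {j} c = Fin.toℕ-injective (trans (sym (Fin.toℕ-cast eq i)) (trans (cong toℕ c) (Fin.toℕ-cast eq j)))

  degree-antitone : ∀ {i j} → i Fin.≤ j → degree K k j ℕ.≤ degree K k i
  degree-antitone {i} {j} i≤j = Sorted.lookup-mono-≤ (DecTotalOrder.totalOrder ≥-order) (sort-↗ degrees)
    (subst₂ ℕ._≤_ (sym (Fin.toℕ-cast (length-degrees K k) i)) (sym (Fin.toℕ-cast (length-degrees K k) j)) i≤j)

two-elements : ∀ {n} → 2 ℕ.≤ n → ∃ λ (i : Fin n) → ∃ λ j → i ≢ j
two-elements (ℕ.s≤s (ℕ.s≤s _)) = zero , suc zero , λ ()

fromℤ-shift-≤ : ∀ d k {c x} → + d ℤ.+ + k ℤ.- 1ℤ ℤ.≤ c → fromℤ c ≤ x → fromℕ d +ᵣ fromℕ k -ᵣ fromℕ 1 ≤ x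
fromℤ-shift-≤ d k {c} d+k-1≤c c≤x = ≤-trans
  (≤-reflexive (pointwise λ _ → sym (trans (/1-homo-+ (+ d ℤ.+ + k) -1ℤ)
    (cong (ℚ._- 1ℚ) (/1-homo-+ (+ d) (+ k))))))
  (≤-trans (pointwise-≤ {fromℤ (+ d ℤ.+ + k ℤ.- 1ℤ)} {fromℤ c} λ _ → /1-mono-≤ d+k-1≤c) c≤x)

-- Choice of the test plane and conclusion

module _ {N} (K : SimplicialComplex N) (o : Orientation K) (k : ℕ) where

  open UpGram K o k

  -- Since k ≥ 1, a k-face has two vertices, and removing one or the other gives different ridges.
  -- This guarantees that d₂ and λ₂ exist.
  two-ridges : 1 ℕ.≤ k → Fin (#faces K (suc k)) → 1 ℕ.< #faces K k
  two-ridges 1≤k f = distinct⇒1< {i = proj₁ (row q)} {proj₁ (row q′)} λ i≡i′ →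
    q≢q′ (vertex-injective (o (suc k) f) (removed-unique (v∈ q) (v∈ q′)
      (trans (sym (proj₂ (row q))) (trans (cong ρ i≡i′) (proj₂ (row q′))))))
    where
    q q′ : Fin (suc k)
    q = proj₁ (two-elements (ℕ.s≤s 1≤k))
    q′ = proj₁ (proj₂ (two-elements (ℕ.s≤s 1≤k)))
    q≢q′ = proj₂ (proj₂ (two-elements (ℕ.s≤s 1≤k)))
    v∈ : ∀ q → vertex (o (suc k) f) q ∈ F f
    v∈ q = proj₂ (Inverse.to (o (suc k) f) q)
    row : ∀ q → ∃ λ i → ρ i ≡ F f - vertex (o (suc k) f) q
    row q = removed-face (v∈ q)

  -- The constant may exceed the target: two k-faces always give k, which is one more than needed
  -- when d₂ = 0.
  TestPlane : ℕ → Set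
  TestPlane d₂ = ∃ λ c → 1ℤ ℤ.≤ c × TestVectors B c × + d₂ ℤ.+ + k ℤ.- 1ℤ ℤ.≤ c

  facePlane : 1 ℕ.≤ k → 2 ℕ.≤ #faces K (suc k) → ∀ {d₂} → d₂ ℕ.≤ 1 → TestPlane d₂
  facePlane 1≤k 2≤m {d₂} d₂≤1 = + k , ℤ.+≤+ 1≤k
    , faceVectors K o k (proj₁ (two-elements 2≤m)) (proj₁ (proj₂ (two-elements 2≤m))) (proj₂ (proj₂ (two-elements 2≤m)))
    , subst (+ d₂ ℤ.+ + k ℤ.- 1ℤ ℤ.≤_) (lemma (+ k)) (ℤ.+-monoˡ-≤ -1ℤ (ℤ.+-monoˡ-≤ (+ k) (ℤ.+≤+ d₂≤1)))
    where
    lemma : ∀ κ → 1ℤ ℤ.+ κ ℤ.- 1ℤ ≡ κ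
    lemma = ℤ-Solver.solve-∀

  ridgePlane : 1 ℕ.≤ k → ∀ {d₁ d₂} → 2 ℕ.≤ d₂ → d₂ ℕ.≤ d₁ → ∀ r s → r ≢ s →
    d₁ ≡ upperDegree K k (face K k r) → d₂ ≡ upperDegree K k (face K k s) → TestPlane d₂
  ridgePlane 1≤k {d₁} {d₂} 2≤d₂ d₂≤d₁ r s r≢s dr ds = d s ℤ.+ + k ℤ.- 1ℤ
    , subst (λ x → 1ℤ ℤ.≤ x ℤ.+ + k ℤ.- 1ℤ) (sym ds≡)
        (ℤ.≤-trans (ℤ.+≤+ (ℕ.s≤s ℕ.z≤n)) (ℤ.+-monoˡ-≤ -1ℤ (ℤ.+-mono-≤ (ℤ.+≤+ 2≤d₂) (ℤ.+≤+ 1≤k))))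
    , ridgeVectors K o k r s r≢s (subst₂ ℤ._≤_ (sym ds≡) (sym dr≡) (ℤ.+≤+ d₂≤d₁))
        (subst (+ 2 ℤ.≤_) (sym ds≡) (ℤ.+≤+ 2≤d₂))
    , ℤ.≤-reflexive (cong (λ x → x ℤ.+ + k ℤ.- 1ℤ) (sym ds≡))
    where
    ds≡ : d s ≡ + d₂
    ds≡ = trans (d≡upperDegree s) (cong +_ (sym ds))
    dr≡ : d r ≡ + d₁
    dr≡ = trans (d≡upperDegree r) (cong +_ (sym dr))

  testPlane : 1 ℕ.≤ k → 2 ℕ.≤ #faces K (suc k) → (i j : Fin (#faces K k)) → toℕ i ℕ.< toℕ j →
              TestPlane (degree K k j)
  testPlane 1≤k 2≤m i j i<j = by-cases (degree K k j ℕ.≤? 1)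
    where
    by-cases : Dec (degree K k j ℕ.≤ 1) → TestPlane (degree K k j)
    by-cases (yes d₂≤1) = facePlane 1≤k 2≤m d₂≤1
    by-cases (no  d₂≰1) = ridgePlane 1≤k {degree K k i} {degree K k j} (ℕ.≰⇒> d₂≰1) (degree-antitone K k (ℕ.<⇒≤ i<j))
      (ridgeOfRank K k i) (ridgeOfRank K k j) (λ eq → ℕ.<⇒≢ i<j (cong toℕ (ridgeOfRank-injective K k eq)))
      (degree-ridgeOfRank K k i) (degree-ridgeOfRank K k j)

  λ₂-≥ : ∀ {d₂} → TestPlane d₂ → ∀ {ev} → Eigenvalues (realMatrix (upLaplacian K o k)) ev → (p : 1 ℕ.< #faces K k) →
         fromℕ d₂ +ᵣ fromℕ k -ᵣ fromℕ 1 ≤ ev (fromℕ< p)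
  λ₂-≥ {d₂} (c , 1≤c , vectors , d₂+k-1≤c) eigenvalues p = fromℤ-shift-≤ d₂ k d₂+k-1≤c
    (second-eigenvalue-≥ B (upLaplacian K o k) L≡BBᵀ c 1≤c vectors eigenvalues p)
    where
    L≡BBᵀ : ∀ i i′ → upLaplacian K o k i i′ ≡ sumℤ λ j → B i j ℤ.* B i′ j
    L≡BBᵀ i i′ = cong (λ A → sumℤ λ j → A i j ℤ.* A i′ j) (sym B≡boundary)

theorem5p1 : ∀ {N} (K : SimplicialComplex N) (k : ℕ) → 1 ≤ℕ k → HasDimension K k →
    2 ≤ℕ #faces K (suc k) →
    (o : Orientation K) (ev : Fin (#faces K k) → ℝ) →
    Eigenvalues (realMatrix (upLaplacian K o k)) ev →
    Σ[ p ∈ 1 <ℕ #faces K k ]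
    ev (fromℕ< p) ≥ fromℕ (degree K k (fromℕ< p)) +ᵣ fromℕ k -ᵣ fromℕ 1
theorem5p1 K k 1≤k _ 2≤m o ev eigenvalues = 1<n ,
  λ₂-≥ K o k {degree K k (fromℕ< 1<n)} (testPlane K o k 1≤k 2≤m (fromℕ< 0<n) (fromℕ< 1<n) 0<1) eigenvalues 1<n
  where
  1<n : 1 ℕ.< #faces K k
  1<n = two-ridges K o k 1≤k (fromℕ< (ℕ.<⇒≤ 2≤m))
  0<n : 0 ℕ.< #faces K k
  0<n = ℕ.<⇒≤ 1<n
  0<1 : toℕ (fromℕ< 0<n) ℕ.< toℕ (fromℕ< 1<n)
  0<1 = subst₂ ℕ._<_ (sym (Fin.toℕ-fromℕ< 0<n)) (sym (Fin.toℕ-fromℕ< 1<n)) (ℕ.s≤s ℕ.z≤n)
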